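{- For all $h\ge2$, there exist $u_0,\dots,u_{h-2},v_0,\dots,v_{h-1},w_0,\dots,w_h\in\mathbb{Q}$ such that for all $L\ge0$, $$s(L,h)=\alpha L^2+\beta L+u_{L\bmod(h-1)}+v_{L\bmod h}+w_{L\bmod(h+1)},$$ with $$\alpha=\frac{1}{h(h^2-1)}\sum_{i=1}^{h-1}(h-i)\varphi(i)\qquad\text{and}\qquad\beta=\frac{1}{h(h+1)}\sum_{i=1}^{h}\varphi(i),$$ where $\varphi$ is Euler's totient function.
   Context: For a finite word $w$ over $\{0,1\}$, $|w|$ is its length and $|w|_0,|w|_1$ are its numbers of $0$'s and $1$'s; $|w|_1$ is the height of $w$. A subword means a contiguous factor. A word $w$ is balanced if for all finite subwords $u,v$ of $w$ with $|u|=|v|$ one has $\bigl||u|_0-|v|_0\bigr|\le 1$. For $0\le h\le L$, $\mathbb{S}(L,h)$ is the set of balanced words in $\{0,1\}^*$ of length $L$ and height $h$. The function $s:\mathbb{Z}^2\to\mathbb{N}$ is defined by $s(L,h)=\#\mathbb{S}(L,h\bmod L)$ if $L>0$ (with $h\bmod L\in\{0,\dots,L-1\}$), $s(0,0)=1$, and $s(L,h)=0$ if $L<0$ or if $L=0$ and $h\ne0$. Euler's totient satisfies $\varphi(1)=1$. -}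

module Defs where

open import Data.Fin using (Fin)
open import Data.Fin.Patterns using (0F; 1F)
import Data.Fin.Properties as Fin
open import Data.Integer using (ℤ; +_; -[1+_])
open import Data.Integer.DivMod using (_%ℕ_)
open import Data.List
  using (List; []; _∷_; length; map; filter; upTo; allFin; cartesianProductWith)
open import Data.List.Membership.Propositional using (_∈_)
open import Data.List.Membership.Propositional.Properties
  using (∈-allFin; ∈-cartesianProductWith⁺; ∈-filter⁺; ∈-filter⁻)
open import Data.List.Properties using (∷-injective)
open import Data.List.Relation.Binary.Infix.Heterogeneous using (Infix; here; there)
open import Data.List.Relation.Binary.Prefix.Heterogeneous using (Prefix; []; _∷_)
open import Data.List.Relation.Unary.All using ([])
open import Data.List.Relation.Unary.AllPairs using ([]; _∷_)
import Data.List.Relation.Unary.Any as Any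
open import Data.List.Relation.Unary.Unique.Propositional using (Unique)
import Data.List.Relation.Unary.Unique.Propositional.Properties as Unique
open import Data.Nat
  using (ℕ; zero; suc; 2+; _*_; _∸_; _^_; _≤_; ∣_-_∣; NonZero; NonTrivial;
         nonTrivial⇒nonZero; _≟_; _≤?_)
open import Data.Nat.Coprimality using (coprime?)
open import Data.Nat.ListAction using (sum)
open import Data.Nat.Properties using (m*n≢0)
open import Data.Product using (_×_; _,_; proj₂)
open import Data.Rational using (ℚ; _/_)
open import Function using (_∘_; _⇔_; mk⇔)
open import Level using (0ℓ)
open import Relation.Binary.PropositionalEquality using (_≡_; refl)
open import Relation.Nullary using (Dec)
open import Relation.Nullary.Decidable using (map′; _×-dec_; _→-dec_)
open import Relation.Unary using (Pred; Decidable)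

Word : Set
Word = List (Fin 2)

∣_∣₀ ∣_∣₁ : Word → ℕ
∣ w ∣₀ = length (filter (Fin._≟ 0F) w)
∣ w ∣₁ = length (filter (Fin._≟ 1F) w)

height : Word → ℕ
height = ∣_∣₁

infix 4 _⊑_

_⊑_ : Word → Word → Set
u ⊑ w = Infix _≡_ u w

Balanced : Pred Word 0ℓ
Balanced w = ∀ u → u ⊑ w → ∀ v → v ⊑ w → length u ≡ length v →
             ∣ ∣ u ∣₀ - ∣ v ∣₀ ∣ ≤ 1

𝕊 : ℕ → ℕ → Pred Word 0ℓ
𝕊 L h w = Balanced w × length w ≡ L × height w ≡ h

private
  allPrefixes? : {P : Pred Word 0ℓ} → Decidable P →
                 ∀ w → Dec (∀ u → Prefix _≡_ u w → P u)
  allPrefixes? P? [] =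
    map′ (λ { p [] [] → p }) (λ f → f [] []) (P? [])
  allPrefixes? P? (a ∷ w) =
    map′ (λ { (p , f) [] [] → p ; (p , f) (_ ∷ u) (refl ∷ q) → f u q })
         (λ f → f [] [] , λ u q → f (a ∷ u) (refl ∷ q))
         (P? [] ×-dec allPrefixes? (P? ∘ (a ∷_)) w)

  allSubwords? : {P : Pred Word 0ℓ} → Decidable P →
                 ∀ w → Dec (∀ u → u ⊑ w → P u)
  allSubwords? P? [] =
    map′ (λ { f u (here q) → f u q }) (λ f u q → f u (here q)) (allPrefixes? P? [])
  allSubwords? P? (a ∷ w) =
    map′ (λ { (f , g) u (here q) → f u q ; (f , g) u (there q) → g u q })
         (λ f → (λ u q → f u (here q)) , (λ u q → f u (there q)))
         (allPrefixes? P? (a ∷ w) ×-dec allSubwords? P? w)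

balanced? : Decidable Balanced
balanced? w =
  allSubwords? (λ u → allSubwords? (λ v →
    (length u ≟ length v) →-dec (∣ ∣ u ∣₀ - ∣ v ∣₀ ∣ ≤? 1)) w) w

𝕊? : ∀ L h → Decidable (𝕊 L h)
𝕊? L h w = balanced? w ×-dec length w ≟ L ×-dec height w ≟ h

words : ℕ → List Word
words zero    = [] ∷ []
words (suc L) = cartesianProductWith _∷_ (allFin 2) (words L)

𝕊-list : ℕ → ℕ → List Word
𝕊-list L h = filter (𝕊? L h) (words L)

#𝕊 : ℕ → ℕ → ℕ
#𝕊 L h = length (𝕊-list L h)

-- 𝕊-list enumerates 𝕊 without repetition, so #𝕊 is its cardinality.

∈-words : ∀ w → w ∈ words (length w)
∈-words []      = Any.here refl
∈-words (a ∷ w) = ∈-cartesianProductWith⁺ _∷_ (∈-allFin a) (∈-words w)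

words-unique : ∀ L → Unique (words L)
words-unique zero    = [] ∷ []
words-unique (suc L) =
  Unique.cartesianProductWith⁺ _∷_ ∷-injective (Unique.allFin⁺ 2) (words-unique L)

∈-𝕊-list : ∀ {L h w} → w ∈ 𝕊-list L h ⇔ 𝕊 L h w
∈-𝕊-list {L} {h} = mk⇔ (proj₂ ∘ ∈-filter⁻ (𝕊? L h) {xs = words L}) from
  where
  from : ∀ {w} → 𝕊 L h w → w ∈ 𝕊-list L h
  from {w} p@(_ , refl , _) = ∈-filter⁺ (𝕊? L h) (∈-words w) p

𝕊-list-unique : ∀ L h → Unique (𝕊-list L h)
𝕊-list-unique L h = Unique.filter⁺ (𝕊? L h) (words-unique L)

s : ℤ → ℤ → ℕ
s (+ suc l)  h     = #𝕊 (suc l) (h %ℕ suc l)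
s (+ zero)   (+ 0) = 1
s (+ zero)   _     = 0
s (-[1+ _ ]) _     = 0

range : ℕ → List ℕ
range n = map suc (upTo n)

φ : ℕ → ℕ
φ n = length (filter (λ k → coprime? k n) (range n))

pred-nonZero : ∀ h → .{{NonTrivial h}} → NonZero (h ∸ 1)
pred-nonZero (2+ _) = _

α-denominator-nonZero : ∀ h → .{{NonTrivial h}} → NonZero (h * (h ^ 2 ∸ 1))
α-denominator-nonZero h@(2+ _) = m*n≢0 h (h ^ 2 ∸ 1)

α : ∀ h → .{{NonTrivial h}} → ℚ
α h = _/_ (+ sum (map (λ i → (h ∸ i) * φ i) (range (h ∸ 1))))
          (h * (h ^ 2 ∸ 1)) {{α-denominator-nonZero h}}

β : ∀ h → .{{NonTrivial h}} → ℚ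
β h = _/_ (+ sum (map φ (range h))) (h * suc h) {{m*n≢0 h (suc h) {{nonTrivial⇒nonZero h}}}}

fromℕ : ℕ → ℚ
fromℕ n = + n / 1

module Submission where

-- Cut a balanced word of length L with h letters 1 at these letters. The inner
-- gaps take two values q, q + 1 (counting one adjacent 1), and they spell a
-- balanced word u of length h - 1, not all of whose letters are 1. Each outer gap
-- can be anything from 1 to q or q + 1, according to whether u can be extended by a
-- 1 on that side. Counting pairs of outer gaps by inclusion-exclusion gives
--
--   s(L,h) = Σ_u Σ_{q ≥ 0} [(M)⁺ - (M - q - δˡ u)⁺ - (M - q - δʳ u)⁺ + (M - 2q - δˡ u - δʳ u)⁺]
--
-- with M = L - q (h - 1) - |u|₁. For L ≥ h the layer q = 0 vanishes. For L < h it
-- is the only one, and the same coding applied to the words 1u1 identifies it with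
-- s(L, h mod L). The sums over q of (L - q c - t)⁺, for c = h - 1, h, h + 1, are
-- quadratic in L up to a c-periodic term. To evaluate the coefficients one needs
-- the number of balanced words of length n, whose second difference is φ: all
-- balanced words extend to the left, and those of length n which extend in two ways
-- correspond to the fractions p/q in (0,1] with q ≤ n + 1.

open import Defs

-- The sum over `q ≥ 0` of `(L - q c - t)⁺` with `0 ≤ t ≤ c` obeys its recurrence in `L` from
-- `L = 0` on. Dropping the layer `q = 0` would spoil this for small lengths, so the layer is kept,
-- and the convention `h mod L` in `s` is what it counts when `L < h`. Each such sum has leading
-- coefficient `1 / (2c)`, and `1 / (2(h - 1)) - 1 / h + 1 / (2(h + 1)) = 1 / (h(h² -
-- 1))`, so `α` is the number of words `u` over `h(h² - 1)`. Its linear coefficient is `1/2 - t/c`.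
-- In the combination the halves cancel, and `β` depends only on the totals of `|u|₁`, `δˡ u` and
-- `δʳ u`. No single height or indicator has to be known: exchanging the letters 0 and 1 averages
-- the heights to half the length, and makes the number of words extendable by a 1 on a given side
-- half the number of balanced words of length `h`. All totals thus reduce to numbers of balanced
-- words.

module Counting where

  open import Data.Fin using (Fin; toℕ)
  open import Data.Fin.Patterns using (0F; 1F)
  open import Data.Fin.Properties using (toℕ-injective)
  import Data.Integer as ℤ
  open import Data.List using (List; []; _∷_; length; map; filter; _++_; [_]; _∷ʳ_; upTo; allFin; replicate)
  open import Data.List.Membership.Propositional using (_∈_)
  open import Data.List.Membership.Propositional.Properties
    using (∈-map⁺; ∈-map⁻; ∈-++⁺ˡ; ∈-++⁺ʳ; ∈-++⁻; ∈-filter⁺; ∈-filter⁻; ∈-upTo⁺; ∈-upTo⁻; ∈-cartesianProductWith⁻)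
  open import Data.List.Membership.Propositional.Properties.WithK using (unique∧set⇒bag)
  open import Data.List.Properties
    using (length-map; length-++; length-replicate; map-∘; map-++; map-cong; map-injective; map-applyUpTo; map-upTo;
           upTo-∷ʳ; ∷-injective; ∷-injectiveˡ; ∷-injectiveʳ; ∷ʳ-injective; filter-++; filter-none; filter-accept; filter-reject)
  open import Data.List.Relation.Binary.BagAndSetEquality using (∼bag⇒↭)
  open import Data.List.Relation.Binary.Infix.Heterogeneous using (here; there)
  open import Data.List.Relation.Binary.Permutation.Propositional using (_↭_)
  open import Data.List.Relation.Binary.Permutation.Propositional.Properties using (↭-length) renaming (map⁺ to ↭-map⁺)
  open import Data.List.Relation.Binary.Prefix.Heterogeneous using (Prefix; []; _∷_)
  import Data.List.Relation.Unary.All as All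
  import Data.List.Relation.Unary.All.Properties as All
  open import Data.List.Relation.Unary.AllPairs using ([]; _∷_)
  open import Data.List.Relation.Unary.Any using (here; there)
  open import Data.List.Relation.Unary.Unique.Propositional using (Unique)
  import Data.List.Relation.Unary.Unique.Propositional.Properties as Unique
  open import Data.Nat
  open import Data.Nat.Coprimality using (Coprime; coprime?; coprime-divisor; coprime-/gcd)
  import Data.Nat.Coprimality as Coprime
  open import Data.Nat.Divisibility using (divides; ∣-antisym)
  open import Data.Nat.DivMod
  open import Data.Nat.GCD using (gcd; gcd[m,n]∣m; gcd[m,n]∣n; gcd[m,n]≢0)
  open import Data.Nat.ListAction using (sum)
  open import Data.Nat.ListAction.Properties using (sum-++; sum-↭)
  open import Data.Nat.Properties
  open import Data.Nat.Solver
  open +-*-Solver using (solve; _:+_; _:*_; con; _:=_)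
  open import Data.Product using (∃; ∃₂; _×_; _,_; proj₁; proj₂; swap)
  open import Data.Sum using (_⊎_; inj₁; inj₂; [_,_]′)
  open import Function using (_∘_; mk⇔; Equivalence)
  open import Level using (0ℓ)
  open import Relation.Binary using (Tri; tri<; tri≈; tri>)
  open import Relation.Binary.PropositionalEquality hiding ([_])
  open import Relation.Nullary using (Dec; yes; no; ¬_; contradiction)
  open import Relation.Nullary.Decidable using (_×-dec_)
  open import Relation.Unary using (Pred; Decidable)

  -- Counting finite sets through repetition-free lists

  private variable
    A B : Set

  module _ {f : A → B} where

    map-unique : ∀ {xs} → (∀ {x y} → x ∈ xs → y ∈ xs → f x ≡ f y → x ≡ y) →
                 Unique xs → Unique (map f xs)
    map-unique inj []         = []
    map-unique inj (x∉ ∷ xs!) =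
      All.map⁺ (All.tabulate λ y∈ fx≡fy →
                  All.lookup x∉ y∈ (inj (here refl) (there y∈) fx≡fy))
      ∷ map-unique (λ x∈ y∈ → inj (there x∈) (there y∈)) xs!

    -- Repetition-free lists with the same members are permutations of each other. Injectivity and
    -- surjectivity are asked of members only, because the codings used below are faithful only on
    -- the listed words.
    bijection⇒length : ∀ {xs ys} → Unique xs → Unique ys →
      (∀ {x} → x ∈ xs → f x ∈ ys) →
      (∀ {x y} → x ∈ xs → y ∈ xs → f x ≡ f y → x ≡ y) →
      (∀ {y} → y ∈ ys → ∃ λ x → x ∈ xs × f x ≡ y) →
      length xs ≡ length ys
    bijection⇒length {xs} {ys} xs! ys! into inj onto = begin
      length xs         ≡⟨ length-map f xs ⟨
      length (map f xs) ≡⟨ ↭-length (∼bag⇒↭ (unique∧set⇒bag (map-unique inj xs!) ys! (mk⇔ to from))) ⟩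
      length ys         ∎
      where
      open ≡-Reasoning
      to : ∀ {y} → y ∈ map f xs → y ∈ ys
      to y∈ with _ , x∈ , refl ← ∈-map⁻ f y∈ = into x∈
      from : ∀ {y} → y ∈ ys → y ∈ map f xs
      from y∈ with _ , x∈ , refl ← onto y∈ = ∈-map⁺ f x∈

  bijection⇒sum : {f : A → A} {xs : List A} (g : A → ℕ) → Unique xs →
    (∀ {x} → x ∈ xs → f x ∈ xs) →
    (∀ {x} → f (f x) ≡ x) →
    sum (map (g ∘ f) xs) ≡ sum (map g xs)
  bijection⇒sum {f = f} {xs} g xs! into invol = begin
    sum (map (g ∘ f) xs)     ≡⟨ cong sum (map-∘ xs) ⟩
    sum (map g (map f xs))   ≡⟨ sum-↭ (↭-map⁺ g (∼bag⇒↭ (unique∧set⇒bag (map-unique (λ _ _ → inj) xs!) xs! (mk⇔ to from)))) ⟩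
    sum (map g xs)           ∎
    where
    open ≡-Reasoning
    inj : ∀ {x y} → f x ≡ f y → x ≡ y
    inj eq = trans (sym invol) (trans (cong f eq) invol)
    to : ∀ {y} → y ∈ map f xs → y ∈ xs
    to y∈ with _ , x∈ , refl ← ∈-map⁻ f y∈ = into x∈
    from : ∀ {y} → y ∈ xs → y ∈ map f xs
    from {y} y∈ = subst (_∈ map f xs) invol (∈-map⁺ f (into y∈))

  pairs : List A → (A → List B) → List (A × B)
  pairs []       g = []
  pairs (x ∷ xs) g = map (x ,_) (g x) ++ pairs xs g

  module _ {g : A → List B} where

    ∈-pairs⁺ : ∀ {xs x y} → x ∈ xs → y ∈ g x → (x , y) ∈ pairs xs g
    ∈-pairs⁺ (here refl)          y∈ = ∈-++⁺ˡ (∈-map⁺ _ y∈)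
    ∈-pairs⁺ {x ∷ xs} (there x∈) y∈ = ∈-++⁺ʳ (map (x ,_) (g x)) (∈-pairs⁺ x∈ y∈)

    ∈-pairs⁻ : ∀ xs {x y} → (x , y) ∈ pairs xs g → x ∈ xs × y ∈ g x
    ∈-pairs⁻ (x ∷ xs) p with ∈-++⁻ (map (x ,_) (g x)) p
    ... | inj₁ q with _ , y∈ , refl ← ∈-map⁻ (x ,_) q = here refl , y∈
    ... | inj₂ q with x∈ , y∈ ← ∈-pairs⁻ xs q = there x∈ , y∈

    pairs-unique : ∀ {xs} → Unique xs → (∀ x → Unique (g x)) → Unique (pairs xs g)
    pairs-unique []                   g! = []
    pairs-unique {x ∷ xs} (x∉ ∷ xs!) g! =
      Unique.++⁺ (Unique.map⁺ (λ { refl → refl }) (g! x)) (pairs-unique xs! g!) disjoint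
      where
      disjoint : ∀ {p} → ¬ (p ∈ map (x ,_) (g x) × p ∈ pairs xs g)
      disjoint (p , q) with _ , _ , refl ← ∈-map⁻ (x ,_) p =
        All.lookup x∉ (proj₁ (∈-pairs⁻ xs q)) refl

    length-pairs : ∀ xs → length (pairs xs g) ≡ sum (map (length ∘ g) xs)
    length-pairs []       = refl
    length-pairs (x ∷ xs) = begin
      length (map (x ,_) (g x) ++ pairs xs g)        ≡⟨ length-++ (map (x ,_) (g x)) ⟩
      length (map (x ,_) (g x)) + length (pairs xs g) ≡⟨ cong₂ _+_ (length-map _ (g x)) (length-pairs xs) ⟩
      length (g x) + sum (map (length ∘ g) xs)       ∎
      where open ≡-Reasoning

  -- Inclusion-exclusion for `P` and `Q`. Union and intersection enter as predicates `R` and `S` of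
  -- their own, so that each keeps its own decision procedure, such as `balanced?` and
  -- `leftSpecial?`.
  filter-∪∩ : {P Q R S : Pred A 0ℓ}
    (P? : Decidable P) (Q? : Decidable Q) (R? : Decidable R) (S? : Decidable S) →
    (∀ x → P x ⊎ Q x → R x) → (∀ x → R x → P x ⊎ Q x) →
    (∀ x → P x × Q x → S x) → (∀ x → S x → P x × Q x) → ∀ xs →
    length (filter P? xs) + length (filter Q? xs) ≡ length (filter R? xs) + length (filter S? xs)
  filter-∪∩ P? Q? R? S? r r′ s s′ [] = refl
  filter-∪∩ P? Q? R? S? r r′ s s′ (x ∷ xs)
    with ih ← filter-∪∩ P? Q? R? S? r r′ s s′ xs | P? x | Q? x | R? x | S? x
  ... | yes p | yes q | yes _ | yes _ = cong suc (trans (+-suc _ _) (trans (cong suc ih) (sym (+-suc _ _))))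
  ... | yes p | yes q | yes _ | no ¬s = contradiction (s x (p , q)) ¬s
  ... | yes p | _     | no ¬r | _     = contradiction (r x (inj₁ p)) ¬r
  ... | yes p | no ¬q | yes _ | yes z = contradiction (proj₂ (s′ x z)) ¬q
  ... | yes p | no ¬q | yes _ | no _  = cong suc ih
  ... | no ¬p | yes q | yes _ | yes z = contradiction (proj₁ (s′ x z)) ¬p
  ... | no ¬p | yes q | yes _ | no _  = trans (+-suc _ _) (cong suc ih)
  ... | no ¬p | yes q | no ¬r | _     = contradiction (r x (inj₂ q)) ¬r
  ... | no ¬p | no ¬q | yes z | _     = contradiction (r′ x z) [ ¬p , ¬q ]′
  ... | no ¬p | no ¬q | no _  | yes z = contradiction (proj₁ (s′ x z)) ¬p
  ... | no ¬p | no ¬q | no _  | no _  = ih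

  infixl 6 _⊕_
  _⊕_ : ∀ {a b c d} → a ≤ b → c ≤ d → a + c ≤ b + d
  _⊕_ = +-mono-≤

  -- Certificate-based linear arithmetic: p ≤ q is a sum of hypotheses, and eq is
  -- a semiring identity left to the solver.
  linear : ∀ {x y p q} → p ≤ q → x + q ≡ y + p → x ≤ y
  linear {x} {y} {p} {q} p≤q eq = +-cancelʳ-≤ p x y (begin
    x + p ≤⟨ +-monoʳ-≤ x p≤q ⟩
    x + q ≡⟨ eq ⟩
    y + p ∎)
    where open ≤-Reasoning

  -- Balance in terms of heights of prefixes

  σ : Word → ℕ → ℕ
  σ w       zero    = 0
  σ []      (suc i) = 0
  σ (a ∷ w) (suc i) = toℕ a + σ w i

  σ-length : ∀ w → σ w (length w) ≡ height w
  σ-length []       = refl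
  σ-length (0F ∷ w) = σ-length w
  σ-length (1F ∷ w) = cong suc (σ-length w)

  length-split : ∀ w → ∣ w ∣₀ + ∣ w ∣₁ ≡ length w
  length-split []       = refl
  length-split (0F ∷ w) = cong suc (length-split w)
  length-split (1F ∷ w) = trans (+-suc ∣ w ∣₀ ∣ w ∣₁) (cong suc (length-split w))

  σ-lower : ∀ w i → σ w i ≤ σ w (suc i)
  σ-lower []       i       = ≤-reflexive (σ[] i)
    where
    σ[] : ∀ i → σ [] i ≡ 0
    σ[] zero    = refl
    σ[] (suc i) = refl
  σ-lower (a ∷ w)  zero    = z≤n
  σ-lower (a ∷ w)  (suc i) = +-monoʳ-≤ (toℕ a) (σ-lower w i)

  σ-upper : ∀ w i → σ w (suc i) ≤ suc (σ w i)
  σ-upper []       i       = z≤n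
  σ-upper (0F ∷ w) zero    = z≤n
  σ-upper (1F ∷ w) zero    = ≤-refl
  σ-upper (a ∷ w)  (suc i) = ≤-trans (+-monoʳ-≤ (toℕ a) (σ-upper w i)) (≤-reflexive (+-suc (toℕ a) _))

  σ-injective : ∀ {w w′} → length w ≡ length w′ →
                (∀ i → i ≤ length w → σ w i ≡ σ w′ i) → w ≡ w′
  σ-injective {[]}     {[]}      _  _  = refl
  σ-injective {a ∷ w} {a′ ∷ w′} eq eqs = cong₂ _∷_ a≡a′ (σ-injective (suc-injective eq) tail)
    where
    a≡a′ : a ≡ a′
    a≡a′ = toℕ-injective (+-cancelʳ-≡ 0 (toℕ a) (toℕ a′) (eqs 1 (s≤s z≤n)))
    tail : ∀ i → i ≤ length w → σ w i ≡ σ w′ i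
    tail i i≤ = +-cancelˡ-≡ (toℕ a) _ _ (trans (eqs (suc i) (s≤s i≤)) (cong (λ b → toℕ b + σ w′ i) (sym a≡a′)))

  Steps : ℕ → (ℕ → ℕ) → Set
  Steps n y = ∀ i → i < n → y i ≤ y (suc i) × y (suc i) ≤ suc (y i)

  letter : ℕ → Fin 2
  letter zero    = 0F
  letter (suc _) = 1F

  -- Only the increments of `y` are read, so `y` need not start at 0; `σ-build` restores the offset
  -- `y 0`.
  build : ℕ → (ℕ → ℕ) → Word
  build zero    y = []
  build (suc n) y = letter (y 1 ∸ y 0) ∷ build n (y ∘ suc)

  length-build : ∀ n y → length (build n y) ≡ n
  length-build zero    y = refl
  length-build (suc n) y = cong suc (length-build n (y ∘ suc))

  letter-step : ∀ {p q} → p ≤ q → q ≤ suc p → toℕ (letter (q ∸ p)) + p ≡ q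
  letter-step {p} {q} p≤q q≤1+p with m≤n⇒m<n∨m≡n p≤q
  ... | inj₂ refl rewrite n∸n≡0 p = refl
  ... | inj₁ p<q with refl ← ≤-antisym q≤1+p p<q rewrite m+n∸n≡m 1 p = refl

  σ-build : ∀ n y → Steps n y → ∀ i → i ≤ n → σ (build n y) i + y 0 ≡ y i
  σ-build n       y st zero    _         = refl
  σ-build (suc n) y st (suc i) (s≤s i≤n) = begin
    a + σ (build n (y ∘ suc)) i + y 0     ≡⟨ solve 3 (λ a s z → a :+ s :+ z := s :+ (a :+ z)) refl a _ (y 0) ⟩
    σ (build n (y ∘ suc)) i + (a + y 0)   ≡⟨ cong (σ (build n (y ∘ suc)) i +_) (letter-step (proj₁ (st 0 z<s)) (proj₂ (st 0 z<s))) ⟩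
    σ (build n (y ∘ suc)) i + y 1         ≡⟨ σ-build n (y ∘ suc) (λ j j<n → st (suc j) (s≤s j<n)) i i≤n ⟩
    y (suc i)                             ∎
    where
    open ≡-Reasoning
    a = toℕ (letter (y 1 ∸ y 0))

  -- With y the heights of the prefixes of a word, this is a balance condition on
  -- heights; it is equivalent to Balanced, which counts the letters 0.
  WindowBalanced : ℕ → (ℕ → ℕ) → Set
  WindowBalanced n y = ∀ i j d → i + d ≤ n → j + d ≤ n →
                       y (i + d) + y j ≤ suc (y (j + d) + y i)

  WB-cong : ∀ {n y y′} → (∀ i → i ≤ n → y i ≡ y′ i) → WindowBalanced n y → WindowBalanced n y′
  WB-cong eq wb i j d p q =
    subst₂ _≤_ (cong₂ _+_ (eq (i + d) p) (eq j (m+n≤o⇒m≤o j q)))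
               (cong suc (cong₂ _+_ (eq (j + d) q) (eq i (m+n≤o⇒m≤o i p))))
               (wb i j d p q)

  prefix⇒window : ∀ {u w} → Prefix _≡_ u w → length u ≤ length w × ∣ u ∣₁ ≡ σ w (length u)
  prefix⇒window []                         = z≤n , refl
  prefix⇒window (_∷_ {a = 0F} refl p) with l , e ← prefix⇒window p = s≤s l , e
  prefix⇒window (_∷_ {a = 1F} refl p) with l , e ← prefix⇒window p = s≤s l , cong suc e

  infix⇒window : ∀ {u w} → u ⊑ w →
    ∃ λ i → i + length u ≤ length w × ∣ u ∣₁ + σ w i ≡ σ w (i + length u)
  infix⇒window (here p) with l , e ← prefix⇒window p = 0 , l , trans (+-identityʳ _) e
  infix⇒window {u} {a ∷ w} (there p) with i , l , e ← infix⇒window p =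
    suc i , s≤s l , (begin
      ∣ u ∣₁ + (toℕ a + σ w i) ≡⟨ solve 3 (λ u a s → u :+ (a :+ s) := a :+ (u :+ s)) refl ∣ u ∣₁ (toℕ a) (σ w i) ⟩
      toℕ a + (∣ u ∣₁ + σ w i) ≡⟨ cong (toℕ a +_) e ⟩
      toℕ a + σ w (i + length u) ∎)
    where open ≡-Reasoning

  window⇒prefix : ∀ (w : Word) d → d ≤ length w → ∃ λ u → Prefix _≡_ u w × length u ≡ d
  window⇒prefix w       zero    _       = [] , [] , refl
  window⇒prefix (a ∷ w) (suc d) (s≤s l) with u , p , refl ← window⇒prefix w d l =
    a ∷ u , refl ∷ p , refl

  window⇒infix : ∀ w i d → i + d ≤ length w →
    ∃ λ u → u ⊑ w × length u ≡ d × ∣ u ∣₁ + σ w i ≡ σ w (i + d)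
  window⇒infix w zero d l with u , p , refl ← window⇒prefix w d l =
    u , here p , refl , trans (+-identityʳ _) (proj₂ (prefix⇒window p))
  window⇒infix (a ∷ w) (suc i) d (s≤s l) with u , p , refl , e ← window⇒infix w i d l =
    u , there p , refl , (begin
      ∣ u ∣₁ + (toℕ a + σ w i) ≡⟨ solve 3 (λ u a s → u :+ (a :+ s) := a :+ (u :+ s)) refl ∣ u ∣₁ (toℕ a) (σ w i) ⟩
      toℕ a + (∣ u ∣₁ + σ w i) ≡⟨ cong (toℕ a +_) e ⟩
      toℕ a + σ w (i + length u) ∎)
    where open ≡-Reasoning

  balanced⇒WB : ∀ {w} → Balanced w → WindowBalanced (length w) (σ w)
  balanced⇒WB {w} bal i j d p q
    with u , u⊑w , refl , eu ← window⇒infix w i d p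
       | v , v⊑w , lv   , ev ← window⇒infix w j d q =
    -- `Balanced` counts letters 0. As the two windows have equal length, a surplus of ones in `u`
    -- is a surplus of zeros in `v`, hence the order `v`, `u`.
    linear (m≤n+∣m-n∣ ∣ v ∣₀ ∣ u ∣₀ ⊕ bal v v⊑w u u⊑w lv ⊕ ≤-reflexive (length-split u)
             ⊕ ≤-reflexive (sym lv) ⊕ ≤-reflexive (sym (length-split v))
             ⊕ ≤-reflexive ev ⊕ ≤-reflexive (sym eu))
      (solve 11 (λ yid yj yjd yi v0 u0 D u1 lu v1 lv →
         (yid :+ yj) :+ ((u0 :+ D) :+ con 1 :+ lu :+ lv :+ (v0 :+ v1) :+ yjd :+ (u1 :+ yi))
         := (con 1 :+ (yjd :+ yi)) :+ (v0 :+ D :+ (u0 :+ u1) :+ lu :+ lv :+ (v1 :+ yj) :+ yid))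
        refl (σ w (i + length u)) (σ w j) (σ w (j + length u)) (σ w i) ∣ v ∣₀ ∣ u ∣₀ ∣ ∣ v ∣₀ - ∣ u ∣₀ ∣ ∣ u ∣₁ (length u) ∣ v ∣₁ (length v))

  WB⇒balanced : ∀ {w} → WindowBalanced (length w) (σ w) → Balanced w
  WB⇒balanced {w} wb u u⊑w v v⊑w lu≡lv
    with i , p , eu ← infix⇒window u⊑w | j , q , ev ← infix⇒window v⊑w
    = close (half v u j i lu≡lv p q eu ev) (half u v i j (sym lu≡lv) q p ev eu)
    where
    half : ∀ v u j i → length u ≡ length v → i + length u ≤ length w → j + length v ≤ length w →
           ∣ u ∣₁ + σ w i ≡ σ w (i + length u) → ∣ v ∣₁ + σ w j ≡ σ w (j + length v) →
           ∣ v ∣₀ ≤ suc ∣ u ∣₀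
    half v u j i lu p q eu ev rewrite sym lu =
      linear (wb i j (length u) p q ⊕ ≤-reflexive eu ⊕ ≤-reflexive (sym ev)
               ⊕ ≤-reflexive (sym (length-split u)) ⊕ ≤-reflexive (trans (length-split v) (sym lu)))
        (solve 9 (λ yid yj yjd yi v0 u0 u1 v1 l →
           v0 :+ ((con 1 :+ (yjd :+ yi)) :+ yid :+ (v1 :+ yj) :+ (u0 :+ u1) :+ l)
           := (con 1 :+ u0) :+ ((yid :+ yj) :+ (u1 :+ yi) :+ yjd :+ l :+ (v0 :+ v1)))
         refl (σ w (i + length u)) (σ w j) (σ w (j + length u)) (σ w i) ∣ v ∣₀ ∣ u ∣₀ ∣ u ∣₁ ∣ v ∣₁ (length u))
    close : ∀ {m n} → m ≤ suc n → n ≤ suc m → ∣ n - m ∣ ≤ 1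
    close {m} {n} p q with ∣m-n∣≡[m∸n]∨[n∸m] n m
    ... | inj₁ e = ≤-trans (≤-reflexive e) (m≤n+o⇒m∸n≤o n m (≤-trans q (≤-reflexive (+-comm 1 m))))
    ... | inj₂ e = ≤-trans (≤-reflexive e) (m≤n+o⇒m∸n≤o m n (≤-trans p (≤-reflexive (+-comm 1 n))))

  -- Extending balanced words

  WB-tail : ∀ {n} y → WindowBalanced (suc n) y → WindowBalanced n (y ∘ suc)
  WB-tail y wb i j d p q = wb (suc i) (suc j) d (s≤s p) (s≤s q)

  WB-init : ∀ {n} y → WindowBalanced (suc n) y → WindowBalanced n y
  WB-init y wb i j d p q = wb i j d (m≤n⇒m≤1+n p) (m≤n⇒m≤1+n q)

  WB-shift : ∀ {n} y {y′} c → (∀ i → y i ≡ c + y′ i) → WindowBalanced n y → WindowBalanced n y′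
  WB-shift y {y′} c eq wb i j d p q =
    linear (wb i j d p q ⊕ ≤-reflexive (sym (eq (i + d))) ⊕ ≤-reflexive (sym (eq j))
                         ⊕ ≤-reflexive (eq (j + d)) ⊕ ≤-reflexive (eq i))
      (solve 9 (λ c A B C D A′ B′ C′ D′ →
          (A′ :+ B′) :+ ((con 1 :+ (C :+ D)) :+ A :+ B :+ (c :+ C′) :+ (c :+ D′))
          := (con 1 :+ (C′ :+ D′)) :+ ((A :+ B) :+ (c :+ A′) :+ (c :+ B′) :+ C :+ D))
        refl c (y (i + d)) (y j) (y (j + d)) (y i) (y′ (i + d)) (y′ j) (y′ (j + d)) (y′ i))

  -- A window that is not inside the tail starts at 0, so prefixes have to be compared with later
  -- windows, in both directions. Two prefixes of equal length coincide, and empty windows are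
  -- trivial.
  WB-cons : ∀ {n} y → WindowBalanced n (y ∘ suc) →
    (∀ a k → a + suc k ≤ n → y (suc k) + y (suc a) ≤ suc (y (suc (a + suc k)) + y 0)) →
    (∀ a k → a + suc k ≤ n → y (suc (a + suc k)) + y 0 ≤ suc (y (suc k) + y (suc a))) →
    WindowBalanced (suc n) y
  WB-cons y wb lo hi zero    zero    d       p       q       = n≤1+n _
  WB-cons y wb lo hi (suc i) (suc j) d       (s≤s p) (s≤s q) = wb i j d p q
  WB-cons y wb lo hi i       j       zero    p       q
    rewrite +-identityʳ i | +-identityʳ j | +-comm (y i) (y j)     = n≤1+n _
  WB-cons y wb lo hi zero    (suc a) (suc k) p       (s≤s q) = lo a k q
  WB-cons y wb lo hi (suc a) zero    (suc k) (s≤s p) q       = hi a k p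

  -- Mirror image: a new window ends at `suc n`, and `b` is the start of the suffix of length
  -- `suc k`.
  WB-snoc : ∀ {n} y → WindowBalanced n y →
    (∀ a b k → a + suc k ≤ n → b + k ≡ n → y (suc n) + y a ≤ suc (y (a + suc k) + y b)) →
    (∀ a b k → a + suc k ≤ n → b + k ≡ n → y (a + suc k) + y b ≤ suc (y (suc n) + y a)) →
    WindowBalanced (suc n) y
  WB-snoc y wb lo hi i j zero p q
    rewrite +-identityʳ i | +-identityʳ j | +-comm (y i) (y j) = n≤1+n _
  WB-snoc y wb lo hi i j (suc k) p q with m≤n⇒m<n∨m≡n p | m≤n⇒m<n∨m≡n q
  ... | inj₁ (s≤s p′) | inj₁ (s≤s q′) = wb i j (suc k) p′ q′
  ... | inj₁ (s≤s p′) | inj₂ q′       =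
    subst (λ t → y (i + suc k) + y j ≤ suc (y t + y i)) (sym q′)
          (hi i j k p′ (suc-injective (trans (sym (+-suc j k)) q′)))
  ... | inj₂ p′       | inj₁ (s≤s q′) =
    subst (λ t → y t + y j ≤ suc (y (j + suc k) + y i)) (sym p′)
          (lo j i k q′ (suc-injective (trans (sym (+-suc i k)) p′)))
  ... | inj₂ p′       | inj₂ q′
    with refl ← +-cancelʳ-≡ (suc k) i j (trans p′ (sym q′)) = n≤1+n _

  balanced-tail : ∀ {a u} → Balanced (a ∷ u) → Balanced u
  balanced-tail {a} {u} bal = WB⇒balanced (WB-shift (σ (a ∷ u) ∘ suc) (toℕ a) (λ _ → refl) (WB-tail (σ (a ∷ u)) (balanced⇒WB bal)))

  length-∷ʳ : ∀ u (a : Fin 2) → length (u ∷ʳ a) ≡ suc (length u)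
  length-∷ʳ u a = trans (length-++ u) (+-comm (length u) 1)

  σ-∷ʳ : ∀ u a i → i ≤ length u → σ (u ∷ʳ a) i ≡ σ u i
  σ-∷ʳ u       a zero    _       = refl
  σ-∷ʳ (b ∷ u) a (suc i) (s≤s p) = cong (toℕ b +_) (σ-∷ʳ u a i p)

  σ-∷ʳ-last : ∀ u a → σ (u ∷ʳ a) (suc (length u)) ≡ toℕ a + σ u (length u)
  σ-∷ʳ-last []      a = refl
  σ-∷ʳ-last (b ∷ u) a rewrite σ-∷ʳ-last u a =
    solve 3 (λ a b c → b :+ (a :+ c) := a :+ (b :+ c)) refl (toℕ a) (toℕ b) _

  balanced-init : ∀ {a u} → Balanced (u ∷ʳ a) → Balanced u
  balanced-init {a} {u} bal =
    WB⇒balanced (WB-cong (σ-∷ʳ u a)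
      (WB-init (σ (u ∷ʳ a)) (subst (λ n → WindowBalanced n (σ (u ∷ʳ a))) (length-∷ʳ u a) (balanced⇒WB bal))))

  module _ (u : Word) where

    private
      m = length u
      z = σ u

    -- Superadditivity with a shifted index: the prefix of length `k + 1` of `1u` has height
    -- `1 + z k`, and no window of that length in `u` may fall more than 1 below it.
    LeftExt : Set
    LeftExt = ∀ a k → a + suc k ≤ m → z k + z a ≤ z (a + suc k)

    -- The same for the suffix of length `k + 1` of `u1`, whose height is `1 + z m - z b`.
    RightExt : Set
    RightExt = ∀ a b k → a + suc k ≤ m → b + k ≡ m → z m + z a ≤ z (a + suc k) + z b

    1∷-balanced⇒LeftExt : Balanced (1F ∷ u) → LeftExt
    1∷-balanced⇒LeftExt bal a k p =
      linear (balanced⇒WB bal 0 (suc a) (suc k) (s≤s (m+n≤o⇒n≤o a (≤-trans (+-monoʳ-≤ a (n≤1+n k)) p))) (s≤s p))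
        (solve 3 (λ zk za zak → (zk :+ za) :+ (con 1 :+ (con 1 :+ zak :+ con 0)) := zak :+ ((con 1 :+ zk) :+ (con 1 :+ za)))
          refl (z k) (z a) (z (a + suc k)))

    LeftExt⇒1∷-balanced : Balanced u → LeftExt → Balanced (1F ∷ u)
    LeftExt⇒1∷-balanced bal ext = WB⇒balanced (WB-cons (σ (1F ∷ u)) shifted lo hi)
      where
      wb = balanced⇒WB bal
      shifted : WindowBalanced m (suc ∘ z)
      shifted i j d p q = linear (wb i j d p q)
        (solve 4 (λ a b c d → (con 1 :+ a :+ (con 1 :+ b)) :+ (con 1 :+ (c :+ d)) := (con 1 :+ ((con 1 :+ c) :+ (con 1 :+ d))) :+ (a :+ b))
          refl (z (i + d)) (z j) (z (j + d)) (z i))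
      lo : ∀ a k → a + suc k ≤ m → suc (z k) + suc (z a) ≤ suc (suc (z (a + suc k)) + 0)
      lo a k p = linear (ext a k p)
        (solve 3 (λ zk za zak → (con 1 :+ zk :+ (con 1 :+ za)) :+ zak := (con 1 :+ (con 1 :+ zak :+ con 0)) :+ (zk :+ za))
          refl (z k) (z a) (z (a + suc k)))
      -- The opposite inequality follows from balance of `u`: without its last letter the window
      -- exceeds the prefix of length `k` by at most 1. The last letter adds at most 1, which the 1
      -- in front of `u` makes up for.
      hi : ∀ a k → a + suc k ≤ m → suc (z (a + suc k)) + 0 ≤ suc (suc (z k) + suc (z a))
      hi a k p = linear (≤-reflexive (cong z (+-suc a k)) ⊕ σ-upper u (a + k)
                         ⊕ wb a 0 k (≤-trans (+-monoʳ-≤ a (n≤1+n k)) p) (m+n≤o⇒n≤o a (≤-trans (+-monoʳ-≤ a (n≤1+n k)) p)))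
        (solve 5 (λ A B C zk za → (con 1 :+ A :+ con 0) :+ (B :+ (con 1 :+ C) :+ (con 1 :+ (zk :+ za)))
             := (con 1 :+ ((con 1 :+ zk) :+ (con 1 :+ za))) :+ (A :+ B :+ (C :+ con 0)))
          refl (z (a + suc k)) (z (suc (a + k))) (z (a + k)) (z k) (z a))

    0∷-balanced⇐ : Balanced u → (∀ a k → a + suc k ≤ m → z (a + suc k) ≤ suc (z k + z a)) → Balanced (0F ∷ u)
    0∷-balanced⇐ bal ext = WB⇒balanced (WB-cons (σ (0F ∷ u)) wb lo (λ a k p → ≤-trans (≤-reflexive (+-identityʳ _)) (ext a k p)))
      where
      wb = balanced⇒WB bal
      lo : ∀ a k → a + suc k ≤ m → z k + z a ≤ suc (z (a + suc k) + 0)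
      lo a k p = linear (≤-reflexive (sym (cong z (+-suc a k))) ⊕ σ-lower u (a + k)
                         ⊕ wb 0 a k (m+n≤o⇒n≤o a (≤-trans (+-monoʳ-≤ a (n≤1+n k)) p)) (≤-trans (+-monoʳ-≤ a (n≤1+n k)) p))
        (solve 5 (λ A B C zk za → (zk :+ za) :+ (A :+ B :+ (con 1 :+ (C :+ con 0)))
             := (con 1 :+ (A :+ con 0)) :+ (B :+ C :+ (zk :+ za)))
          refl (z (a + suc k)) (z (suc (a + k))) (z (a + k)) (z k) (z a))

    0∷-balanced⇒ : Balanced (0F ∷ u) → ∀ a k → a + suc k ≤ m → z (a + suc k) ≤ suc (z k + z a)
    0∷-balanced⇒ bal a k p =
      ≤-trans (≤-reflexive (sym (+-identityʳ _)))
        (balanced⇒WB bal (suc a) 0 (suc k) (s≤s p) (s≤s (m+n≤o⇒n≤o a (≤-trans (+-monoʳ-≤ a (n≤1+n k)) p))))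

    -- A failure for `0u` is a window of length `k + 1` with at least two ones more than the prefix
    -- of length `k`. By balance of `u`, such a surplus makes every window of `u` rich enough for
    -- `LeftExt`.
    balanced-left-extendable : Balanced u → Balanced (0F ∷ u) ⊎ Balanced (1F ∷ u)
    balanced-left-extendable bal with balanced? (1F ∷ u)
    ... | yes bal₁ = inj₂ bal₁
    ... | no ¬bal₁ = inj₁ (0∷-balanced⇐ bal λ i k p → ≮⇒≥ λ fail →
      ¬bal₁ (LeftExt⇒1∷-balanced bal λ a k′ q → ext i k p fail a k′ q (≤-total k k′)))
      where
      wb = balanced⇒WB bal
      ext : ∀ i k → i + suc k ≤ m → suc (suc (z k + z i)) ≤ z (i + suc k) →
            ∀ a k′ → a + suc k′ ≤ m → k ≤ k′ ⊎ k′ ≤ k → z k′ + z a ≤ z (a + suc k′)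
      -- The window at `a` is at least as long as the failing one. Its first `k + 1` letters hold at
      -- least one 1 more than the prefix of length `k`, which pays for a deficit of at most 1 in
      -- its other `e` letters.
      ext i k p fail a k′ q (inj₁ k≤k′) with e , refl ← m≤n⇒∃[o]m+o≡n k≤k′ =
        linear (fail ⊕ wb i a (suc k) p (≤-trans (m≤m+n _ e) q′)
                ⊕ wb k (a + suc k) e (≤-trans (n≤1+n _) (m+n≤o⇒n≤o a q)) q′
                ⊕ ≤-reflexive (cong z (+-assoc a (suc k) e)))
          (solve 8 (λ zk zi zik za zak zke zake zake′ →
              (zke :+ za) :+ (zik :+ (con 1 :+ (zak :+ zi)) :+ (con 1 :+ (zake :+ zk)) :+ zake′)
              := zake′ :+ ((con 2 :+ (zk :+ zi)) :+ (zik :+ za) :+ (zke :+ zak) :+ zake))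
            refl (z k) (z i) (z (i + suc k)) (z a) (z (a + suc k)) (z (k + e)) (z (a + suc k + e)) (z (a + suc (k + e))))
        where
        q′ : a + suc k + e ≤ m
        q′ = ≤-trans (≤-reflexive (+-assoc a (suc k) e)) q
      -- The failing window is cut after `k′ + 1` letters. Its last `e` letters exceed the matching
      -- part of the prefix by at most 1, so the first part holds at least one 1 more than the
      -- prefix of length `k′`; the window at `a` loses at most that one.
      ext i k p fail a k′ q (inj₂ k′≤k) with e , refl ← m≤n⇒∃[o]m+o≡n k′≤k =
        linear (fail ⊕ ≤-reflexive (cong z (sym (+-assoc i (suc k′) e)))
                ⊕ wb (i + suc k′) k′ e p′ (≤-trans (n≤1+n _) (m+n≤o⇒n≤o i p))
                ⊕ wb i a (suc k′) (≤-trans (m≤m+n _ e) p′) q)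
          (solve 8 (λ zk zi zik za zak zke zike zike′ →
              (zk :+ za) :+ (zike′ :+ zike :+ (con 1 :+ (zke :+ zik)) :+ (con 1 :+ (zak :+ zi)))
              := zak :+ ((con 2 :+ (zke :+ zi)) :+ zike′ :+ (zike :+ zk) :+ (zik :+ za)))
            refl (z k′) (z i) (z (i + suc k′)) (z a) (z (a + suc k′)) (z (k′ + e)) (z (i + suc k′ + e)) (z (i + suc (k′ + e))))
        where
        p′ : i + suc k′ + e ≤ m
        p′ = ≤-trans (≤-reflexive (+-assoc i (suc k′) e)) p

    private
      y = σ (u ∷ʳ 1F)

      y-last : y (suc m) ≡ suc (z m)
      y-last = σ-∷ʳ-last u 1F

      y-init : ∀ {i} → i ≤ m → y i ≡ z i
      y-init = σ-∷ʳ u 1F _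

    ∷ʳ1-balanced⇒RightExt : Balanced (u ∷ʳ 1F) → RightExt
    ∷ʳ1-balanced⇒RightExt bal a b k p q =
      linear (wb b a (suc k) (≤-reflexive e) (m≤n⇒m≤1+n p)
              ⊕ ≤-reflexive (sym (trans (cong y e) y-last)) ⊕ ≤-reflexive (sym (y-init (m+n≤o⇒m≤o a p)))
              ⊕ ≤-reflexive (y-init p) ⊕ ≤-reflexive (y-init (m+n≤o⇒m≤o b (≤-reflexive q))))
        (solve 8 (λ zm za zak zb ym ya yak yb →
            (zm :+ za) :+ ((con 1 :+ (yak :+ yb)) :+ ym :+ ya :+ zak :+ zb)
            := (zak :+ zb) :+ ((ym :+ ya) :+ (con 1 :+ zm) :+ za :+ yak :+ yb))
          refl (z m) (z a) (z (a + suc k)) (z b) (y (b + suc k)) (y a) (y (a + suc k)) (y b))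
      where
      e : b + suc k ≡ suc m
      e = trans (+-suc b k) (cong suc q)
      wb : WindowBalanced (suc m) y
      wb = subst (λ n → WindowBalanced n y) (length-∷ʳ u 1F) (balanced⇒WB bal)

    RightExt⇒∷ʳ1-balanced : Balanced u → RightExt → Balanced (u ∷ʳ 1F)
    RightExt⇒∷ʳ1-balanced bal ext =
      WB⇒balanced (subst (λ n → WindowBalanced n y) (sym (length-∷ʳ u 1F))
        (WB-snoc y (WB-cong (λ i p → sym (y-init p)) wb) lo hi))
      where
      wb = balanced⇒WB bal
      lo : ∀ a b k → a + suc k ≤ m → b + k ≡ m → y (suc m) + y a ≤ suc (y (a + suc k) + y b)
      lo a b k p q rewrite y-last | y-init p | y-init {a} (m+n≤o⇒m≤o a p) | y-init {b} (m+n≤o⇒m≤o b (≤-reflexive q)) =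
        s≤s (ext a b k p q)
      hi : ∀ a b k → a + suc k ≤ m → b + k ≡ m → y (a + suc k) + y b ≤ suc (y (suc m) + y a)
      hi a b k p q rewrite y-last | y-init p | y-init {a} (m+n≤o⇒m≤o a p) | y-init {b} (m+n≤o⇒m≤o b (≤-reflexive q)) =
        linear (wb a b k (≤-trans (+-monoʳ-≤ a (n≤1+n k)) p) (≤-reflexive q)
                ⊕ ≤-reflexive (cong z (+-suc a k)) ⊕ σ-upper u (a + k) ⊕ ≤-reflexive (cong z q))
          (solve 7 (λ zm za zak zb zak′ zak″ zbk →
              (zak :+ zb) :+ ((con 1 :+ (zbk :+ za)) :+ zak″ :+ (con 1 :+ zak′) :+ zm)
              := (con 1 :+ (con 1 :+ zm :+ za)) :+ ((zak′ :+ zb) :+ zak :+ zak″ :+ zbk))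
            refl (z m) (z a) (z (a + suc k)) (z b) (z (a + k)) (z (suc (a + k))) (z (b + k)))

  -- Two windows of 1u1 of equal length both lie in 1u or both lie in u1, except for
  -- a prefix and a suffix; without the border, these are two windows of u.
  1∷∷ʳ1-balanced : ∀ u → Balanced (1F ∷ u) → Balanced (u ∷ʳ 1F) → Balanced (1F ∷ u ∷ʳ 1F)
  1∷∷ʳ1-balanced u bal₁ bal₂ =
    WB⇒balanced (subst (λ n → WindowBalanced (suc n) Y) (sym (length-∷ʳ u 1F))
      (WB-snoc Y (WB-cong same (balanced⇒WB bal₁)) lo hi))
    where
    m = length u
    z = σ u
    y = σ (u ∷ʳ 1F)
    Y = σ (1F ∷ u ∷ʳ 1F)
    same : ∀ i → i ≤ suc m → σ (1F ∷ u) i ≡ Y i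
    same zero    _       = refl
    same (suc i) (s≤s p) = cong suc (sym (σ-∷ʳ u 1F i p))
    wb = balanced⇒WB (balanced-tail bal₁)
    wb₂ : WindowBalanced (suc m) y
    wb₂ = subst (λ n → WindowBalanced n y) (length-∷ʳ u 1F) (balanced⇒WB bal₂)
    lo : ∀ a b k → a + suc k ≤ suc m → b + k ≡ suc m → Y (suc (suc m)) + Y a ≤ suc (Y (a + suc k) + Y b)
    lo a       zero    k p       refl = contradiction (m+n≤o⇒n≤o a p) 1+n≰n
    lo (suc a) (suc b) k (s≤s p) q    =
      linear (wb₂ b a (suc k) (≤-reflexive (trans (+-suc b k) q)) (m≤n⇒m≤1+n p)
              ⊕ ≤-reflexive (cong y (sym (trans (+-suc b k) q))))
        (solve 5 (λ A B C D E → (con 1 :+ A :+ (con 1 :+ B)) :+ ((con 1 :+ (C :+ D)) :+ E) := (con 1 :+ (con 1 :+ C :+ (con 1 :+ D))) :+ ((E :+ B) :+ A))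
          refl (y (suc m)) (y a) (y (a + suc k)) (y b) (y (b + suc k)))
    lo zero    (suc b) k (s≤s p) q
      rewrite σ-∷ʳ-last u 1F | σ-∷ʳ u 1F k p | σ-∷ʳ u 1F b (m+n≤o⇒m≤o b (≤-reflexive (suc-injective q))) =
      linear (wb b 0 k (≤-reflexive (suc-injective q)) p ⊕ ≤-reflexive (cong z (sym (suc-injective q))))
        (solve 4 (λ A B C D → (con 2 :+ A :+ con 0) :+ ((con 1 :+ (B :+ C)) :+ D) := (con 1 :+ (con 1 :+ B :+ (con 1 :+ C))) :+ ((D :+ con 0) :+ A))
          refl (z m) (z k) (z b) (z (b + k)))
    hi : ∀ a b k → a + suc k ≤ suc m → b + k ≡ suc m → Y (a + suc k) + Y b ≤ suc (Y (suc (suc m)) + Y a)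
    hi a       zero    k p       refl = contradiction (m+n≤o⇒n≤o a p) 1+n≰n
    hi (suc a) (suc b) k (s≤s p) q    =
      linear (wb₂ a b (suc k) (m≤n⇒m≤1+n p) (≤-reflexive (trans (+-suc b k) q))
              ⊕ ≤-reflexive (cong y (trans (+-suc b k) q)))
        (solve 5 (λ A B C D E → (con 1 :+ C :+ (con 1 :+ D)) :+ ((con 1 :+ (E :+ B)) :+ A) := (con 1 :+ (con 1 :+ A :+ (con 1 :+ B))) :+ ((C :+ D) :+ E))
          refl (y (suc m)) (y a) (y (a + suc k)) (y b) (y (b + suc k)))
    hi zero    (suc b) k (s≤s p) q
      rewrite σ-∷ʳ-last u 1F | σ-∷ʳ u 1F k p | σ-∷ʳ u 1F b (m+n≤o⇒m≤o b (≤-reflexive (suc-injective q))) =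
      linear (wb 0 b k p (≤-reflexive (suc-injective q)) ⊕ ≤-reflexive (cong z (suc-injective q)))
        (solve 4 (λ A B C D → (con 1 :+ B :+ (con 1 :+ C)) :+ ((con 1 :+ (D :+ con 0)) :+ A) := (con 1 :+ (con 2 :+ A :+ con 0)) :+ ((B :+ C) :+ D))
          refl (z m) (z k) (z b) (z (b + k)))

  -- Exchange of the two letters

  flip : Fin 2 → Fin 2
  flip 0F = 1F
  flip 1F = 0F

  complement : Word → Word
  complement = map flip

  complement-involutive : ∀ {w} → complement (complement w) ≡ w
  complement-involutive {[]}     = refl
  complement-involutive {0F ∷ w} = cong (0F ∷_) complement-involutive
  complement-involutive {1F ∷ w} = cong (1F ∷_) complement-involutive

  σ-complement : ∀ w i → i ≤ length w → σ (complement w) i + σ w i ≡ i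
  σ-complement w        zero    _       = refl
  σ-complement (0F ∷ w) (suc i) (s≤s p) = cong suc (σ-complement w i p)
  σ-complement (1F ∷ w) (suc i) (s≤s p) = trans (+-suc _ _) (cong suc (σ-complement w i p))

  height-complement : ∀ w → height (complement w) + height w ≡ length w
  height-complement []       = refl
  height-complement (0F ∷ w) = cong suc (height-complement w)
  height-complement (1F ∷ w) = trans (+-suc _ _) (cong suc (height-complement w))

  complement-balanced : ∀ w → Balanced w → Balanced (complement w)
  complement-balanced w bal = WB⇒balanced wb′
    where
    wb = balanced⇒WB bal
    z = σ w
    z′ = σ (complement w)
    e : ∀ i → i ≤ length w → z′ i + z i ≡ i
    e = σ-complement w
    wb′ : WindowBalanced (length (complement w)) z′
    wb′ i j d p q rewrite length-map flip w =
      -- Prefix heights become `i - z i`, so the two windows change places.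
      linear (wb j i d q p ⊕ ≤-reflexive (e (i + d) p) ⊕ ≤-reflexive (e j (m+n≤o⇒m≤o j q))
              ⊕ ≤-reflexive (sym (e (j + d) q)) ⊕ ≤-reflexive (sym (e i (m+n≤o⇒m≤o i p))))
        (solve 11 (λ i j d A B C D A′ B′ C′ D′ →
            (A′ :+ B′) :+ ((con 1 :+ (A :+ B)) :+ (i :+ d) :+ j :+ (C′ :+ C) :+ (D′ :+ D))
            := (con 1 :+ (C′ :+ D′)) :+ ((C :+ D) :+ (A′ :+ A) :+ (B′ :+ B) :+ (j :+ d) :+ i))
          refl i j d (z (i + d)) (z j) (z (j + d)) (z i) (z′ (i + d)) (z′ j) (z′ (j + d)) (z′ i))

  -- Left special words and Farey fractions

  ∈-words⁻ : ∀ n {w} → w ∈ words n → length w ≡ n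
  ∈-words⁻ zero    (here refl) = refl
  ∈-words⁻ (suc n) w∈ with _ , _ , _ , w′∈ , refl ← ∈-cartesianProductWith⁻ _∷_ (allFin 2) (words n) w∈ =
    cong suc (∈-words⁻ n w′∈)

  ∈-words⁺ : ∀ {n w} → length w ≡ n → w ∈ words n
  ∈-words⁺ refl = ∈-words _

  ∈-range⁺ : ∀ {n k} → 1 ≤ k → k ≤ n → k ∈ range n
  ∈-range⁺ {k = suc k} _ k<n = ∈-map⁺ suc (∈-upTo⁺ k<n)

  ∈-range⁻ : ∀ {n k} → k ∈ range n → 1 ≤ k × k ≤ n
  ∈-range⁻ {n} k∈ with _ , i∈ , refl ← ∈-map⁻ suc k∈ = s≤s z≤n , ∈-upTo⁻ i∈

  range-unique : ∀ n → Unique (range n)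
  range-unique n = Unique.map⁺ suc-injective (Unique.upTo⁺ n)

  LeftSpecial : Word → Set
  LeftSpecial u = Balanced (0F ∷ u) × Balanced (1F ∷ u)

  leftSpecial? : ∀ u → Dec (LeftSpecial u)
  leftSpecial? u = balanced? (0F ∷ u) ×-dec balanced? (1F ∷ u)

  -- z i = ⌈ (i + 1) p / q ⌉ - 1 for i ≤ n.
  record Mechanical (q p n : ℕ) (z : ℕ → ℕ) : Set where
    field
      below : ∀ {i} → i ≤ n → q * z i < suc i * p
      above : ∀ {i} → i ≤ n → suc i * p ≤ q * suc (z i)

  open Mechanical

  module _ {q p n z} (mech : Mechanical q p n z) where

    open Mechanical mech using () renaming (below to lower; above to upper)

    -- The linear parts cancel in the sum of the four bounds, which leaves a difference of window
    -- heights below 2; the strictness of `below` makes it at most 1.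
    mechanical-WB : WindowBalanced n z
    mechanical-WB i j d r s = s≤s⁻¹ (*-cancelˡ-< q _ _ (linear
      (lower r ⊕ <⇒≤ (lower (m+n≤o⇒m≤o j s)) ⊕ upper s ⊕ upper (m+n≤o⇒m≤o i r))
      (solve 9 (λ i j d p q A B C D →
         (con 1 :+ q :* (A :+ B)) :+ ((con 1 :+ (i :+ d)) :* p :+ (con 1 :+ j) :* p :+ q :* (con 1 :+ C) :+ q :* (con 1 :+ D))
         := (q :* (con 2 :+ (C :+ D))) :+ ((con 1 :+ q :* A) :+ q :* B :+ (con 1 :+ (j :+ d)) :* p :+ (con 1 :+ i) :* p))
       refl i j d p q (z (i + d)) (z j) (z (j + d)) (z i))))

    -- The shift by one in `Mechanical` fits exactly: `(k + 1) + (a + 1)` is the multiple of `p`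
    -- attached to the index `a + (k + 1)`. Subadditivity uses the same identity with the bounds
    -- exchanged.
    mechanical-superadditive : ∀ a k → a + suc k ≤ n → z k + z a ≤ z (a + suc k)
    mechanical-superadditive a k r = s≤s⁻¹ (*-cancelˡ-< q _ _ (linear
      (lower (≤-trans (n≤1+n k) (m+n≤o⇒n≤o a r)) ⊕ <⇒≤ (lower (m+n≤o⇒m≤o a r)) ⊕ upper r)
      (solve 7 (λ a k p q A B C →
         (con 1 :+ q :* (A :+ B)) :+ ((con 1 :+ k) :* p :+ (con 1 :+ a) :* p :+ q :* (con 1 :+ C))
         := (q :* (con 1 :+ C)) :+ ((con 1 :+ q :* A) :+ q :* B :+ (con 1 :+ (a :+ (con 1 :+ k))) :* p))
       refl a k p q (z k) (z a) (z (a + suc k)))))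

    mechanical-subadditive : ∀ a k → a + suc k ≤ n → z (a + suc k) ≤ suc (z k + z a)
    mechanical-subadditive a k r = s≤s⁻¹ (*-cancelˡ-< q _ _ (linear
      (upper (≤-trans (n≤1+n k) (m+n≤o⇒n≤o a r)) ⊕ upper (m+n≤o⇒m≤o a r) ⊕ lower r)
      (solve 7 (λ a k p q A B C →
         (con 1 :+ q :* C) :+ (q :* (con 1 :+ A) :+ q :* (con 1 :+ B) :+ (con 1 :+ (a :+ (con 1 :+ k))) :* p)
         := (q :* (con 2 :+ (A :+ B))) :+ ((con 1 :+ k) :* p :+ (con 1 :+ a) :* p :+ (con 1 :+ q :* C)))
       refl a k p q (z k) (z a) (z (a + suc k)))))

  mechanical⇒leftSpecial : ∀ {q p} u → Mechanical q p (length u) (σ u) → LeftSpecial u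
  mechanical⇒leftSpecial u mech =
    0∷-balanced⇐ u bal (mechanical-subadditive mech) ,
    LeftExt⇒1∷-balanced u bal (mechanical-superadditive mech)
    where
    bal : Balanced u
    bal = WB⇒balanced (mechanical-WB mech)

  mechanical-unique : ∀ {q p n z z′} → Mechanical q p n z → Mechanical q p n z′ →
                      ∀ i → i ≤ n → z i ≡ z′ i
  mechanical-unique {q} m m′ i i≤n = ≤-antisym (half m m′) (half m′ m)
    where
    half : ∀ {p z z′} → Mechanical q p _ z → Mechanical q p _ z′ → z i ≤ z′ i
    half m m′ = s≤s⁻¹ (*-cancelˡ-< q _ _ (<-≤-trans (below m i≤n) (above m′ i≤n)))

  -- The slope is read off at the index `q - 1`, where `(i + 1) p / q` is the integer `p`; this
  -- index is within range once `q ≤ n + 1`. The height there is below `p`, which bounds the other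
  -- slope by `p / q`.
  mechanical-slope : ∀ {q p q′ p′ n z} → q ≤ suc n → q′ ≤ suc n → Mechanical q p n z → Mechanical q′ p′ n z →
                     1 ≤ q → 1 ≤ q′ → q * p′ ≤ q′ * p
  mechanical-slope {suc q} {p} {q′} {p′} {z = z} (s≤s q≤n) _ m m′ _ _ = begin
    suc q * p′      ≤⟨ above m′ q≤n ⟩
    q′ * suc (z q)  ≤⟨ *-monoʳ-≤ q′ (*-cancelˡ-< (suc q) (z q) p (below m q≤n)) ⟩
    q′ * p          ∎
    where open ≤-Reasoning

  coprime-fraction-unique : ∀ {p q p′ q′} → 1 ≤ q → Coprime p q → Coprime p′ q′ →
                            q * p′ ≡ q′ * p → q ≡ q′ × p ≡ p′
  coprime-fraction-unique {p} {q@(suc _)} {p′} {q′} _ c c′ eq with q≡q′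
    where
    q≡q′ : q ≡ q′
    q≡q′ = ∣-antisym
      (coprime-divisor (Coprime.sym c) (divides p′ (trans (*-comm p q′) (trans (sym eq) (*-comm q p′)))))
      (coprime-divisor (Coprime.sym c′) (divides p (trans (*-comm p′ q) (trans eq (*-comm q′ p)))))
  ... | refl = refl , sym (*-cancelˡ-≡ p′ p q eq)

  -- ⌈ i p / q ⌉ - 1 for i > 0, and the junk value 0 for i = 0 or q = 0.
  fractionSteps : ℕ → ℕ → ℕ → ℕ
  fractionSteps zero    p i = 0
  fractionSteps (suc q) p i = (i * p ∸ 1) / suc q

  module _ {q p} (1≤p : 1 ≤ p) (p≤q : p ≤ suc q) where

    private
      y = fractionSteps (suc q) p

      nonneg : ∀ i → suc (suc i * p ∸ 1) ≡ suc i * p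
      nonneg i = m+[n∸m]≡n (≤-trans 1≤p (m≤m+n p (i * p)))

      y-below : ∀ i → suc q * y (suc i) < suc i * p
      y-below i = begin
        suc (suc q * y (suc i))    ≡⟨ cong suc (*-comm (suc q) (y (suc i))) ⟩
        suc (y (suc i) * suc q)    ≤⟨ s≤s (m/n*n≤m (suc i * p ∸ 1) (suc q)) ⟩
        suc (suc i * p ∸ 1)        ≡⟨ nonneg i ⟩
        suc i * p                  ∎
        where open ≤-Reasoning

      y-above : ∀ i → suc i * p ≤ suc q * suc (y (suc i))
      y-above i = begin
        suc i * p                                              ≡⟨ nonneg i ⟨
        suc (suc i * p ∸ 1)                                    ≡⟨ cong suc (m≡m%n+[m/n]*n (suc i * p ∸ 1) (suc q)) ⟩
        suc ((suc i * p ∸ 1) % suc q) + y (suc i) * suc q      ≤⟨ +-monoˡ-≤ _ (m%n<n (suc i * p ∸ 1) (suc q)) ⟩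
        suc q + y (suc i) * suc q                              ≡⟨ *-comm (suc (y (suc i))) (suc q) ⟩
        suc q * suc (y (suc i))                                ∎
        where open ≤-Reasoning

    private
      -- A slope in (0,1] has ceiling 1, so the sequence read from index 1 starts at 0, as prefix
      -- heights do.
      y1≡0 : y 1 ≡ 0
      y1≡0 = n<1⇒n≡0 (*-cancelˡ-< (suc q) (y 1) 1 (≤-trans (y-below 0)
               (≤-trans (≤-reflexive (*-identityˡ p)) (≤-trans p≤q (≤-reflexive (sym (*-identityʳ (suc q))))))))

      steps : ∀ n → Steps n (y ∘ suc)
      steps n i _ =
        /-monoˡ-≤ (suc q) (∸-monoˡ-≤ 1 (*-monoˡ-≤ p (n≤1+n (suc i)))) ,
        s≤s⁻¹ (*-cancelˡ-< (suc q) _ _ (linear (y-below (suc i) ⊕ y-above i ⊕ p≤q)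
          (solve 5 (λ q p i A B →
              (con 1 :+ (con 1 :+ q) :* A) :+ ((con 2 :+ i) :* p :+ (con 1 :+ q) :* (con 1 :+ B) :+ (con 1 :+ q))
              := ((con 1 :+ q) :* (con 2 :+ B)) :+ ((con 1 :+ (con 1 :+ q) :* A) :+ (con 1 :+ i) :* p :+ p))
            refl q p i (y (suc (suc i))) (y (suc i)))))

    σ-fraction : ∀ n i → i ≤ n → y (suc i) ≡ σ (build n (y ∘ suc)) i
    σ-fraction n i i≤n =
      trans (sym (σ-build n (y ∘ suc) (steps n) i i≤n)) (trans (cong (σ (build n (y ∘ suc)) i +_) y1≡0) (+-identityʳ _))

    σ-fraction-mechanical : ∀ n → Mechanical (suc q) p n (σ (build n (y ∘ suc)))
    σ-fraction-mechanical n = record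
      { below = λ {i} i≤n → subst (λ t → suc q * t < suc i * p) (σ-fraction n i i≤n) (y-below i)
      ; above = λ {i} i≤n → subst (λ t → suc i * p ≤ suc q * suc t) (σ-fraction n i i≤n) (y-above i)
      }

  <⇒∃+suc : ∀ {m n} → m < n → ∃ λ o → n ≡ m + suc o
  <⇒∃+suc {m} m<n with o , refl ← m≤n⇒∃[o]m+o≡n m<n = o , sym (+-suc m o)

  -- The slope is the least (z i + 1) / (i + 1); comparing with every z i works by
  -- a Euclidean descent on the pair of indices.
  module _ {n} (z : ℕ → ℕ) (sup : ∀ a k → a + suc k ≤ n → z k + z a ≤ z (a + suc k))
                 (sub : ∀ a k → a + suc k ≤ n → z (a + suc k) ≤ suc (z k + z a)) where

    slope-bound : ∀ s a k → a + k < s → a ≤ n → k ≤ n → suc k * z a < suc a * suc (z k)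
    slope-bound (suc s) a k (s≤s a+k≤s) a≤n k≤n with <-cmp a k
    ... | tri< a<k _ _ with e , refl ← <⇒∃+suc a<k = linear
        (slope-bound s a e (≤-trans (+-monoʳ-< a (≤-trans (n<1+n e) (m≤n+m (suc e) a))) a+k≤s) a≤n (≤-trans (n≤1+n e) (m+n≤o⇒n≤o a k≤n))
          ⊕ *-monoʳ-≤ (suc a) (sup a e k≤n))
        (solve 5 (λ a e A E K →
            (con 1 :+ (con 1 :+ (a :+ (con 1 :+ e))) :* A) :+ ((con 1 :+ a) :* (con 1 :+ E) :+ (con 1 :+ a) :* K)
            := ((con 1 :+ a) :* (con 1 :+ K)) :+ ((con 1 :+ (con 1 :+ e) :* A) :+ (con 1 :+ a) :* (E :+ A)))
          refl a e (z a) (z e) (z (a + suc e)))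
    ... | tri≈ _ refl _ = *-monoʳ-< (suc a) (n<1+n (z a))
    ... | tri> _ _ k<a with e , refl ← <⇒∃+suc k<a = linear
        (slope-bound s e k (≤-trans (+-monoˡ-< k (m≤n+m (suc e) k)) a+k≤s) (≤-trans (n≤1+n e) (m+n≤o⇒n≤o k a≤n)) k≤n
          ⊕ *-monoʳ-≤ (suc k) (sub k e a≤n))
        (solve 5 (λ k e A E K →
            (con 1 :+ (con 1 :+ k) :* A) :+ ((con 1 :+ e) :* (con 1 :+ K) :+ (con 1 :+ k) :* (con 1 :+ (E :+ K)))
            := ((con 1 :+ (k :+ (con 1 :+ e))) :* (con 1 :+ K)) :+ ((con 1 :+ (con 1 :+ k) :* E) :+ (con 1 :+ k) :* A))
          refl k e (z (k + suc e)) (z e) (z k))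

  least-slope : ∀ n (z : ℕ → ℕ) → ∃ λ e → e ≤ n × ∀ i → i ≤ n → suc i * suc (z e) ≤ suc e * suc (z i)
  least-slope zero    z = 0 , z≤n , λ { zero _ → ≤-refl }
  least-slope (suc n) z with e , e≤n , le ← least-slope n z
                      | ≤-total (suc (suc n) * suc (z e)) (suc e * suc (z (suc n)))
  ... | inj₁ p = e , m≤n⇒m≤1+n e≤n , λ i i≤ → [ (λ i<1+n → le i (s≤s⁻¹ i<1+n)) , (λ { refl → p }) ]′ (m≤n⇒m<n∨m≡n i≤)
  -- Cross-multiplied fractions are chained by multiplying with `suc e` and cancelling it again.
  ... | inj₂ p = suc n , ≤-refl , λ i i≤ → [ (λ i<1+n → *-cancelˡ-≤ (suc e) (chain i (s≤s⁻¹ i<1+n))) , (λ { refl → ≤-refl }) ]′ (m≤n⇒m<n∨m≡n i≤)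
    where
    open ≤-Reasoning
    chain : ∀ i → i ≤ n → suc e * (suc i * suc (z (suc n))) ≤ suc e * (suc (suc n) * suc (z i))
    chain i i≤n = begin
      suc e * (suc i * suc (z (suc n)))       ≡⟨ solve 3 (λ a b c → a :* (b :* c) := b :* (a :* c)) refl (suc e) (suc i) (suc (z (suc n))) ⟩
      suc i * (suc e * suc (z (suc n)))       ≤⟨ *-monoʳ-≤ (suc i) p ⟩
      suc i * (suc (suc n) * suc (z e))       ≡⟨ solve 3 (λ a b c → a :* (b :* c) := b :* (a :* c)) refl (suc i) (suc (suc n)) (suc (z e)) ⟩
      suc (suc n) * (suc i * suc (z e))       ≤⟨ *-monoʳ-≤ (suc (suc n)) (le i i≤n) ⟩
      suc (suc n) * (suc e * suc (z i))       ≡⟨ solve 3 (λ a b c → a :* (b :* c) := b :* (a :* c)) refl (suc (suc n)) (suc e) (suc (z i)) ⟩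
      suc e * (suc (suc n) * suc (z i))       ∎

  lowest-terms : ∀ P Q → 1 ≤ Q → ∃₂ λ p q → ∃ λ g → 1 ≤ g × P ≡ g * p × Q ≡ g * q × Coprime p q
  lowest-terms P Q@(suc _) _ =
    P / g , Q / g , g , n≢0⇒n>0 g≢0 , sym (m*[n/m]≡n (gcd[m,n]∣m P Q)) , sym (m*[n/m]≡n (gcd[m,n]∣n P Q)) , coprime-/gcd P Q
    where
    g = gcd P Q
    g≢0 : g ≢ 0
    g≢0 = gcd[m,n]≢0 P Q (inj₂ λ ())
    instance _ = ≢-nonZero g≢0

  -- Take the minimal fraction in lowest terms: minimality is `upper`, and `slope-bound` is `lower`.
  -- Reduction can only lower the denominator `e + 1`, and a prefix of length `e` has height at most
  -- `e`, so the slope is at most 1.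
  leftSpecial⇒mechanical : ∀ u → LeftSpecial u →
    ∃₂ λ q p → 1 ≤ q × q ≤ suc (length u) × 1 ≤ p × p ≤ q × Coprime p q × Mechanical q p (length u) (σ u)
  leftSpecial⇒mechanical u (bal₀ , bal₁)
    with e , e≤n , le ← least-slope (length u) (σ u)
    with p , q , g@(suc _) , _ , P≡ , Q≡ , c ← lowest-terms (suc (σ u e)) (suc e) (s≤s z≤n) =
    q , p , positive Q≡ , ≤-trans (subst (q ≤_) (sym Q≡) (m≤n*m q g)) (s≤s e≤n) , positive P≡ ,
    *-cancelˡ-≤ g (subst₂ _≤_ P≡ Q≡ (s≤s (σ≤ u e))) , c , mech
    where
    positive : ∀ {m k} → suc m ≡ g * k → 1 ≤ k
    positive {k = zero}  eq = contradiction (trans eq (*-zeroʳ g)) λ ()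
    positive {k = suc k} eq = s≤s z≤n
    σ≤ : ∀ w i → σ w i ≤ i
    σ≤ w zero    = z≤n
    σ≤ w (suc i) = ≤-trans (σ-upper w i) (s≤s (σ≤ w i))
    open ≤-Reasoning
    mech : Mechanical q p (length u) (σ u)
    mech = record { below = lower ; above = upper }
      where
      lower : ∀ {i} → i ≤ length u → q * σ u i < suc i * p
      lower {i} i≤n = *-cancelˡ-< g _ _ (begin-strict
        g * (q * σ u i)      ≡⟨ *-assoc g q (σ u i) ⟨
        g * q * σ u i        ≡⟨ cong (_* σ u i) Q≡ ⟨
        suc e * σ u i        <⟨ slope-bound (σ u) (1∷-balanced⇒LeftExt u bal₁) (0∷-balanced⇒ u bal₀) (suc (i + e)) i e ≤-refl i≤n e≤n ⟩
        suc i * suc (σ u e)  ≡⟨ cong (suc i *_) P≡ ⟩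
        suc i * (g * p)      ≡⟨ solve 3 (λ a b c → a :* (b :* c) := b :* (a :* c)) refl (suc i) g p ⟩
        g * (suc i * p)      ∎)
      upper : ∀ {i} → i ≤ length u → suc i * p ≤ q * suc (σ u i)
      upper {i} i≤n = *-cancelˡ-≤ g (begin
        g * (suc i * p)      ≡⟨ solve 3 (λ a b c → a :* (b :* c) := b :* (a :* c)) refl g (suc i) p ⟩
        suc i * (g * p)      ≡⟨ cong (suc i *_) P≡ ⟨
        suc i * suc (σ u e)  ≤⟨ le i i≤n ⟩
        suc e * suc (σ u i)  ≡⟨ cong (_* suc (σ u i)) Q≡ ⟩
        g * q * suc (σ u i)  ≡⟨ *-assoc g q (suc (σ u i)) ⟩
        g * (q * suc (σ u i)) ∎)

  numerators : ℕ → List ℕ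
  numerators q = filter (λ p → coprime? p q) (range q)

  fractions : ℕ → List (ℕ × ℕ)
  fractions n = pairs (range n) numerators

  -- The reduced fractions are listed by denominator, which produces the totients. The extremes are
  -- `1 / (n + 1)` for the word of zeros and `1 / 1` for the word of ones.
  #leftSpecial : ∀ n → length (filter leftSpecial? (words n)) ≡ sum (map φ (range (suc n)))
  #leftSpecial n = trans (sym (bijection⇒length {f = f} fractions! words! into inj onto)) (length-pairs {g = numerators} (range (suc n)))
    where
    f : ℕ × ℕ → Word
    f (q , p) = build n (fractionSteps q p ∘ suc)
    fractions! : Unique (fractions (suc n))
    fractions! = pairs-unique (range-unique (suc n)) (λ q → Unique.filter⁺ (λ p → coprime? p q) (range-unique q))
    words! : Unique (filter leftSpecial? (words n))
    words! = Unique.filter⁺ leftSpecial? (words-unique n)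
    members : ∀ {x} → x ∈ fractions (suc n) →
      1 ≤ proj₁ x × proj₁ x ≤ suc n × Coprime (proj₂ x) (proj₁ x) × Mechanical (proj₁ x) (proj₂ x) n (σ (f x))
    members {q , p} x∈
      with q∈ , p∈ ← ∈-pairs⁻ {g = numerators} (range (suc n)) x∈
      with p∈r , c ← ∈-filter⁻ (λ p → coprime? p q) {xs = range q} p∈
      with s≤s z≤n , q≤ ← ∈-range⁻ q∈ | 1≤p , p≤q ← ∈-range⁻ p∈r =
      s≤s z≤n , q≤ , c , σ-fraction-mechanical 1≤p p≤q n
    into : ∀ {x} → x ∈ fractions (suc n) → f x ∈ filter leftSpecial? (words n)
    into {q , p} x∈ with _ , _ , _ , m ← members x∈ =
      ∈-filter⁺ leftSpecial? (∈-words⁺ (length-build n _))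
        (mechanical⇒leftSpecial (f (q , p)) (subst (λ k → Mechanical q p k (σ (f (q , p)))) (sym (length-build n _)) m))
    inj : ∀ {x x′} → x ∈ fractions (suc n) → x′ ∈ fractions (suc n) → f x ≡ f x′ → x ≡ x′
    inj {q , p} {q′ , p′} x∈ x′∈ eq
      with 1≤q , q≤ , c , m ← members x∈ | 1≤q′ , q′≤ , c′ , m′ ← members x′∈
      with m″ ← subst (λ w → Mechanical q′ p′ n (σ w)) (sym eq) m′
      with refl , refl ← coprime-fraction-unique 1≤q c c′
                           (≤-antisym (mechanical-slope q≤ q′≤ m m″ 1≤q 1≤q′) (mechanical-slope q′≤ q≤ m″ m 1≤q′ 1≤q)) = refl
    onto : ∀ {u} → u ∈ filter leftSpecial? (words n) → ∃ λ x → x ∈ fractions (suc n) × f x ≡ u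
    onto {u} u∈
      with u∈w , ls ← ∈-filter⁻ leftSpecial? {xs = words n} u∈
      with refl ← ∈-words⁻ n u∈w
      with q@(suc _) , p , 1≤q , q≤ , 1≤p , p≤q , c , m ← leftSpecial⇒mechanical u ls =
      (q , p) , ∈-pairs⁺ {g = numerators} (∈-range⁺ 1≤q q≤) (∈-filter⁺ (λ p → coprime? p q) (∈-range⁺ 1≤p p≤q) c) ,
      σ-injective (length-build n _) λ i i≤ →
        mechanical-unique (σ-fraction-mechanical 1≤p p≤q n) m i (subst (i ≤_) (length-build n _) i≤)

  -- Counting balanced words

  balancedWords : ℕ → List Word
  balancedWords n = filter balanced? (words n)

  #balanced : ℕ → ℕ
  #balanced n = length (balancedWords n)

  ∈-balancedWords⁺ : ∀ {n w} → Balanced w → length w ≡ n → w ∈ balancedWords n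
  ∈-balancedWords⁺ bal l = ∈-filter⁺ balanced? (∈-words⁺ l) bal

  ∈-balancedWords⁻ : ∀ n {w} → w ∈ balancedWords n → Balanced w × length w ≡ n
  ∈-balancedWords⁻ n w∈ with w∈′ , bal ← ∈-filter⁻ balanced? {xs = words n} w∈ = bal , ∈-words⁻ n w∈′

  balancedWords-unique : ∀ n → Unique (balancedWords n)
  balancedWords-unique n = Unique.filter⁺ balanced? (words-unique n)

  complement-length : ∀ w → length (complement w) ≡ length w
  complement-length = length-map flip

  complement-injective : ∀ {u v} → complement u ≡ complement v → u ≡ v
  complement-injective eq = trans (sym complement-involutive) (trans (cong complement eq) complement-involutive)

  -- Abstract in the side of the extension, so that one count by exchange of letters serves both
  -- ends of a word.
  module Extension (ext : Fin 2 → Word → Word)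
    (ext-injective : ∀ {a b u v} → ext a u ≡ ext b v → a ≡ b × u ≡ v)
    (ext-onto : ∀ n w → length w ≡ suc n → ∃₂ λ a u → length u ≡ n × ext a u ≡ w)
    (length-ext : ∀ a u → length (ext a u) ≡ suc (length u))
    (complement-ext : ∀ a u → complement (ext a u) ≡ ext (flip a) (complement u)) where

    extendable : Fin 2 → ℕ → List Word
    extendable a n = filter (λ u → balanced? (ext a u)) (words n)

    #balanced-ext : ∀ n → length (extendable 0F n) + length (extendable 1F n) ≡ #balanced (suc n)
    #balanced-ext n = begin
      length (extendable 0F n) + length (extendable 1F n)         ≡⟨ cong (length (extendable 0F n) +_) (+-identityʳ _) ⟨
      length (extendable 0F n) + (length (extendable 1F n) + 0)   ≡⟨ length-pairs {g = ext-list} letters ⟨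
      length (pairs letters ext-list)                              ≡⟨ bijection⇒length {f = f} list! (balancedWords-unique (suc n)) into inj onto ⟩
      #balanced (suc n)                                            ∎
      where
      open ≡-Reasoning
      letters : List (Fin 2)
      letters = 0F ∷ 1F ∷ []
      ext-list : Fin 2 → List Word
      ext-list a = extendable a n
      f : Fin 2 × Word → Word
      f (a , u) = ext a u
      list! : Unique (pairs letters ext-list)
      list! = pairs-unique (((λ ()) All.∷ All.[]) ∷ All.[] ∷ []) (λ a → Unique.filter⁺ (λ u → balanced? (ext a u)) (words-unique n))
      into : ∀ {x} → x ∈ pairs letters ext-list → f x ∈ balancedWords (suc n)
      into {a , u} x∈
        with u∈ , bal ← ∈-filter⁻ (λ u → balanced? (ext a u)) {xs = words n} (proj₂ (∈-pairs⁻ {g = ext-list} letters x∈)) =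
        ∈-balancedWords⁺ bal (trans (length-ext a u) (cong suc (∈-words⁻ n u∈)))
      inj : ∀ {x y} → x ∈ pairs letters ext-list → y ∈ pairs letters ext-list → f x ≡ f y → x ≡ y
      inj _ _ eq with refl , refl ← ext-injective eq = refl
      letter∈ : ∀ a → a ∈ letters
      letter∈ 0F = here refl
      letter∈ 1F = there (here refl)
      onto : ∀ {w} → w ∈ balancedWords (suc n) → ∃ λ x → x ∈ pairs letters ext-list × f x ≡ w
      onto {w} w∈ with bal , l ← ∈-balancedWords⁻ (suc n) w∈ with a , u , lu , refl ← ext-onto n w l =
        (a , u) , ∈-pairs⁺ {g = ext-list} (letter∈ a) (∈-filter⁺ (λ u → balanced? (ext a u)) (∈-words⁺ lu) bal) , refl

    #extendable-flip : ∀ n → length (extendable 0F n) ≡ length (extendable 1F n)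
    #extendable-flip n = bijection⇒length {f = complement}
      (Unique.filter⁺ (λ u → balanced? (ext 0F u)) (words-unique n)) (Unique.filter⁺ (λ u → balanced? (ext 1F u)) (words-unique n))
      (into 0F) (λ _ _ → complement-injective)
      (λ {w} w∈ → complement w , into 1F w∈ , complement-involutive)
      where
      into : ∀ a {u} → u ∈ extendable a n → complement u ∈ extendable (flip a) n
      into a {u} u∈ with u∈w , bal ← ∈-filter⁻ (λ u → balanced? (ext a u)) {xs = words n} u∈ =
        ∈-filter⁺ (λ u → balanced? (ext (flip a) u)) (∈-words⁺ (trans (complement-length u) (∈-words⁻ n u∈w)))
          (subst Balanced (complement-ext a u) (complement-balanced (ext a u) bal))

    -- Exchanging the letters pairs extensions by 1 with extensions by 0. Together these are all
    -- balanced words of length `n + 1`, so each kind makes up half.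
    2*#extendable : ∀ n → 2 * length (extendable 1F n) ≡ #balanced (suc n)
    2*#extendable n = trans (cong (length (extendable 1F n) +_) (+-identityʳ _))
      (trans (cong (_+ length (extendable 1F n)) (sym (#extendable-flip n))) (#balanced-ext n))

  cons-onto : ∀ n (w : Word) → length w ≡ suc n → ∃₂ λ a u → length u ≡ n × a ∷ u ≡ w
  cons-onto n (a ∷ u) l = a , u , suc-injective l , refl

  module Left = Extension _∷_ ∷-injective cons-onto (λ _ _ → refl) (λ _ _ → refl)

  snoc-onto : ∀ n (w : Word) → length w ≡ suc n → ∃₂ λ a u → length u ≡ n × u ∷ʳ a ≡ w
  snoc-onto n       (a ∷ [])    l with refl ← suc-injective l = a , [] , refl , refl
  snoc-onto (suc n) (b ∷ c ∷ w) l with a , u , lu , eq ← snoc-onto n (c ∷ w) (suc-injective l) =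
    a , b ∷ u , cong suc lu , cong (b ∷_) eq

  snoc : Fin 2 → Word → Word
  snoc a u = u ∷ʳ a

  snoc-injective : ∀ {a b u v} → snoc a u ≡ snoc b v → a ≡ b × u ≡ v
  snoc-injective {u = u} {v} eq = swap (∷ʳ-injective u v eq)

  complement-snoc : ∀ a u → complement (snoc a u) ≡ snoc (flip a) (complement u)
  complement-snoc a u = map-++ flip u [ a ]

  length-snoc : ∀ a u → length (snoc a u) ≡ suc (length u)
  length-snoc a u = length-∷ʳ u a

  module Right = Extension snoc snoc-injective snoc-onto length-snoc complement-snoc

  #balanced-suc : ∀ n → #balanced (suc n) ≡ #balanced n + sum (map φ (range (suc n)))
  #balanced-suc n = begin
    #balanced (suc n)                                               ≡⟨ Left.#balanced-ext n ⟨
    length (Left.extendable 0F n) + length (Left.extendable 1F n)   ≡⟨ filter-∪∩ (λ u → balanced? (0F ∷ u)) (λ u → balanced? (1F ∷ u)) balanced? leftSpecial?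
         (λ _ → [ balanced-tail , balanced-tail ]′) (λ u → balanced-left-extendable u) (λ _ p → p) (λ _ p → p) (words n) ⟩
    #balanced n + length (filter leftSpecial? (words n))            ≡⟨ cong (#balanced n +_) (#leftSpecial n) ⟩
    #balanced n + sum (map φ (range (suc n)))                       ∎
    where open ≡-Reasoning

  map-cong-∈ : ∀ {A B : Set} {f g : A → B} xs → (∀ x → x ∈ xs → f x ≡ g x) → map f xs ≡ map g xs
  map-cong-∈ []       eq = refl
  map-cong-∈ (x ∷ xs) eq = cong₂ _∷_ (eq x (here refl)) (map-cong-∈ xs (λ y y∈ → eq y (there y∈)))

  sum-map-+ : ∀ {A : Set} (f g : A → ℕ) xs → sum (map (λ x → f x + g x) xs) ≡ sum (map f xs) + sum (map g xs)
  sum-map-+ f g []       = refl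
  sum-map-+ f g (x ∷ xs) rewrite sum-map-+ f g xs =
    solve 4 (λ a b c d → (a :+ b) :+ (c :+ d) := (a :+ c) :+ (b :+ d)) refl (f x) (g x) (sum (map f xs)) (sum (map g xs))

  range-∷ʳ : ∀ n → range (suc n) ≡ range n ++ [ suc n ]
  range-∷ʳ n = trans (cong (map suc) (sym (upTo-∷ʳ n))) (map-++ suc (upTo n) [ n ])

  -- The first difference of `#balanced` is a partial sum of `φ`, so `φ i` enters at each length
  -- from `i` to `n`, which is `n + 1 - i` times. The leading 1 is the empty word.
  #balanced≡ : ∀ n → #balanced n ≡ suc (sum (map (λ i → (suc n ∸ i) * φ i) (range n)))
  #balanced≡ zero    = refl
  #balanced≡ (suc n) = begin
    #balanced (suc n)                                      ≡⟨ #balanced-suc n ⟩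
    #balanced n + totients                                 ≡⟨ cong (_+ totients) (#balanced≡ n) ⟩
    -- The range may be lengthened because the term `suc n` has weight 0.
    suc (sum (map weight (range n)) + totients)            ≡⟨ cong (λ t → suc (t + totients)) extra ⟨
    suc (sum (map weight (range (suc n))) + totients)      ≡⟨ cong suc (sum-map-+ weight φ (range (suc n))) ⟨
    suc (sum (map (λ i → weight i + φ i) (range (suc n)))) ≡⟨ cong (suc ∘ sum) (map-cong-∈ (range (suc n)) (λ i i∈ → step i (proj₂ (∈-range⁻ i∈)))) ⟩
    suc (sum (map (λ i → (2 + n ∸ i) * φ i) (range (suc n)))) ∎
    where
    open ≡-Reasoning
    totients = sum (map φ (range (suc n)))
    weight : ℕ → ℕ
    weight i = (suc n ∸ i) * φ i
    extra : sum (map weight (range (suc n))) ≡ sum (map weight (range n))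
    extra = begin
      sum (map weight (range (suc n)))                 ≡⟨ cong (sum ∘ map weight) (range-∷ʳ n) ⟩
      sum (map weight (range n ++ [ suc n ]))          ≡⟨ cong sum (map-++ weight (range n) [ suc n ]) ⟩
      sum (map weight (range n) ++ [ weight (suc n) ]) ≡⟨ sum-++ (map weight (range n)) _ ⟩
      sum (map weight (range n)) + (weight (suc n) + 0) ≡⟨ cong (λ t → sum (map weight (range n)) + (t * φ (suc n) + 0)) (n∸n≡0 n) ⟩
      sum (map weight (range n)) + 0                   ≡⟨ +-identityʳ _ ⟩
      sum (map weight (range n))                       ∎
    step : ∀ i → i ≤ suc n → weight i + φ i ≡ (2 + n ∸ i) * φ i
    step i i≤ = trans (+-comm (weight i) (φ i)) (cong (_* φ i) (sym (+-∸-assoc 1 i≤)))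

  sum-const : ∀ {A : Set} c (xs : List A) → sum (map (λ _ → c) xs) ≡ c * length xs
  sum-const c []       = sym (*-zeroʳ c)
  sum-const c (x ∷ xs) = trans (cong (c +_) (sum-const c xs)) (sym (*-suc c (length xs)))

  -- Exchanging the letters pairs a word of height `k` with one of height `n - k`.
  2*sum-height : ∀ n → 2 * sum (map height (balancedWords n)) ≡ n * #balanced n
  2*sum-height n = begin
    2 * H                                                   ≡⟨ cong (H +_) (+-identityʳ H) ⟩
    H + H                                                   ≡⟨ cong (_+ H) (bijection⇒sum height (balancedWords-unique n) into complement-involutive) ⟨
    sum (map (height ∘ complement) bs) + H                  ≡⟨ sum-map-+ (height ∘ complement) height bs ⟨
    sum (map (λ u → height (complement u) + height u) bs)   ≡⟨ cong sum (map-cong-∈ bs (λ u u∈ → trans (height-complement u) (proj₂ (∈-balancedWords⁻ n u∈)))) ⟩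
    sum (map (λ _ → n) bs)                                  ≡⟨ sum-const n bs ⟩
    n * #balanced n                                         ∎
    where
    open ≡-Reasoning
    bs = balancedWords n
    H = sum (map height bs)
    into : ∀ {u} → u ∈ bs → complement u ∈ bs
    into {u} u∈ with bal , l ← ∈-balancedWords⁻ n u∈ =
      ∈-balancedWords⁺ (complement-balanced u bal) (trans (complement-length u) l)

  -- The word of ones is left out because constant gaps would have two codes, one with `q` and ones,
  -- one with `q + 1` and zeros. A letter 0 in `u` makes `q` the least inner gap.
  nonFull : ℕ → List Word
  nonFull n = filter (λ u → height u <? n) (balancedWords n)

  ones : ℕ → Word
  ones n = replicate n 1F

  height≤length : ∀ w → height w ≤ length w
  height≤length w = ≤-trans (m≤n+m _ ∣ w ∣₀) (≤-reflexive (length-split w))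

  height-ones : ∀ n → height (ones n) ≡ n
  height-ones zero    = refl
  height-ones (suc n) = cong suc (height-ones n)

  full⇒ones : ∀ w → length w ≤ height w → w ≡ ones (length w)
  full⇒ones []       _       = refl
  full⇒ones (0F ∷ w) l       = contradiction (≤-trans l (height≤length w)) 1+n≰n
  full⇒ones (1F ∷ w) (s≤s l) = cong (1F ∷_) (full⇒ones w l)

  ones-balanced : ∀ n → Balanced (ones n)
  ones-balanced n = WB⇒balanced λ i j d p q →
    ≤-trans (≤-reflexive (begin
      σ (ones n) (i + d) + σ (ones n) j ≡⟨ cong₂ _+_ (σ-ones n (i + d) (l p)) (σ-ones n j (m+n≤o⇒m≤o j (l q))) ⟩
      i + d + j                         ≡⟨ solve 3 (λ i d j → i :+ d :+ j := j :+ d :+ i) refl i d j ⟩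
      j + d + i                         ≡⟨ cong₂ _+_ (σ-ones n (j + d) (l q)) (σ-ones n i (m+n≤o⇒m≤o i (l p))) ⟨
      σ (ones n) (j + d) + σ (ones n) i ∎)) (n≤1+n _)
    where
    open ≡-Reasoning
    l : ∀ {k} → k ≤ length (ones n) → k ≤ n
    l = subst (_ ≤_) (length-replicate n)
    σ-ones : ∀ n i → i ≤ n → σ (ones n) i ≡ i
    σ-ones n       zero    _       = refl
    σ-ones (suc n) (suc i) (s≤s p) = cong suc (σ-ones n i p)

  ∈-nonFull⁺ : ∀ {n u} → Balanced u → length u ≡ n → height u < n → u ∈ nonFull n
  ∈-nonFull⁺ {n} bal l h = ∈-filter⁺ (λ u → height u <? n) (∈-balancedWords⁺ bal l) h

  ∈-nonFull⁻ : ∀ n {u} → u ∈ nonFull n → Balanced u × length u ≡ n × height u < n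
  ∈-nonFull⁻ n u∈ with u∈′ , h< ← ∈-filter⁻ (λ u → height u <? n) {xs = balancedWords n} u∈ =
    let bal , l = ∈-balancedWords⁻ n u∈′ in bal , l , h<

  nonFull-unique : ∀ n → Unique (nonFull n)
  nonFull-unique n = Unique.filter⁺ (λ u → height u <? n) (balancedWords-unique n)

  nonFull-↭ : ∀ n → balancedWords n ↭ ones n ∷ nonFull n
  nonFull-↭ n = ∼bag⇒↭ (unique∧set⇒bag (balancedWords-unique n) (All.tabulate fresh ∷ nonFull-unique n) (mk⇔ to from))
    where
    fresh : ∀ {u} → u ∈ nonFull n → ones n ≢ u
    fresh u∈ refl = <-irrefl (height-ones n) (proj₂ (proj₂ (∈-nonFull⁻ n u∈)))
    to : ∀ {u} → u ∈ balancedWords n → u ∈ ones n ∷ nonFull n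
    to {u} u∈ with bal , refl ← ∈-balancedWords⁻ n u∈ | height u <? n
    ... | yes h< = there (∈-nonFull⁺ bal refl h<)
    ... | no ¬h< = here (full⇒ones u (≮⇒≥ ¬h<))
    from : ∀ {u} → u ∈ ones n ∷ nonFull n → u ∈ balancedWords n
    from (here refl) = ∈-balancedWords⁺ (ones-balanced n) (length-replicate n)
    from (there u∈) with bal , l , _ ← ∈-nonFull⁻ n u∈ = ∈-balancedWords⁺ bal l

  sum-nonFull : ∀ n (g : Word → ℕ) → sum (map g (balancedWords n)) ≡ g (ones n) + sum (map g (nonFull n))
  sum-nonFull n g = sum-↭ (↭-map⁺ g (nonFull-↭ n))

  indicator : ∀ {P : Set} → Dec P → ℕ
  indicator (yes _) = 1
  indicator (no _)  = 0

  indicator≤1 : ∀ {P : Set} (P? : Dec P) → indicator P? ≤ 1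
  indicator≤1 (yes _) = ≤-refl
  indicator≤1 (no _)  = z≤n

  indicator-yes : ∀ {P : Set} (P? : Dec P) → P → indicator P? ≡ 1
  indicator-yes (yes _) _ = refl
  indicator-yes (no ¬p) p = contradiction p ¬p

  δˡ δʳ : Word → ℕ
  δˡ u = indicator (balanced? (1F ∷ u))
  δʳ u = indicator (balanced? (u ∷ʳ 1F))

  sum-indicator : ∀ {A : Set} {P Q : A → Set} (P? : Decidable P) (Q? : Decidable Q) → (∀ x → Q x → P x) → ∀ xs →
    sum (map (λ x → indicator (Q? x)) (filter P? xs)) ≡ length (filter Q? xs)
  sum-indicator P? Q? Q⇒P []       = refl
  sum-indicator P? Q? Q⇒P (x ∷ xs) with P? x
  ... | no ¬p with Q? x
  ...   | yes q = contradiction (Q⇒P x q) ¬p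
  ...   | no _  = sum-indicator P? Q? Q⇒P xs
  sum-indicator P? Q? Q⇒P (x ∷ xs) | yes p with Q? x
  ...   | yes _ = cong suc (sum-indicator P? Q? Q⇒P xs)
  ...   | no _  = sum-indicator P? Q? Q⇒P xs

  module _ (m : ℕ) where

    private
      T = length (nonFull m)
      S = sum (map height (nonFull m))

    #balanced≡1+nonFull : #balanced m ≡ suc T
    #balanced≡1+nonFull = ↭-length (nonFull-↭ m)

    #nonFull≡ : T ≡ sum (map (λ i → (suc m ∸ i) * φ i) (range m))
    #nonFull≡ = suc-injective (trans (sym #balanced≡1+nonFull) (#balanced≡ m))

    2*sum-height-nonFull : 2 * (m + S) ≡ m * suc T
    2*sum-height-nonFull = begin
      2 * (m + S)                              ≡⟨ cong (λ t → 2 * (t + S)) (height-ones m) ⟨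
      2 * (height (ones m) + S)                ≡⟨ cong (2 *_) (sum-nonFull m height) ⟨
      2 * sum (map height (balancedWords m))   ≡⟨ 2*sum-height m ⟩
      m * #balanced m                          ≡⟨ cong (m *_) #balanced≡1+nonFull ⟩
      m * suc T                                ∎
      where open ≡-Reasoning

    -- `ones m` stays balanced under a further 1 and accounts for the 1 inside `suc`. Over all
    -- balanced words of length `m` the indicators add up to half of `#balanced (suc m)`; the right
    -- end behaves alike.
    2*sum-δˡ : 2 * suc (sum (map δˡ (nonFull m))) ≡ suc T + sum (map φ (range (suc m)))
    2*sum-δˡ = begin
      2 * suc (sum (map δˡ (nonFull m)))             ≡⟨ cong (λ t → 2 * (t + sum (map δˡ (nonFull m)))) (indicator-yes (balanced? (1F ∷ ones m)) (ones-balanced (suc m))) ⟨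
      2 * (δˡ (ones m) + sum (map δˡ (nonFull m)))   ≡⟨ cong (2 *_) (sum-nonFull m δˡ) ⟨
      2 * sum (map δˡ (balancedWords m))             ≡⟨ cong (2 *_) (sum-indicator balanced? (λ u → balanced? (1F ∷ u)) (λ _ → balanced-tail) (words m)) ⟩
      2 * length (Left.extendable 1F m)              ≡⟨ Left.2*#extendable m ⟩
      #balanced (suc m)                              ≡⟨ #balanced-suc m ⟩
      #balanced m + sum (map φ (range (suc m)))      ≡⟨ cong (_+ sum (map φ (range (suc m)))) #balanced≡1+nonFull ⟩
      suc T + sum (map φ (range (suc m)))            ∎
      where open ≡-Reasoning

    2*sum-δʳ : 2 * suc (sum (map δʳ (nonFull m))) ≡ suc T + sum (map φ (range (suc m)))
    2*sum-δʳ = begin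
      2 * suc (sum (map δʳ (nonFull m)))             ≡⟨ cong (λ t → 2 * (t + sum (map δʳ (nonFull m)))) (indicator-yes (balanced? (ones m ∷ʳ 1F)) (subst Balanced (ones-∷ʳ m) (ones-balanced (suc m)))) ⟨
      2 * (δʳ (ones m) + sum (map δʳ (nonFull m)))   ≡⟨ cong (2 *_) (sum-nonFull m δʳ) ⟨
      2 * sum (map δʳ (balancedWords m))             ≡⟨ cong (2 *_) (sum-indicator balanced? (λ u → balanced? (u ∷ʳ 1F)) (λ _ → balanced-init) (words m)) ⟩
      2 * length (Right.extendable 1F m)             ≡⟨ Right.2*#extendable m ⟩
      #balanced (suc m)                              ≡⟨ #balanced-suc m ⟩
      #balanced m + sum (map φ (range (suc m)))      ≡⟨ cong (_+ sum (map φ (range (suc m)))) #balanced≡1+nonFull ⟩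
      suc T + sum (map φ (range (suc m)))            ∎
      where
      open ≡-Reasoning
      ones-∷ʳ : ∀ n → ones (suc n) ≡ ones n ∷ʳ 1F
      ones-∷ʳ zero    = refl
      ones-∷ʳ (suc n) = cong (1F ∷_) (ones-∷ʳ n)

  -- Gaps between consecutive letters 1

  -- The position (from 1) of the k-th letter 1, with pos w 0 = 0 and |w| + 1 when
  -- there is no such letter: this is the Galois dual of σ w.
  pos : Word → ℕ → ℕ
  pos w        zero    = 0
  pos []       (suc k) = 1
  pos (0F ∷ w) (suc k) = suc (pos w (suc k))
  pos (1F ∷ w) (suc k) = suc (pos w k)

  pos-σ : ∀ w {k i} → i ≤ length w → k ≤ σ w i → pos w k ≤ i
  pos-σ w        {zero}          _       _       = z≤n
  pos-σ (0F ∷ w) {suc k} {suc i} (s≤s l) p       = s≤s (pos-σ w l p)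
  pos-σ (1F ∷ w) {suc k} {suc i} (s≤s l) (s≤s p) = s≤s (pos-σ w l p)

  σ-pos : ∀ w {k i} → i ≤ length w → pos w k ≤ i → k ≤ σ w i
  σ-pos w        {zero}          _       _       = z≤n
  σ-pos []       {suc k}         z≤n     ()
  σ-pos (0F ∷ w) {suc k} {suc i} (s≤s l) (s≤s p) = σ-pos w l p
  σ-pos (1F ∷ w) {suc k} {suc i} (s≤s l) (s≤s p) = s≤s (σ-pos w l p)

  pos-mono : ∀ w k → pos w k ≤ pos w (suc k)
  pos-mono w        zero    = z≤n
  pos-mono []       (suc k) = ≤-refl
  pos-mono (0F ∷ w) (suc k) = s≤s (pos-mono w (suc k))
  pos-mono (1F ∷ w) (suc k) = s≤s (pos-mono w k)

  pos-bound : ∀ w k → pos w k ≤ suc (length w)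
  pos-bound w        zero    = z≤n
  pos-bound []       (suc k) = ≤-refl
  pos-bound (0F ∷ w) (suc k) = s≤s (pos-bound w (suc k))
  pos-bound (1F ∷ w) (suc k) = s≤s (pos-bound w k)

  pos-positive : ∀ w k → 1 ≤ pos w (suc k)
  pos-positive []       k = s≤s z≤n
  pos-positive (0F ∷ w) k = s≤s z≤n
  pos-positive (1F ∷ w) k = s≤s z≤n

  mono-+ : (f : ℕ → ℕ) → (∀ i → f i ≤ f (suc i)) → ∀ i d → f i ≤ f (i + d)
  mono-+ f mono i zero    rewrite +-identityʳ i = ≤-refl
  mono-+ f mono i (suc d) rewrite +-suc i d     = ≤-trans (mono-+ f mono i d) (mono (i + d))

  σ≤height : ∀ w i → i ≤ length w → σ w i ≤ height w
  σ≤height w i i≤ with d , e ← m≤n⇒∃[o]m+o≡n i≤ =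
    ≤-trans (mono-+ (σ w) (σ-lower w) i d) (≤-reflexive (trans (cong (σ w) e) (σ-length w)))

  -- A span of `k` consecutive gaps exceeds one between actual letters 1 by at most 1. The longer
  -- span may use the virtual positions 0 and `|w| + 1`: an outer gap is cut off by the end of the
  -- word, so it is bounded from above only.
  record PosBalanced (h : ℕ) (x : ℕ → ℕ) : Set where
    constructor posBalanced
    field
      differences : ∀ a b k → suc a + k ≤ h → b + k ≤ suc h →
                    x (b + k) + x (suc a) ≤ suc (x (suc a + k) + x b)

  open PosBalanced

  -- Suppose the window at `j` holds `c` ones and the window at `i` at least `c + 2`. Inside the
  -- latter, `c + 1` gaps measure at most `d - 1`; around the former, `c + 1` gaps measure at least
  -- `d + 1`. This violates `differences`.
  posBalanced⇒balanced : ∀ w → PosBalanced (height w) (pos w) → Balanced w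
  posBalanced⇒balanced w pb = WB⇒balanced wb
    where
    y = σ w
    wb : WindowBalanced (length w) y
    wb i j d p q with c , e ← m≤n⇒∃[o]m+o≡n (mono-+ y (σ-lower w) j d) = ≮⇒≥ λ fail →
      let
        A+k≤ : suc (y i) + suc c ≤ y (i + d)
        A+k≤ = linear (fail ⊕ ≤-reflexive e)
          (solve 5 (λ yi c yid yj yjd → (con 1 :+ yi :+ (con 1 :+ c)) :+ ((yid :+ yj) :+ yjd) := yid :+ ((con 2 :+ (yjd :+ yi)) :+ (yj :+ c)))
            refl (y i) c (y (i + d)) (y j) (y (j + d)))
        b+k≡ : y j + suc c ≡ suc (y (j + d))
        b+k≡ = trans (+-suc (y j) c) (cong suc e)
        i<x : i < pos w (suc (y i))
        i<x = ≰⇒> λ x≤ → 1+n≰n (σ-pos w (m+n≤o⇒m≤o i p) x≤)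
        j+d<x : j + d < pos w (y j + suc c)
        j+d<x = ≰⇒> λ x≤ → 1+n≰n (≤-trans (≤-reflexive (sym b+k≡)) (σ-pos w q x≤))
      in 1+n≰n {n = 0} (linear
           (differences pb (y i) (y j) (suc c) (≤-trans A+k≤ (σ≤height w (i + d) p)) (≤-trans (≤-reflexive b+k≡) (s≤s (σ≤height w (j + d) q)))
            ⊕ i<x ⊕ j+d<x ⊕ pos-σ w p A+k≤ ⊕ pos-σ w (m+n≤o⇒m≤o j q) (≤-refl {y j}))
           (solve 7 (λ i j d A B C D →
               con 1 :+ ((con 1 :+ (C :+ D)) :+ B :+ A :+ (i :+ d) :+ j)
               := con 0 :+ ((A :+ B) :+ (con 1 :+ i) :+ (con 1 :+ (j :+ d)) :+ C :+ D))
             refl i j d (pos w (y j + suc c)) (pos w (suc (y i))) (pos w (suc (y i) + suc c)) (pos w (y j))))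

  -- The window from the letter 1 numbered `a + 1` to the one numbered `a + 1 + k` holds `k + 1`
  -- ones. Were the span from `b` longer by 2 or more, a window of the same length right after
  -- position `x b` would end before `x (b + k)` and hold at most `k - 1`.
  balanced⇒posBalanced : ∀ w → Balanced w → PosBalanced (height w) (pos w)
  balanced⇒posBalanced w bal = posBalanced diff
    where
    x = pos w
    y = σ w
    diff : ∀ a b k → suc a + k ≤ height w → b + k ≤ suc (height w) → x (b + k) + x (suc a) ≤ suc (x (suc a + k) + x b)
    diff a b k p q
      with i , ei ← m≤n⇒∃[o]m+o≡n (pos-positive w a) | e , ee ← m≤n⇒∃[o]m+o≡n (mono-+ x (pos-mono w) (suc a) k) = ≮⇒≥ λ fail →
      let
        i+d≡ : i + suc e ≡ x (suc a + k)
        i+d≡ = trans (+-suc i e) (trans (cong (_+ e) ei) ee)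
        x≤L : x (suc a + k) ≤ length w
        x≤L = pos-σ w ≤-refl (≤-trans p (≤-reflexive (sym (σ-length w))))
        j+d<x : x b + suc e < x (b + k)
        j+d<x = linear (fail ⊕ ≤-reflexive ee)
          (solve 5 (λ A B C D e → (con 1 :+ (A :+ (con 1 :+ e))) :+ (B :+ C :+ D) := B :+ (con 2 :+ (D :+ A) :+ (C :+ e)))
            refl (x b) (x (b + k)) (x (suc a)) (x (suc a + k)) e)
        i+d≤ : i + suc e ≤ length w
        i+d≤ = ≤-trans (≤-reflexive i+d≡) x≤L
        j+d≤ : x b + suc e ≤ length w
        j+d≤ = s≤s⁻¹ (≤-trans j+d<x (pos-bound w (b + k)))
        y<b+k : y (x b + suc e) < b + k
        y<b+k = ≰⇒> λ le → <⇒≱ j+d<x (pos-σ w j+d≤ le)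
        y<a : y i < suc a
        y<a = ≰⇒> λ le → <⇒≱ (≤-reflexive ei) (pos-σ w (m+n≤o⇒m≤o i i+d≤) le)
      in 1+n≰n {n = 0} (linear
           (balanced⇒WB bal i (x b) (suc e) i+d≤ j+d≤ ⊕ y<b+k ⊕ y<a
            ⊕ σ-pos w i+d≤ (≤-reflexive (sym i+d≡)) ⊕ σ-pos w (m+n≤o⇒m≤o (x b) j+d≤) ≤-refl)
           (solve 7 (λ a b k A B C D →
               con 1 :+ ((con 1 :+ (C :+ D)) :+ (b :+ k) :+ (con 1 :+ a) :+ A :+ B)
               := con 0 :+ ((A :+ B) :+ (con 1 :+ C) :+ (con 1 :+ D) :+ (con 1 :+ a :+ k) :+ b))
             refl a b k (y (i + suc e)) (y (x b)) (y (x b + suc e)) (y i)))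

  -- 0ᵃ 1 0^g₁ 1 ⋯ 0^gₙ 1 0ᵇ
  gapWord : ℕ → List ℕ → ℕ → Word
  gapWord (suc a) gs       b = 0F ∷ gapWord a gs b
  gapWord zero    []       b = 1F ∷ replicate b 0F
  gapWord zero    (g ∷ gs) b = 1F ∷ gapWord g gs b

  height-zeros : ∀ b → height (replicate b 0F) ≡ 0
  height-zeros zero    = refl
  height-zeros (suc b) = height-zeros b

  height-gapWord : ∀ a gs b → height (gapWord a gs b) ≡ suc (length gs)
  height-gapWord (suc a) gs       b = height-gapWord a gs b
  height-gapWord zero    []       b = cong suc (height-zeros b)
  height-gapWord zero    (g ∷ gs) b = cong suc (height-gapWord g gs b)

  gapWord-injective : ∀ {a gs b a′ gs′ b′} → gapWord a gs b ≡ gapWord a′ gs′ b′ →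
                      a ≡ a′ × gs ≡ gs′ × b ≡ b′
  gapWord-injective {suc a} {gs}     {b} {suc a′} {gs′}      {b′} eq
    with refl , refl , refl ← gapWord-injective {a} {gs} {b} {a′} {gs′} {b′} (∷-injectiveʳ eq) = refl , refl , refl
  gapWord-injective {zero}  {[]}     {b} {zero}   {[]}       {b′} eq =
    refl , refl , trans (sym (length-replicate b)) (trans (cong length (∷-injectiveʳ eq)) (length-replicate b′))
  gapWord-injective {zero}  {[]}     {b} {zero}   {g′ ∷ gs′} {b′} eq =
    contradiction (trans (sym (height-zeros b)) (trans (cong height (∷-injectiveʳ eq)) (height-gapWord g′ gs′ b′))) λ ()
  gapWord-injective {zero}  {g ∷ gs} {b} {zero}   {[]}       {b′} eq =
    contradiction (trans (sym (height-zeros b′)) (trans (cong height (sym (∷-injectiveʳ eq))) (height-gapWord g gs b))) λ ()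
  gapWord-injective {zero}  {g ∷ gs} {b} {zero}   {g′ ∷ gs′} {b′} eq
    with refl , refl , refl ← gapWord-injective {g} {gs} {b} {g′} {gs′} {b′} (∷-injectiveʳ eq) = refl , refl , refl
  gapWord-injective {zero}  {[]}     {b} {suc a′} {gs′}      {b′} ()
  gapWord-injective {zero}  {g ∷ gs} {b} {suc a′} {gs′}      {b′} ()
  gapWord-injective {suc a} {gs}     {b} {zero}   {[]}       {b′} ()
  gapWord-injective {suc a} {gs}     {b} {zero}   {g′ ∷ gs′} {b′} ()

  gapWord-onto : ∀ w m → height w ≡ suc m → ∃₂ λ a gs → ∃ λ b → length gs ≡ m × gapWord a gs b ≡ w
  gapWord-onto (0F ∷ w) m h with a , gs , b , l , refl ← gapWord-onto w m h = suc a , gs , b , l , refl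
  gapWord-onto (1F ∷ w) zero    h = 0 , [] , length w , refl , cong (1F ∷_) (zeros w (suc-injective h))
    where
    zeros : ∀ w → height w ≡ 0 → replicate (length w) 0F ≡ w
    zeros []       _ = refl
    zeros (0F ∷ w) h = cong (0F ∷_) (zeros w h)
    zeros (1F ∷ w) ()
  gapWord-onto (1F ∷ w) (suc m) h with a , gs , b , l , refl ← gapWord-onto w m (suc-injective h) =
    0 , a ∷ gs , b , cong suc l , refl

  pos-gapWord-1 : ∀ a gs b → pos (gapWord a gs b) 1 ≡ suc a
  pos-gapWord-1 (suc a) gs       b = cong suc (pos-gapWord-1 a gs b)
  pos-gapWord-1 zero    []       b = refl
  pos-gapWord-1 zero    (g ∷ gs) b = refl

  pos-gapWord-∷ : ∀ a g gs b k → pos (gapWord a (g ∷ gs) b) (suc k) ≡ suc a + pos (gapWord g gs b) k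
  pos-gapWord-∷ (suc a) g gs b k = cong suc (pos-gapWord-∷ a g gs b k)
  pos-gapWord-∷ zero    g gs b k = refl

  pos-gapWord-[] : ∀ a b → pos (gapWord a [] b) 2 ≡ suc a + suc b
  pos-gapWord-[] (suc a) b       = cong suc (pos-gapWord-[] a b)
  pos-gapWord-[] zero    b       = cong suc (zeros b)
    where
    zeros : ∀ b → pos (replicate b 0F) 1 ≡ suc b
    zeros zero    = refl
    zeros (suc b) = cong suc (zeros b)

  pos-last : ∀ w → pos w (suc (height w)) ≡ suc (length w)
  pos-last []       = refl
  pos-last (0F ∷ w) = cong suc (pos-last w)
  pos-last (1F ∷ w) = cong suc (pos-last w)

  pos-gap : ∀ {g} a gs b → g ∈ gs → ∃ λ i → suc i ≤ length gs ×
            pos (gapWord a gs b) (2 + i) ≡ pos (gapWord a gs b) (1 + i) + suc g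
  pos-gap a (g ∷ gs) b (here refl) = 0 , s≤s z≤n , (begin
    pos (gapWord a (g ∷ gs) b) 2         ≡⟨ pos-gapWord-∷ a g gs b 1 ⟩
    suc a + pos (gapWord g gs b) 1       ≡⟨ cong (suc a +_) (pos-gapWord-1 g gs b) ⟩
    suc a + suc g                        ≡⟨ cong (_+ suc g) (pos-gapWord-1 a (g ∷ gs) b) ⟨
    pos (gapWord a (g ∷ gs) b) 1 + suc g ∎)
    where open ≡-Reasoning
  pos-gap {g′} a (g ∷ gs) b (there g∈) with i , i< , e ← pos-gap g gs b g∈ = suc i , s≤s i< , (begin
    pos (gapWord a (g ∷ gs) b) (3 + i)                ≡⟨ pos-gapWord-∷ a g gs b (2 + i) ⟩
    suc a + pos (gapWord g gs b) (2 + i)              ≡⟨ cong (suc a +_) e ⟩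
    suc a + (pos (gapWord g gs b) (1 + i) + suc g′)   ≡⟨ +-assoc (suc a) _ _ ⟨
    suc a + pos (gapWord g gs b) (1 + i) + suc g′     ≡⟨ cong (_+ suc g′) (pos-gapWord-∷ a g gs b (1 + i)) ⟨
    pos (gapWord a (g ∷ gs) b) (2 + i) + suc g′       ∎)
    where open ≡-Reasoning

  balanced-gaps : ∀ a gs b → Balanced (gapWord a gs b) → ∀ {g g′} → g ∈ gs → g′ ∈ gs → g ≤ suc g′
  balanced-gaps a gs b bal {g} {g′} g∈ g′∈
    with i , i< , e ← pos-gap a gs b g∈ | i′ , i′< , e′ ← pos-gap a gs b g′∈ =
    linear (diff i′ (suc i) 1 (s≤s (≤-trans (≤-reflexive (+-comm i′ 1)) i′<)) (s≤s (≤-trans (≤-reflexive (+-comm i 1)) (m≤n⇒m≤1+n i<)))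
            ⊕ ≤-reflexive (cong (x ∘ suc) (+-comm 1 i)) ⊕ ≤-reflexive (cong (x ∘ suc) (+-comm i′ 1))
            ⊕ ≤-reflexive (sym e) ⊕ ≤-reflexive e′)
      (solve 8 (λ g g′ A A′ A″ B B′ B″ →
          g :+ ((con 1 :+ (B′ :+ A)) :+ A′ :+ B″ :+ A″ :+ (B :+ (con 1 :+ g′)))
          := (con 1 :+ g′) :+ ((A′ :+ B) :+ A″ :+ B′ :+ (A :+ (con 1 :+ g)) :+ B″))
        refl g g′ (x (suc i)) (x (suc i + 1)) (x (2 + i)) (x (suc i′)) (x (suc i′ + 1)) (x (2 + i′)))
    where
    w = gapWord a gs b
    x = pos w
    diff : ∀ a b k → suc a + k ≤ suc (length gs) → b + k ≤ suc (suc (length gs)) → x (b + k) + x (suc a) ≤ suc (x (suc a + k) + x b)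
    diff = differences (subst (λ h → PosBalanced h x) (height-gapWord a gs b) (balanced⇒posBalanced w bal))

  gaps : ℕ → Word → List ℕ
  gaps q = map (λ c → q + toℕ c)

  -- Here `q` counts zeros only; with one adjacent letter 1 a short gap is `suc q`, which is the
  -- index of its layer.
  code : ℕ → ℕ → Word → ℕ → Word
  code a q u b = gapWord a (gaps q u) b

  height-code : ∀ a q u b → height (code a q u b) ≡ suc (length u)
  height-code a q u b = trans (height-gapWord a (gaps q u) b) (cong suc (length-map _ u))

  -- The letters 1 follow a line of slope `q + 1`, shifted by the prefix heights of `u`. The line
  -- cancels between spans of equally many inner gaps, so there balance of the code becomes balance
  -- of `u`.
  pos-code : ∀ a q u b i → i ≤ length u → pos (code a q u b) (suc i) ≡ suc a + (i * suc q + σ u i)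
  pos-code a q u       b zero    _       = trans (pos-gapWord-1 a (gaps q u) b) (sym (+-identityʳ (suc a)))
  pos-code a q (c ∷ u) b (suc i) (s≤s p) = begin
    pos (code a q (c ∷ u) b) (2 + i)                             ≡⟨ pos-gapWord-∷ a (q + toℕ c) (gaps q u) b (suc i) ⟩
    suc a + pos (code (q + toℕ c) q u b) (suc i)                 ≡⟨ cong (suc a +_) (pos-code (q + toℕ c) q u b i p) ⟩
    suc a + (suc (q + toℕ c) + (i * suc q + σ u i))              ≡⟨ cong (suc a +_) (solve 4 (λ q c x y → con 1 :+ (q :+ c) :+ (x :+ y) := con 1 :+ q :+ x :+ (c :+ y)) refl q (toℕ c) (i * suc q) (σ u i)) ⟩
    suc a + (suc i * suc q + σ (c ∷ u) (suc i))                  ∎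
    where open ≡-Reasoning

  pos-code-last : ∀ a q u b → pos (code a q u b) (2 + length u) ≡ suc a + (length u * suc q + σ u (length u)) + suc b
  pos-code-last a q []      b = trans (pos-gapWord-[] a b) (cong (_+ suc b) (sym (+-identityʳ (suc a))))
  pos-code-last a q (c ∷ u) b = begin
    pos (code a q (c ∷ u) b) (3 + m)                                ≡⟨ pos-gapWord-∷ a (q + toℕ c) (gaps q u) b (2 + m) ⟩
    suc a + pos (code (q + toℕ c) q u b) (2 + m)                    ≡⟨ cong (suc a +_) (pos-code-last (q + toℕ c) q u b) ⟩
    suc a + (suc (q + toℕ c) + (m * suc q + σ u m) + suc b)         ≡⟨ solve 6 (λ a q c x y b → con 1 :+ a :+ (con 1 :+ (q :+ c) :+ (x :+ y) :+ b) := con 1 :+ a :+ (con 1 :+ q :+ x :+ (c :+ y)) :+ b) refl a q (toℕ c) (m * suc q) (σ u m) (suc b) ⟩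
    suc a + (suc m * suc q + (toℕ c + σ u m)) + suc b               ∎
    where
    open ≡-Reasoning
    m = length u

  length-code : ∀ a q u b → length (code a q u b) ≡ suc (a + b) + (length u * suc q + height u)
  length-code a q u b = suc-injective (begin
    suc (length w)                                              ≡⟨ pos-last w ⟨
    pos w (suc (height w))                                      ≡⟨ cong (pos w ∘ suc) (height-code a q u b) ⟩
    pos w (2 + length u)                                        ≡⟨ pos-code-last a q u b ⟩
    suc a + (length u * suc q + σ u (length u)) + suc b         ≡⟨ cong (λ t → suc a + (length u * suc q + t) + suc b) (σ-length u) ⟩
    suc a + (length u * suc q + height u) + suc b               ≡⟨ solve 3 (λ a b x → con 1 :+ a :+ x :+ (con 1 :+ b) := con 2 :+ (a :+ b) :+ x) refl a b (length u * suc q + height u) ⟩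
    2 + (a + b) + (length u * suc q + height u)                 ∎)
    where
    open ≡-Reasoning
    w = code a q u b

  nonFull⇒0∈ : ∀ u → height u < length u → 0F ∈ u
  nonFull⇒0∈ (0F ∷ u) _       = here refl
  nonFull⇒0∈ (1F ∷ u) (s≤s p) = there (nonFull⇒0∈ u p)

  0∈⇒nonFull : ∀ {u} → 0F ∈ u → height u < length u
  0∈⇒nonFull {0F ∷ u} _          = s≤s (height≤length u)
  0∈⇒nonFull {1F ∷ u} (there 0∈) = s≤s (0∈⇒nonFull 0∈)

  0∈⇒flat : ∀ {u} → 0F ∈ u → ∃ λ i → suc i ≤ length u × σ u (suc i) ≡ σ u i
  0∈⇒flat (here refl)       = 0 , s≤s z≤n , refl
  0∈⇒flat {c ∷ u} (there 0∈) with i , i< , e ← 0∈⇒flat 0∈ = suc i , s≤s i< , cong (toℕ c +_) e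

  gaps-least : ∀ {q u q′ u′} → height u < length u → gaps q u ≡ gaps q′ u′ → q′ ≤ q
  gaps-least {q} {u} {q′} {u′} nf eq
    with c , _ , e ← ∈-map⁻ (λ c → q′ + toℕ c) (subst (q + 0 ∈_) eq (∈-map⁺ (λ c → q + toℕ c) (nonFull⇒0∈ u nf))) =
    ≤-trans (m≤m+n q′ (toℕ c)) (≤-reflexive (trans (sym e) (+-identityʳ q)))

  code-injective : ∀ {a q u b a′ q′ u′ b′} → height u < length u → height u′ < length u′ →
    code a q u b ≡ code a′ q′ u′ b′ → a ≡ a′ × q ≡ q′ × u ≡ u′ × b ≡ b′
  code-injective {a} {q} {u} {b} {a′} {q′} {u′} {b′} nf nf′ eq
    with refl , gs≡ , refl ← gapWord-injective {a} {gaps q u} {b} {a′} {gaps q′ u′} {b′} eq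
    with refl ← ≤-antisym (gaps-least {u = u′} {u′ = u} nf′ (sym gs≡)) (gaps-least {u = u} {u′ = u′} nf gs≡) =
    refl , refl , map-injective (λ e → toℕ-injective (+-cancelˡ-≡ q _ _ e)) gs≡ , refl

  least-element : ∀ g gs → ∃ λ q → q ∈ g ∷ gs × ∀ {x} → x ∈ g ∷ gs → q ≤ x
  least-element g []        = g , here refl , λ { (here refl) → ≤-refl }
  least-element g (g′ ∷ gs) with q , q∈ , q≤ ← least-element g′ gs | ≤-total g q
  ... | inj₁ g≤q = g , here refl , λ { (here refl) → ≤-refl ; (there x∈) → ≤-trans g≤q (q≤ x∈) }
  ... | inj₂ q≤g = q , there q∈ , λ { (here refl) → q≤g ; (there x∈) → q≤ x∈ }

  -- A height of at least 2 provides an inner gap, hence a least one `q`. By `balanced-gaps` every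
  -- inner gap is `q` or `q + 1`, and the least one becomes a letter 0.
  code-onto : ∀ w {m} → height w ≡ suc (suc m) → Balanced w →
    ∃₂ λ a q → ∃₂ λ u b → length u ≡ suc m × height u < suc m × code a q u b ≡ w
  code-onto w {m} h bal
    with a , gs@(g ∷ gs′) , b , l , refl ← gapWord-onto w (suc m) h
    with q , q∈ , q≤ ← least-element g gs′ =
    a , q , u , b , lu , subst (height u <_) lu (0∈⇒nonFull 0∈u) , cong (λ t → gapWord a t b) (rebuild gs (λ x∈ → x∈))
    where
    u = map (λ x → letter (x ∸ q)) gs
    lu : length u ≡ suc m
    lu = trans (length-map _ gs) l
    0∈u : 0F ∈ u
    0∈u = subst (_∈ u) (cong letter (n∸n≡0 q)) (∈-map⁺ (λ x → letter (x ∸ q)) q∈)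
    rebuild : ∀ xs → (∀ {x} → x ∈ xs → x ∈ gs) → gaps q (map (λ x → letter (x ∸ q)) xs) ≡ xs
    rebuild []       _   = refl
    rebuild (x ∷ xs) inc = cong₂ _∷_
      (trans (+-comm q _) (letter-step (q≤ (inc (here refl))) (balanced-gaps a gs b bal (inc (here refl)) q∈)))
      (rebuild xs (inc ∘ there))

  -- The outer gaps are bounded independently of each other, and only from above:
  -- by q + 1 when u can be extended by a 1 on that side, and by q otherwise.
  module _ (a q : ℕ) (u : Word) (b : ℕ) (nf : height u < length u) where

    private
      m = length u
      z = σ u
      Q = suc q
      x = pos (code a q u b)

      -- These compare inner spans with spans that contain an outer gap. At `a = Q` the first is
      -- `LeftExt`, at `b = Q` the second is `RightExt`; smaller outer gaps give weaker conditions.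
      LeftBound RightBound : Set
      LeftBound = ∀ a′ k → a′ + suc k ≤ m → a + z k + z a′ ≤ Q + z (a′ + suc k)
      RightBound = ∀ a′ b′ k → a′ + suc k ≤ m → b′ + k ≡ m → b + z m + z a′ ≤ Q + z (a′ + suc k) + z b′

      xe : ∀ {i} → i ≤ m → x (suc i) ≡ suc a + (i * Q + z i)
      xe = pos-code a q u b _

      xl : x (2 + m) ≡ suc a + (m * Q + z m) + suc b
      xl = pos-code-last a q u b

      posBalanced⇒WB : PosBalanced (suc m) x → WindowBalanced m z
      posBalanced⇒WB pb i j d p r =
        linear (differences pb j (suc i) d (s≤s r) (s≤s (m≤n⇒m≤1+n p)) ⊕ ≤-reflexive (sym (xe p))
                ⊕ ≤-reflexive (sym (xe (m+n≤o⇒m≤o j r))) ⊕ ≤-reflexive (xe r) ⊕ ≤-reflexive (xe (m+n≤o⇒m≤o i p)))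
          (solve 13 (λ a Q i j d A B C D A′ B′ C′ D′ →
              (A :+ B) :+ ((con 1 :+ (C′ :+ D′)) :+ A′ :+ B′ :+ (con 1 :+ a :+ ((j :+ d) :* Q :+ C)) :+ (con 1 :+ a :+ (i :* Q :+ D)))
              := con 1 :+ (C :+ D) :+ ((A′ :+ B′) :+ (con 1 :+ a :+ ((i :+ d) :* Q :+ A)) :+ (con 1 :+ a :+ (j :* Q :+ B)) :+ C′ :+ D′))
            refl a Q i j d (z (i + d)) (z j) (z (j + d)) (z i) (x (suc i + d)) (x (suc j)) (x (suc j + d)) (x (suc i)))

      posBalanced⇒LeftBound : PosBalanced (suc m) x → LeftBound
      posBalanced⇒LeftBound pb a′ k p =
        linear (differences pb a′ 0 (suc k) (s≤s p) (s≤s (m≤n⇒m≤1+n k≤m)) ⊕ ≤-reflexive (sym (xe k≤m))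
                ⊕ ≤-reflexive (sym (xe (m+n≤o⇒m≤o a′ p))) ⊕ ≤-reflexive (xe p))
          (solve 10 (λ a Q i k A B C A′ B′ C′ →
              (a :+ A :+ B) :+ ((con 1 :+ (C′ :+ con 0)) :+ A′ :+ B′ :+ (con 1 :+ a :+ ((i :+ (con 1 :+ k)) :* Q :+ C)))
              := (Q :+ C) :+ ((A′ :+ B′) :+ (con 1 :+ a :+ (k :* Q :+ A)) :+ (con 1 :+ a :+ (i :* Q :+ B)) :+ C′))
            refl a Q a′ k (z k) (z a′) (z (a′ + suc k)) (x (suc k)) (x (suc a′)) (x (suc a′ + suc k)))
        where
        k≤m : k ≤ m
        k≤m = ≤-trans (n≤1+n k) (m+n≤o⇒n≤o a′ p)

      last-index : ∀ {b′ k} → b′ + k ≡ m → x (suc b′ + suc k) ≡ suc a + ((b′ + k) * Q + z m) + suc b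
      last-index {b′} {k} e rewrite e = trans (cong (x ∘ suc) (trans (+-suc b′ k) (cong suc e))) xl

      posBalanced⇒RightBound : PosBalanced (suc m) x → RightBound
      posBalanced⇒RightBound pb a′ b′ k p e =
        linear (differences pb a′ (suc b′) (suc k) (s≤s p) (s≤s (≤-trans (≤-reflexive (+-suc b′ k)) (s≤s (≤-reflexive e))))
                ⊕ ≤-reflexive (sym (last-index e)) ⊕ ≤-reflexive (sym (xe (m+n≤o⇒m≤o a′ p))) ⊕ ≤-reflexive (xe p)
                ⊕ ≤-reflexive (xe (m+n≤o⇒m≤o b′ (≤-reflexive e))))
          (solve 14 (λ a b Q i j k A B C D A′ B′ C′ D′ →
              (b :+ A :+ B) :+ ((con 1 :+ (C′ :+ D′)) :+ A′ :+ B′ :+ (con 1 :+ a :+ ((i :+ (con 1 :+ k)) :* Q :+ C)) :+ (con 1 :+ a :+ (j :* Q :+ D)))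
              := (Q :+ C :+ D) :+ ((A′ :+ B′) :+ (con 1 :+ a :+ ((j :+ k) :* Q :+ A) :+ (con 1 :+ b)) :+ (con 1 :+ a :+ (i :* Q :+ B)) :+ C′ :+ D′))
            refl a b Q a′ b′ k (z m) (z a′) (z (a′ + suc k)) (z b′) (x (suc b′ + suc k)) (x (suc a′)) (x (suc a′ + suc k)) (x (suc b′)))

      bounds⇒posBalanced : WindowBalanced m z → LeftBound → RightBound → PosBalanced (suc m) x
      bounds⇒posBalanced wb lb rb = posBalanced diff
        where
        trivial : ∀ a b → x (b + 0) + x a ≤ suc (x (a + 0) + x b)
        trivial a b rewrite +-identityʳ a | +-identityʳ b | +-comm (x b) (x a) = n≤1+n _
        -- There are `m` inner gaps, so a span compared with inner ones has at most `m` of the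
        -- `m + 2` gaps and contains at most one outer gap: the left one if it starts at 0, the
        -- right one if it ends at `m + 2`. Hence the two bounds are independent.
        diff : ∀ a′ b′ k → suc a′ + k ≤ suc m → b′ + k ≤ suc (suc m) → x (b′ + k) + x (suc a′) ≤ suc (x (suc a′ + k) + x b′)
        diff a′ b′       zero    _       _ = trivial (suc a′) b′
        diff a′ zero     (suc k) (s≤s p) _ =
          linear (lb a′ k p ⊕ ≤-reflexive (xe (≤-trans (n≤1+n k) (m+n≤o⇒n≤o a′ p)))
                  ⊕ ≤-reflexive (xe (m+n≤o⇒m≤o a′ p)) ⊕ ≤-reflexive (sym (xe p)))
            (solve 10 (λ a Q i k A B C A′ B′ C′ →
                (A′ :+ B′) :+ ((Q :+ C) :+ (con 1 :+ a :+ (k :* Q :+ A)) :+ (con 1 :+ a :+ (i :* Q :+ B)) :+ C′)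
                := (con 1 :+ (C′ :+ con 0)) :+ ((a :+ A :+ B) :+ A′ :+ B′ :+ (con 1 :+ a :+ ((i :+ (con 1 :+ k)) :* Q :+ C))))
              refl a Q a′ k (z k) (z a′) (z (a′ + suc k)) (x (suc k)) (x (suc a′)) (x (suc a′ + suc k)))
        diff a′ (suc b′) (suc k) (s≤s p) (s≤s r) with m≤n⇒m<n∨m≡n r
        ... | inj₁ (s≤s r′) =
          linear (wb b′ a′ (suc k) r′ p ⊕ ≤-reflexive (xe r′)
                ⊕ ≤-reflexive (xe (m+n≤o⇒m≤o a′ p)) ⊕ ≤-reflexive (sym (xe p)) ⊕ ≤-reflexive (sym (xe (m+n≤o⇒m≤o b′ r′))))
          (solve 13 (λ a Q i j d A B C D A′ B′ C′ D′ →
              (A′ :+ B′) :+ ((con 1 :+ (C :+ D)) :+ (con 1 :+ a :+ ((i :+ d) :* Q :+ A)) :+ (con 1 :+ a :+ (j :* Q :+ B)) :+ C′ :+ D′)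
              := con 1 :+ (C′ :+ D′) :+ ((A :+ B) :+ A′ :+ B′ :+ (con 1 :+ a :+ ((j :+ d) :* Q :+ C)) :+ (con 1 :+ a :+ (i :* Q :+ D))))
            refl a Q b′ a′ (suc k) (z (b′ + suc k)) (z a′) (z (a′ + suc k)) (z b′) (x (suc b′ + suc k)) (x (suc a′)) (x (suc a′ + suc k)) (x (suc b′)))
        ... | inj₂ r′ =
          linear (rb a′ b′ k p e ⊕ ≤-reflexive (last-index e) ⊕ ≤-reflexive (xe (m+n≤o⇒m≤o a′ p)) ⊕ ≤-reflexive (sym (xe p))
                ⊕ ≤-reflexive (sym (xe (m+n≤o⇒m≤o b′ (≤-reflexive e)))))
          (solve 14 (λ a b Q i j k A B C D A′ B′ C′ D′ →
              (A′ :+ B′) :+ ((Q :+ C :+ D) :+ (con 1 :+ a :+ ((j :+ k) :* Q :+ A) :+ (con 1 :+ b)) :+ (con 1 :+ a :+ (i :* Q :+ B)) :+ C′ :+ D′)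
              := (con 1 :+ (C′ :+ D′)) :+ ((b :+ A :+ B) :+ A′ :+ B′ :+ (con 1 :+ a :+ ((i :+ (con 1 :+ k)) :* Q :+ C)) :+ (con 1 :+ a :+ (j :* Q :+ D))))
            refl a b Q a′ b′ k (z m) (z a′) (z (a′ + suc k)) (z b′) (x (suc b′ + suc k)) (x (suc a′)) (x (suc a′ + suc k)) (x (suc b′)))
          where
          e : b′ + k ≡ m
          e = suc-injective (trans (sym (+-suc b′ k)) r′)

      -- At a letter 0 of `u` the bounds with `k = 0` read `a ≤ Q` and `b ≤ Q`: a short inner gap
      -- caps the outer ones.
      flat : ∃ λ i → suc i ≤ m × z (suc i) ≡ z i
      flat = 0∈⇒flat (nonFull⇒0∈ u nf)

      LeftBound⇒≤ : Balanced u → LeftBound → a < Q + δˡ u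
      LeftBound⇒≤ bal lb with balanced? (1F ∷ u)
      ... | yes _ with i , i< , e ← flat =
        linear (lb i 0 (≤-trans (≤-reflexive (+-comm i 1)) i<) ⊕ ≤-reflexive (trans (cong z (+-comm i 1)) e))
          (solve 4 (λ a Q A B → con 1 :+ a :+ ((Q :+ B) :+ A) := (Q :+ con 1) :+ ((a :+ con 0 :+ A) :+ B))
            refl a Q (z i) (z (i + 1)))
      -- With `a ≥ Q`, `LeftBound` would imply `LeftExt`.
      ... | no ¬bal₁ = ≰⇒> λ Q≤a → ¬bal₁ (LeftExt⇒1∷-balanced u bal λ a′ k p →
        linear (lb a′ k p ⊕ Q≤a)
          (solve 5 (λ a Q A B C → A :+ B :+ ((Q :+ C) :+ a) := C :+ ((a :+ A :+ B) :+ (Q :+ con 0))) refl a Q (z k) (z a′) (z (a′ + suc k))))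

      RightBound⇒≤ : Balanced u → RightBound → b < Q + δʳ u
      RightBound⇒≤ bal rb with balanced? (u ∷ʳ 1F)
      ... | yes _ with i , i< , e ← flat =
        linear (rb i m 0 (≤-trans (≤-reflexive (+-comm i 1)) i<) (+-identityʳ m) ⊕ ≤-reflexive (trans (cong z (+-comm i 1)) e))
          (solve 5 (λ b Q A B C → con 1 :+ b :+ ((Q :+ B :+ C) :+ A) := (Q :+ con 1) :+ ((b :+ C :+ A) :+ B))
            refl b Q (z i) (z (i + 1)) (z m))
      ... | no ¬bal₁ = ≰⇒> λ Q≤b → ¬bal₁ (RightExt⇒∷ʳ1-balanced u bal λ a′ b′ k p e →
        linear (rb a′ b′ k p e ⊕ Q≤b)
          (solve 6 (λ b Q A B C D → A :+ B :+ ((Q :+ C :+ D) :+ b) := C :+ D :+ ((b :+ A :+ B) :+ (Q :+ con 0))) refl b Q (z m) (z a′) (z (a′ + suc k)) (z b′)))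

      step : ∀ {a′ k} → z (a′ + k) ≤ z (a′ + suc k)
      step {a′} {k} = ≤-trans (σ-lower u (a′ + k)) (≤-reflexive (cong z (sym (+-suc a′ k))))

      ≤⇒LeftBound : Balanced u → a < Q + δˡ u → LeftBound
      ≤⇒LeftBound bal a< a′ k p with balanced? (1F ∷ u)
      ... | yes bal₁ = linear (a< ⊕ 1∷-balanced⇒LeftExt u bal₁ a′ k p)
        (solve 5 (λ a Q A B C → a :+ A :+ B :+ ((Q :+ con 1) :+ C) := Q :+ C :+ ((con 1 :+ a) :+ (A :+ B))) refl a Q (z k) (z a′) (z (a′ + suc k)))
      -- Now `a < Q`. Balance compares the prefix and the window of length `k` with an error of at
      -- most 1, which the spare `Q - a` absorbs.
      ... | no _ = linear (a< ⊕ balanced⇒WB bal 0 a′ k (m+n≤o⇒n≤o a′ p′) p′ ⊕ step {a′} {k})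
        (solve 6 (λ a Q A B C D → a :+ A :+ B :+ ((Q :+ con 0) :+ (con 1 :+ (D :+ con 0)) :+ C) := Q :+ C :+ ((con 1 :+ a) :+ (A :+ B) :+ D))
          refl a Q (z k) (z a′) (z (a′ + suc k)) (z (a′ + k)))
        where
        p′ : a′ + k ≤ m
        p′ = ≤-trans (+-monoʳ-≤ a′ (n≤1+n k)) p

      ≤⇒RightBound : Balanced u → b < Q + δʳ u → RightBound
      ≤⇒RightBound bal b< a′ b′ k p e with balanced? (u ∷ʳ 1F)
      ... | yes bal₁ = linear (b< ⊕ ∷ʳ1-balanced⇒RightExt u bal₁ a′ b′ k p e)
        (solve 6 (λ a Q A B C D → a :+ A :+ B :+ ((Q :+ con 1) :+ (C :+ D)) := Q :+ C :+ D :+ ((con 1 :+ a) :+ (A :+ B))) refl b Q (z m) (z a′) (z (a′ + suc k)) (z b′))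
      ... | no _ = linear (b< ⊕ balanced⇒WB bal b′ a′ k (≤-reflexive e) (≤-trans (+-monoʳ-≤ a′ (n≤1+n k)) p) ⊕ step {a′} {k} ⊕ ≤-reflexive (cong z (sym e)))
        (solve 8 (λ a Q A B C D E F → a :+ A :+ B :+ ((Q :+ con 0) :+ (con 1 :+ (D :+ F)) :+ C :+ E) := Q :+ C :+ F :+ ((con 1 :+ a) :+ (E :+ B) :+ D :+ A))
          refl b Q (z m) (z a′) (z (a′ + suc k)) (z (a′ + k)) (z (b′ + k)) (z b′))

    code-balanced⇒ : Balanced (code a q u b) → Balanced u × a < Q + δˡ u × b < Q + δʳ u
    code-balanced⇒ bal =
      balᵤ , LeftBound⇒≤ balᵤ (posBalanced⇒LeftBound pb) , RightBound⇒≤ balᵤ (posBalanced⇒RightBound pb)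
      where
      pb : PosBalanced (suc m) x
      pb = subst (λ h → PosBalanced h x) (height-code a q u b) (balanced⇒posBalanced _ bal)
      balᵤ : Balanced u
      balᵤ = WB⇒balanced (posBalanced⇒WB pb)

    code-balanced⇐ : Balanced u → a < Q + δˡ u → b < Q + δʳ u → Balanced (code a q u b)
    code-balanced⇐ bal a< b< = posBalanced⇒balanced _ (subst (λ h → PosBalanced h x) (sym (height-code a q u b))
      (bounds⇒posBalanced (balanced⇒WB bal) (≤⇒LeftBound bal a<) (≤⇒RightBound bal b<)))

  -- Counting words by their gaps

  Admissible : ℕ → ℕ → ℕ → Set
  Admissible B M a = a < M × M ≤ a + B

  admissible? : ∀ B M → Decidable (Admissible B M)
  admissible? B M a = (a <? M) ×-dec (M ≤? a + B)

  -- The a < A such that a + b + 1 = M for some b < B.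
  admissible : ℕ → ℕ → ℕ → List ℕ
  admissible A B M = filter (admissible? B M) (upTo A)

  ∈-admissible⁺ : ∀ {A B M a} → a < A → a < M → M ≤ a + B → a ∈ admissible A B M
  ∈-admissible⁺ {A} {B} {M} a<A a<M M≤ = ∈-filter⁺ (admissible? B M) (∈-upTo⁺ a<A) (a<M , M≤)

  ∈-admissible⁻ : ∀ {A B M a} → a ∈ admissible A B M → a < A × a < M × M ≤ a + B
  ∈-admissible⁻ {A} {B} {M} a∈ with a∈′ , a<M , M≤ ← ∈-filter⁻ (admissible? B M) {xs = upTo A} a∈ =
    ∈-upTo⁻ a∈′ , a<M , M≤

  admissible-unique : ∀ A B M → Unique (admissible A B M)
  admissible-unique A B M = Unique.filter⁺ (admissible? B M) (Unique.upTo⁺ A)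

  #admissible : ℕ → ℕ → ℕ → ℕ
  #admissible A B M = length (admissible A B M)

  #admissible-empty : ∀ A B M → (∀ {a} → a < A → ¬ Admissible B M a) → #admissible A B M ≡ 0
  #admissible-empty A B M none = cong length (filter-none (admissible? B M) (All.tabulate λ a∈ → none (∈-upTo⁻ a∈)))

  #admissible-suc : ∀ A B M → #admissible (suc A) B M ≡ #admissible A B M + length (filter (admissible? B M) [ A ])
  #admissible-suc A B M = begin
    length (filter (admissible? B M) (upTo (suc A)))                        ≡⟨ cong (length ∘ filter (admissible? B M)) (upTo-∷ʳ A) ⟨
    length (filter (admissible? B M) (upTo A ++ [ A ]))                     ≡⟨ cong length (filter-++ (admissible? B M) (upTo A) [ A ]) ⟩
    length (admissible A B M ++ filter (admissible? B M) [ A ])             ≡⟨ length-++ (admissible A B M) ⟩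
    #admissible A B M + length (filter (admissible? B M) [ A ])             ∎
    where open ≡-Reasoning

  ∸-pred : ∀ {m n} → n < m → m ∸ n ≡ suc (m ∸ suc n)
  ∸-pred {m} {n} n<m = +-∸-assoc 1 n<m

  -- Of the `M` pairs with `a + b + 1 = M`, those with `a ≥ A` number `M ∸ A`, those with `b ≥ B`
  -- number `M ∸ B`, and `M ∸ (A + B)` have both; negative terms stand on the left. In the induction
  -- on `A` the new candidate `a = A` counts exactly when `A < M ≤ A + B`.
  #admissible≡ : ∀ A B M → #admissible A B M + (M ∸ A) + (M ∸ B) ≡ M + (M ∸ (A + B))
  #admissible≡ zero    B M = refl
  #admissible≡ (suc A) B M with ih ← #admissible≡ A B M | A <? M | M ≤? A + B
  ... | yes A<M | yes M≤ = begin
    #admissible (suc A) B M + (M ∸ suc A) + (M ∸ B) ≡⟨ cong (λ t → t + (M ∸ suc A) + (M ∸ B)) (trans (#admissible-suc A B M) (cong (λ t → #admissible A B M + length t) (filter-accept (admissible? B M) (A<M , M≤)))) ⟩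
    #admissible A B M + 1 + (M ∸ suc A) + (M ∸ B)   ≡⟨ cong (_+ (M ∸ B)) (trans (+-assoc (#admissible A B M) 1 _) (cong (#admissible A B M +_) (sym (∸-pred A<M)))) ⟩
    #admissible A B M + (M ∸ A) + (M ∸ B)           ≡⟨ ih ⟩
    M + (M ∸ (A + B))                               ≡⟨ cong (M +_) (trans (m≤n⇒m∸n≡0 M≤) (sym (m≤n⇒m∸n≡0 (m≤n⇒m≤1+n M≤)))) ⟩
    M + (M ∸ suc (A + B))                           ∎
    where open ≡-Reasoning
  ... | yes A<M | no M≰ = suc-injective (begin
    suc (#admissible (suc A) B M + (M ∸ suc A) + (M ∸ B)) ≡⟨ cong (λ t → suc (t + (M ∸ suc A) + (M ∸ B))) (trans (#admissible-suc A B M) (trans (cong (λ t → #admissible A B M + length t) (filter-reject (admissible? B M) (M≰ ∘ proj₂))) (+-identityʳ _))) ⟩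
    suc (#admissible A B M + (M ∸ suc A) + (M ∸ B))       ≡⟨ cong (_+ (M ∸ B)) (trans (sym (+-suc _ _)) (cong (#admissible A B M +_) (sym (∸-pred A<M)))) ⟩
    #admissible A B M + (M ∸ A) + (M ∸ B)                 ≡⟨ ih ⟩
    M + (M ∸ (A + B))                                     ≡⟨ trans (cong (M +_) (∸-pred (≰⇒> M≰))) (+-suc M _) ⟩
    suc (M + (M ∸ suc (A + B)))                           ∎)
    where open ≡-Reasoning
  ... | no A≮M | _ = begin
    #admissible (suc A) B M + (M ∸ suc A) + (M ∸ B) ≡⟨ cong (λ t → t + (M ∸ suc A) + (M ∸ B)) (trans (#admissible-suc A B M) (trans (cong (λ t → #admissible A B M + length t) (filter-reject (admissible? B M) (A≮M ∘ proj₁))) (+-identityʳ _))) ⟩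
    #admissible A B M + (M ∸ suc A) + (M ∸ B)       ≡⟨ cong (λ t → #admissible A B M + t + (M ∸ B)) (trans (m≤n⇒m∸n≡0 (m≤n⇒m≤1+n M≤A)) (sym (m≤n⇒m∸n≡0 M≤A))) ⟩
    #admissible A B M + (M ∸ A) + (M ∸ B)           ≡⟨ ih ⟩
    M + (M ∸ (A + B))                               ≡⟨ cong (M +_) (trans (m≤n⇒m∸n≡0 (≤-trans M≤A (m≤m+n A B))) (sym (m≤n⇒m∸n≡0 (≤-trans M≤A (≤-trans (m≤m+n A B) (n≤1+n _)))))) ⟩
    M + (M ∸ suc (A + B))                           ∎
    where
    open ≡-Reasoning
    M≤A : M ≤ A
    M≤A = ≮⇒≥ A≮M

  ∈-𝕊⁻ : ∀ L h {w} → w ∈ 𝕊-list L h → 𝕊 L h w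
  ∈-𝕊⁻ L h = Equivalence.to (∈-𝕊-list {L} {h})

  ∈-𝕊⁺ : ∀ L h {w} → 𝕊 L h w → w ∈ 𝕊-list L h
  ∈-𝕊⁺ L h = Equivalence.from (∈-𝕊-list {L} {h})

  #𝕊-complement : ∀ L {h h′} → h + h′ ≡ L → #𝕊 L h ≡ #𝕊 L h′
  #𝕊-complement L {h} {h′} eq = bijection⇒length {f = complement} (𝕊-list-unique L h) (𝕊-list-unique L h′)
    (into eq) (λ _ _ → complement-injective)
    (λ {w} w∈ → complement w , into (trans (+-comm h′ h) eq) w∈ , complement-involutive)
    where
    into : ∀ {h h′ w} → h + h′ ≡ L → w ∈ 𝕊-list L h → complement w ∈ 𝕊-list L h′
    into {h} {h′} {w} eq w∈ with bal , refl , refl ← ∈-𝕊⁻ L h w∈ =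
      ∈-𝕊⁺ L h′ (complement-balanced w bal , complement-length w ,
        +-cancelʳ-≡ (height w) _ _ (trans (height-complement w) (trans (sym eq) (+-comm (height w) h′))))

  -- q counts a gap together with one adjacent letter 1, so q ≥ 1 for actual words;
  -- the layer q = 0 accounts for the lengths L < h.
  slack : ℕ → ℕ → ℕ → Word → ℕ
  slack m L q u = L ∸ (m * q + height u)

  ends : ℕ → ℕ → ℕ → Word → List ℕ
  ends m L q u = admissible (q + δˡ u) (q + δʳ u) (slack m L q u)

  ∸-recover : ∀ {L K M} → 0 < M → L ∸ K ≡ M → M + K ≡ L
  ∸-recover {L} {K} 0<M refl = m∸n+n≡m (<⇒≤ (m∸n≢0⇒n<m {L} {K} (m<n⇒n≢0 0<M)))

  module _ (m L : ℕ) where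

    private
      cells : ℕ → List (Word × ℕ)
      cells q = pairs (nonFull (suc m)) (ends (suc m) L (suc q))

      cells! : ∀ q → Unique (cells q)
      cells! q = pairs-unique (nonFull-unique (suc m)) (λ u → admissible-unique (suc q + δˡ u) (suc q + δʳ u) (slack (suc m) L (suc q) u))

      -- The inner gaps, each with one letter 1, leave `a + b + 1` places, so the slack and `a`
      -- determine the right gap `b`.
      word : ℕ × Word × ℕ → Word
      word (q , u , a) = code a q u (slack (suc m) L (suc q) u ∸ suc a)

      module _ {q u a} (x∈ : (q , u , a) ∈ pairs (upTo L) cells) where

        private
          u,a∈ : (u , a) ∈ cells q
          u,a∈ = proj₂ (∈-pairs⁻ {g = cells} (upTo L) x∈)
          u∈ = ∈-nonFull⁻ (suc m) (proj₁ (∈-pairs⁻ {g = ends (suc m) L (suc q)} (nonFull (suc m)) u,a∈))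
          a∈ = ∈-admissible⁻ {suc q + δˡ u} {suc q + δʳ u} {slack (suc m) L (suc q) u} (proj₂ (∈-pairs⁻ {g = ends (suc m) L (suc q)} (nonFull (suc m)) u,a∈))
          M = slack (suc m) L (suc q) u

        cell-balanced : Balanced u
        cell-balanced = proj₁ u∈

        cell-length : length u ≡ suc m
        cell-length = proj₁ (proj₂ u∈)

        cell-nonFull : height u < length u
        cell-nonFull = subst (height u <_) (sym cell-length) (proj₂ (proj₂ u∈))

        cell-left : a < suc q + δˡ u
        cell-left = proj₁ a∈

        cell-slack : suc (a + (M ∸ suc a)) ≡ M
        cell-slack = m+[n∸m]≡n (proj₁ (proj₂ a∈))

        cell-right : M ∸ suc a < suc q + δʳ u
        cell-right = +-cancelˡ-≤ a _ _ (≤-trans (≤-reflexive (trans (+-suc a _) cell-slack)) (proj₂ (proj₂ a∈)))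

        cell-total : M + (suc m * suc q + height u) ≡ L
        cell-total = ∸-recover (≤-trans (s≤s z≤n) (≤-reflexive cell-slack)) refl

      into : ∀ {x} → x ∈ pairs (upTo L) cells → word x ∈ 𝕊-list L (suc (suc m))
      into {q , u , a} x∈ = ∈-𝕊⁺ L (2 + m)
        ( code-balanced⇐ a q u _ (cell-nonFull x∈) (cell-balanced x∈) (cell-left x∈) (cell-right x∈)
        , trans (length-code a q u _) (trans (cong₂ (λ s k → s + (k * suc q + height u)) (cell-slack x∈) (cell-length x∈)) (cell-total x∈))
        , trans (height-code a q u _) (cong suc (cell-length x∈)) )

      inj : ∀ {x y} → x ∈ pairs (upTo L) cells → y ∈ pairs (upTo L) cells → word x ≡ word y → x ≡ y
      inj {q , u , a} {q′ , u′ , a′} x∈ y∈ eq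
        with refl , refl , refl , _ ← code-injective {a} {q} {u} {a′ = a′} {q′} {u′} (cell-nonFull x∈) (cell-nonFull y∈) eq = refl

      onto-code : ∀ a q u b → Balanced (code a q u b) → length (code a q u b) ≡ L →
                  length u ≡ suc m → height u < suc m →
                  (q , u , a) ∈ pairs (upTo L) cells × word (q , u , a) ≡ code a q u b
      onto-code a q u b bal lw lu hu =
        ∈-pairs⁺ {g = cells} (∈-upTo⁺ q<L) (∈-pairs⁺ {g = ends (suc m) L (suc q)} (∈-nonFull⁺ (proj₁ parts) lu hu)
          (∈-admissible⁺ (proj₁ (proj₂ parts)) (≤-trans (s≤s (m≤m+n a b)) (≤-reflexive (sym M≡)))
            (≤-trans (≤-reflexive (trans M≡ (sym (+-suc a b)))) (+-monoʳ-≤ a (proj₂ (proj₂ parts)))))) ,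
        cong (code a q u) (trans (cong (_∸ suc a) M≡) (m+n∸m≡n a b))
        where
        parts : Balanced u × a < suc q + δˡ u × b < suc q + δʳ u
        parts = code-balanced⇒ a q u b (subst (height u <_) (sym lu) hu) bal
        total : suc (a + b) + (suc m * suc q + height u) ≡ L
        total = trans (cong (λ k → suc (a + b) + (k * suc q + height u)) (sym lu)) (trans (sym (length-code a q u b)) lw)
        M≡ : slack (suc m) L (suc q) u ≡ suc (a + b)
        M≡ = trans (cong (_∸ (suc m * suc q + height u)) (sym total)) (m+n∸n≡m (suc (a + b)) (suc m * suc q + height u))
        -- At least one inner gap, of size at least `q + 1` with its letter 1, fits into the length,
        -- so the layers up to `L` suffice.
        q<L : q < L
        q<L = ≤-trans (≤-trans (m≤n*m (suc q) (suc m)) (≤-trans (m≤m+n _ (height u)) (m≤n+m _ (suc (a + b))))) (≤-reflexive total)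

      onto : ∀ {w} → w ∈ 𝕊-list L (suc (suc m)) → ∃ λ x → x ∈ pairs (upTo L) cells × word x ≡ w
      onto {w} w∈ =
        let bal , lw , hw = ∈-𝕊⁻ L (2 + m) w∈
            a , q , u , b , lu , hu , eq = code-onto w hw bal
            x∈ , word≡ = onto-code a q u b (subst Balanced (sym eq) bal) (trans (cong length eq) lw) lu hu
        in (q , u , a) , x∈ , trans word≡ eq

    #𝕊≡ : #𝕊 L (suc (suc m)) ≡
          sum (map (λ q → sum (map (length ∘ ends (suc m) L (suc q)) (nonFull (suc m)))) (upTo L))
    #𝕊≡ = begin
      #𝕊 L (suc (suc m))                    ≡⟨ bijection⇒length {f = word} (pairs-unique (Unique.upTo⁺ L) cells!) (𝕊-list-unique L _) into inj onto ⟨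
      length (pairs (upTo L) cells)         ≡⟨ length-pairs {g = cells} (upTo L) ⟩
      sum (map (length ∘ cells) (upTo L))   ≡⟨ cong sum (map-cong (λ q → length-pairs {g = ends (suc m) L (suc q)} (nonFull (suc m))) (upTo L)) ⟩
      _                                     ∎
      where open ≡-Reasoning

  gapWord-ends-1 : ∀ a gs → ∃ λ p → gapWord a gs 0 ≡ p ∷ʳ 1F
  gapWord-ends-1 (suc a) gs       with p , e ← gapWord-ends-1 a gs = 0F ∷ p , cong (0F ∷_) e
  gapWord-ends-1 zero    []       = [] , refl
  gapWord-ends-1 zero    (g ∷ gs) with p , e ← gapWord-ends-1 g gs = 1F ∷ p , cong (1F ∷_) e

  gapWord-ends-0 : ∀ a gs b → ∃ λ p → gapWord a gs (suc b) ≡ p ∷ʳ 0F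
  gapWord-ends-0 (suc a) gs       b with p , e ← gapWord-ends-0 a gs b = 0F ∷ p , cong (0F ∷_) e
  gapWord-ends-0 zero    []       b = 1F ∷ replicate b 0F , cong (1F ∷_) (zeros b)
    where
    zeros : ∀ b → replicate {A = Fin 2} (suc b) 0F ≡ replicate b 0F ∷ʳ 0F
    zeros zero    = refl
    zeros (suc b) = cong (0F ∷_) (zeros b)
  gapWord-ends-0 zero    (g ∷ gs) b with p , e ← gapWord-ends-0 g gs b = 1F ∷ p , cong (1F ∷_) e

  bordered-gapWord : ∀ {a gs b u} → gapWord a gs b ≡ 1F ∷ u ∷ʳ 1F → a ≡ 0 × b ≡ 0
  bordered-gapWord {zero}  {gs} {zero}  {u} eq = refl , refl
  bordered-gapWord {zero}  {gs} {suc b} {u} eq with p , e ← gapWord-ends-0 0 gs b =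
    contradiction (proj₂ (∷ʳ-injective p (1F ∷ u) (trans (sym e) eq))) λ ()
  bordered-gapWord {suc a} {gs} {b}     {u} eq = contradiction (∷-injectiveˡ eq) λ ()

  indicator-positive : ∀ {P : Set} (P? : Dec P) → 0 < indicator P? → P
  indicator-positive (yes p) _ = p

  height-1∷∷ʳ1 : ∀ u → height (1F ∷ u ∷ʳ 1F) ≡ 2 + height u
  height-1∷∷ʳ1 []       = refl
  height-1∷∷ʳ1 (0F ∷ u) = height-1∷∷ʳ1 u
  height-1∷∷ʳ1 (1F ∷ u) = cong suc (height-1∷∷ʳ1 u)

  -- Here L = l + 1 < h = m + 1: the words 1u1 have L + 1 letters 1 and length
  -- h + 1, so their gaps are coded by the balanced words of length L and height h mod L.
  module _ (m l : ℕ) (l<m : l < m) where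

    private
      L = suc l
      h = suc m

      cells : List (Word × ℕ)
      cells = pairs (nonFull m) (ends m L 0)

      bordered : Word × ℕ → Word
      bordered (u , _) = 1F ∷ u ∷ʳ 1F

      -- At `q = 0` the left gap satisfies `a < δˡ u ≤ 1`, and then the slack is at most `δʳ u ≤ 1`.
      -- A cell therefore forces `a = 0`, slack 1 and both indicators equal to 1.
      cell⁻ : ∀ {u a} → (u , a) ∈ cells →
              a ≡ 0 × height u ≡ l × length u ≡ m × Balanced (1F ∷ u) × Balanced (u ∷ʳ 1F)
      cell⁻ {u} {a} x∈ =
        a≡0 , suc-injective (trans (cong suc (cong (_+ height u) (sym (*-zeroʳ m)))) (∸-recover {L} (s≤s z≤n) M≡1)) , proj₁ (proj₂ u∈) ,
        indicator-positive (balanced? (1F ∷ u)) (≤-trans (s≤s z≤n) a<A) , indicator-positive (balanced? (u ∷ʳ 1F)) (≤-trans (≤-reflexive (sym M≡1)) M≤)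
        where
        u∈ : Balanced u × length u ≡ m × height u < m
        u∈ = ∈-nonFull⁻ m (proj₁ (∈-pairs⁻ {g = ends m L 0} (nonFull m) x∈))
        a∈ : a < δˡ u × a < slack m L 0 u × slack m L 0 u ≤ a + δʳ u
        a∈ = ∈-admissible⁻ {δˡ u} {δʳ u} {slack m L 0 u} (proj₂ (∈-pairs⁻ {g = ends m L 0} (nonFull m) x∈))
        a<A : a < δˡ u
        a<A = proj₁ a∈
        a≡0 : a ≡ 0
        a≡0 = n<1⇒n≡0 (≤-trans a<A (indicator≤1 (balanced? (1F ∷ u))))
        M≤ : slack m L 0 u ≤ δʳ u
        M≤ = subst (λ k → slack m L 0 u ≤ k + δʳ u) a≡0 (proj₂ (proj₂ a∈))
        M≡1 : slack m L 0 u ≡ 1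
        M≡1 = ≤-antisym (≤-trans M≤ (indicator≤1 (balanced? (u ∷ʳ 1F)))) (≤-trans (s≤s z≤n) (proj₁ (proj₂ a∈)))

      cell⁺ : ∀ {u} → height u ≡ l → length u ≡ m → Balanced (1F ∷ u) → Balanced (u ∷ʳ 1F) → (u , 0) ∈ cells
      cell⁺ {u} hu lu bal₁ bal₂ = ∈-pairs⁺ {g = ends m L 0} (∈-nonFull⁺ (balanced-tail bal₁) lu (subst (_< m) (sym hu) l<m))
        (∈-admissible⁺ (≤-reflexive (sym (indicator-yes (balanced? (1F ∷ u)) bal₁)))
          (≤-reflexive (sym M≡1)) (≤-trans (≤-reflexive M≡1) (≤-reflexive (sym (indicator-yes (balanced? (u ∷ʳ 1F)) bal₂)))))
        where
        M≡1 : slack m L 0 u ≡ 1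
        M≡1 = trans (cong (L ∸_) (trans (cong (_+ height u) (*-zeroʳ m)) hu)) (m+n∸n≡m 1 l)

      bordered! : Unique (map bordered cells)
      bordered! = map-unique inj (pairs-unique (nonFull-unique m) (λ u → admissible-unique (δˡ u) (δʳ u) (slack m L 0 u)))
        where
        inj : ∀ {x y} → x ∈ cells → y ∈ cells → bordered x ≡ bordered y → x ≡ y
        inj {u , a} {u′ , a′} x∈ y∈ eq
          with refl , _ ← cell⁻ x∈ | refl , _ ← cell⁻ y∈
          with refl , _ ← ∷ʳ-injective u u′ (∷-injectiveʳ eq) = refl

      r = h % L

      -- `code` counts zeros only, so the gap size `h / L`, which is positive because `L < h`, is
      -- lowered by 1.
      q : ℕ
      q = pred (h / L)

      1+q≡h/L : suc q ≡ h / L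
      1+q≡h/L = suc-pred (h / L) ⦃ >-nonZero (m≥n⇒m/n>0 (s≤s (<⇒≤ l<m))) ⦄

      f : Word → Word
      f v = code 0 q v 0

      -- Division with remainder is the length count: after the first 1, the remaining `h` places
      -- are filled by `L` gaps of size `q + 1`, of which `r` are longer by 1.
      total : L * suc q + r ≡ h
      total = trans (+-comm _ r) (trans (cong (_+_ r) (trans (*-comm L (suc q)) (cong (_* L) 1+q≡h/L))) (sym (m≡m%n+[m/n]*n h L)))

      r<L : r < L
      r<L = m%n<n h L

      nf : ∀ {v} → v ∈ 𝕊-list L r → height v < length v
      nf v∈ with _ , lv , hv ← ∈-𝕊⁻ L r v∈ = subst₂ _<_ (sym hv) (sym lv) r<L

      into : ∀ {v} → v ∈ 𝕊-list L r → f v ∈ map bordered cells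
      into {v} v∈ = go v (∈-𝕊⁻ L r v∈) (nf v∈)
        where
        go : ∀ v → 𝕊 L r v → height v < length v → f v ∈ map bordered cells
        go v@(c ∷ v′) (bal , lv , hv) nfv with p , e ← gapWord-ends-1 (q + toℕ c) (gaps q v′) =
          subst (_∈ map bordered cells) (sym fv≡) (∈-map⁺ bordered (cell⁺ hp lp (balanced-init {u = 1F ∷ p} balf) (balanced-tail balf)))
          where
          fv≡ : f v ≡ 1F ∷ p ∷ʳ 1F
          fv≡ = cong (1F ∷_) e
          balf : Balanced (1F ∷ p ∷ʳ 1F)
          balf = subst Balanced fv≡ (code-balanced⇐ 0 q v 0 nfv bal (s≤s z≤n) (s≤s z≤n))
          hp : height p ≡ l
          hp = suc-injective (suc-injective (trans (sym (height-1∷∷ʳ1 p)) (trans (cong height (sym fv≡)) (trans (height-code 0 q v 0) (cong suc lv)))))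
          lp : length p ≡ m
          lp = suc-injective (suc-injective (begin
            2 + length p                    ≡⟨ cong suc (length-∷ʳ p 1F) ⟨
            length (1F ∷ p ∷ʳ 1F)           ≡⟨ cong length fv≡ ⟨
            length (f v)                    ≡⟨ length-code 0 q v 0 ⟩
            suc (length v * suc q + height v) ≡⟨ cong suc (cong₂ (λ k t → k * suc q + t) lv hv) ⟩
            suc (L * suc q + r)             ≡⟨ cong suc total ⟩
            suc h                           ∎))
            where open ≡-Reasoning

      onto-code : ∀ u q′ v → code 0 q′ v 0 ≡ 1F ∷ u ∷ʳ 1F → Balanced (1F ∷ u ∷ʳ 1F) →
                  length u ≡ m → length v ≡ L → height v < L → Balanced v × height v ≡ r × q′ ≡ q
      onto-code u q′ v eq bal lu lv hv =
        proj₁ (code-balanced⇒ 0 q′ v 0 (subst (height v <_) (sym lv) hv) (subst Balanced (sym eq) bal)) , hr ,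
        suc-injective (*-cancelˡ-≡ _ _ L (+-cancelʳ-≡ r _ _ (trans (cong (L * suc q′ +_) (sym hr)) (trans total′ (sym total)))))
        where
        total′ : L * suc q′ + height v ≡ h
        total′ = suc-injective (begin
          suc (L * suc q′ + height v)           ≡⟨ cong (λ k → suc (k * suc q′ + height v)) lv ⟨
          suc (length v * suc q′ + height v)    ≡⟨ length-code 0 q′ v 0 ⟨
          length (code 0 q′ v 0)                ≡⟨ cong length eq ⟩
          length (1F ∷ u ∷ʳ 1F)                 ≡⟨ cong suc (length-∷ʳ u 1F) ⟩
          2 + length u                          ≡⟨ cong (2 +_) lu ⟩
          suc h                                 ∎)
          where open ≡-Reasoning
        h≡ : h ≡ height v + suc q′ * L
        h≡ = trans (sym total′) (trans (+-comm _ (height v)) (cong (_+_ (height v)) (*-comm L (suc q′))))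
        hr : height v ≡ r
        hr = trans (sym (m<n⇒m%n≡m hv)) (trans (sym ([m+kn]%n≡m%n (height v) (suc q′) L)) (cong (_% L) (sym h≡)))

      onto : ∀ {w} → w ∈ map bordered cells → ∃ λ v → v ∈ 𝕊-list L r × f v ≡ w
      onto {w} w∈ =
        let (u , _) , x∈ , w≡ = ∈-map⁻ bordered w∈
            _ , hu , lu , bal₁ , bal₂ = cell⁻ x∈
            bal = 1∷∷ʳ1-balanced u bal₁ bal₂
            a , q′ , v , b , lv , hv , eq = code-onto (1F ∷ u ∷ʳ 1F) (trans (height-1∷∷ʳ1 u) (cong (2 +_) hu)) bal
            a≡0 , b≡0 = bordered-gapWord {a} {gaps q′ v} {b} eq
            eq₀ = trans (cong₂ (λ a b → code a q′ v b) (sym a≡0) (sym b≡0)) eq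
            balᵥ , hr , q≡ = onto-code u q′ v eq₀ bal lu lv hv
        in v , ∈-𝕊⁺ L r (balᵥ , lv , hr) , trans (cong (λ q → code 0 q v 0) (sym q≡)) (trans eq₀ (sym w≡))

    #𝕊-mod≡ : #𝕊 L (h % L) ≡ sum (map (length ∘ ends m L 0) (nonFull m))
    #𝕊-mod≡ = begin
      #𝕊 L r                      ≡⟨ bijection⇒length {f = f} (𝕊-list-unique L r) bordered! into inj onto ⟩
      length (map bordered cells) ≡⟨ length-map bordered cells ⟩
      length cells                ≡⟨ length-pairs {g = ends m L 0} (nonFull m) ⟩
      _                           ∎
      where
      open ≡-Reasoning
      inj : ∀ {v v′} → v ∈ 𝕊-list L r → v′ ∈ 𝕊-list L r → f v ≡ f v′ → v ≡ v′
      inj {v} {v′} v∈ v′∈ eq = proj₁ (proj₂ (proj₂ (code-injective {0} {q} {v} {0} {0} {q} {v′} {0} (nf v∈) (nf v′∈) eq)))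

  sum-upTo-suc : ∀ (f : ℕ → ℕ) n → sum (map f (upTo (suc n))) ≡ f 0 + sum (map (f ∘ suc) (upTo n))
  sum-upTo-suc f n = cong (λ xs → f 0 + sum xs) (trans (map-applyUpTo suc f n) (sym (map-upTo (f ∘ suc) n)))

  sum-zero : ∀ {A : Set} (f : A → ℕ) xs → (∀ x → x ∈ xs → f x ≡ 0) → sum (map f xs) ≡ 0
  sum-zero f []       _  = refl
  sum-zero f (x ∷ xs) f0 = cong₂ _+_ (f0 x (here refl)) (sum-zero f xs (λ y y∈ → f0 y (there y∈)))

  module _ (m′ : ℕ) where

    private
      m = suc m′

      layer : ℕ → ℕ → ℕ
      layer L q = sum (map (length ∘ ends m L q) (nonFull m))

      no-slack : ∀ L q u → L ≤ m * q + height u → length (ends m L q u) ≡ 0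
      no-slack L q u L≤ = trans
        (cong (length ∘ admissible (q + δˡ u) (q + δʳ u)) (m≤n⇒m∸n≡0 L≤))
        (#admissible-empty (q + δˡ u) (q + δʳ u) 0 (λ _ p → contradiction (proj₁ p) λ ()))

      -- Here `height u ≤ h - 2` leaves a slack of at least 2, whereas the outer gaps of the layer
      -- `q = 0` allow at most 1.
      large : ∀ L → suc m ≤ L → #𝕊 L (suc m) ≡ layer L 0 + sum (map (layer L ∘ suc) (upTo L))
      large L h≤L = trans (#𝕊≡ m′ L) (cong (_+ sum (map (layer L ∘ suc) (upTo L))) (sym
        (sum-zero (length ∘ ends m L 0) (nonFull m) λ u u∈ →
          #admissible-empty (δˡ u) (δʳ u) (slack m L 0 u) (λ a< (_ , M≤) →
            <⇒≱ (2≤slack u (proj₂ (proj₂ (∈-nonFull⁻ m u∈)))) (≤-trans M≤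
              (+-mono-≤ (s≤s⁻¹ (≤-trans a< (indicator≤1 (balanced? (1F ∷ u))))) (indicator≤1 (balanced? (u ∷ʳ 1F)))))))))
        where
        2≤slack : ∀ u → height u < m → 2 ≤ slack m L 0 u
        2≤slack u hu = m+n≤o⇒m≤o∸n 2 (≤-trans (s≤s (≤-trans (≤-reflexive (cong (λ t → suc (t + height u)) (*-zeroʳ m))) hu)) h≤L)

      by-size : ∀ l → let L = suc l in Tri (L < suc m) (L ≡ suc m) (L > suc m) →
                #𝕊 L (suc m % L) ≡ layer L 0 + sum (map (layer L ∘ suc) (upTo L))
      -- As `L ≤ h - 1`, no layer from `q = 1` on has any slack.
      by-size l (tri< (s≤s l<m) _ _) = begin
        #𝕊 L (suc m % L)                               ≡⟨ #𝕊-mod≡ m l l<m ⟩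
        layer L 0                                      ≡⟨ +-identityʳ _ ⟨
        layer L 0 + 0                                  ≡⟨ cong (_+_ (layer L 0)) (sum-zero (layer L ∘ suc) (upTo L) (λ q _ →
                                                            sum-zero (length ∘ ends m L (suc q)) (nonFull m) (λ u _ →
                                                              no-slack L (suc q) u (≤-trans l<m (≤-trans (m≤m*n m (suc q)) (m≤m+n _ (height u))))))) ⟨
        layer L 0 + sum (map (layer L ∘ suc) (upTo L)) ∎
        where
        open ≡-Reasoning
        L = suc l
      -- For `L = h` the residue is 0, while the layers count words of height `h = L`; exchange of
      -- letters relates the two.
      by-size l (tri≈ _ L≡h _) =
        trans (cong (#𝕊 L) h%L≡0) (trans (#𝕊-complement L {0} {suc m} (sym L≡h)) (large L (≤-reflexive (sym L≡h))))
        where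
        L = suc l
        h%L≡0 : suc m % L ≡ 0
        h%L≡0 = trans (cong (_% L) (sym L≡h)) (n%n≡0 L)
      by-size l (tri> _ _ h<L) = trans (cong (#𝕊 (suc l)) (m<n⇒m%n≡m h<L)) (large (suc l) (<⇒≤ h<L))

    s≡ : ∀ L → s (ℤ.+ L) (ℤ.+ suc m) ≡ sum (map (layer L) (upTo (suc L)))
    s≡ L = trans (main L) (sym (sum-upTo-suc (layer L) L))
      where
      main : ∀ L → s (ℤ.+ L) (ℤ.+ suc m) ≡ layer L 0 + sum (map (layer L ∘ suc) (upTo L))
      -- The default value 0 of `s` at length 0 and positive height agrees with the sum, since
      -- length 0 leaves no slack.
      main zero    = sym (trans (+-identityʳ _) (sum-zero (length ∘ ends m 0 0) (nonFull m) λ u _ → no-slack 0 0 u z≤n))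
      main (suc l) = by-size l (<-cmp (suc l) (suc m))

  -- Sums of truncated differences

  ramp : ∀ {A : Set} → List A → ℕ → (A → ℕ) → ℕ → ℕ → ℕ
  ramp xs c t L q = sum (map (λ x → L ∸ (c * q + t x)) xs)

  -- For `c ≥ 1`, stopping at `q = L` loses nothing: later terms are truncated to 0.
  ramps : ∀ {A : Set} → List A → ℕ → (A → ℕ) → ℕ → ℕ
  ramps xs c t L = sum (map (ramp xs c t L) (upTo (suc L)))

  sum-upTo-extend : ∀ (f : ℕ → ℕ) n k → (∀ i → n ≤ i → f i ≡ 0) → sum (map f (upTo (n + k))) ≡ sum (map f (upTo n))
  sum-upTo-extend f n zero    f0 = cong (λ i → sum (map f (upTo i))) (+-identityʳ n)
  sum-upTo-extend f n (suc k) f0 = begin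
    sum (map f (upTo (n + suc k)))             ≡⟨ cong (λ i → sum (map f (upTo i))) (+-suc n k) ⟩
    sum (map f (upTo (suc (n + k))))           ≡⟨ cong (sum ∘ map f) (upTo-∷ʳ (n + k)) ⟨
    sum (map f (upTo (n + k) ++ [ n + k ]))    ≡⟨ cong sum (map-++ f (upTo (n + k)) [ n + k ]) ⟩
    sum (map f (upTo (n + k)) ++ [ f (n + k) ]) ≡⟨ sum-++ (map f (upTo (n + k))) [ f (n + k) ] ⟩
    sum (map f (upTo (n + k))) + (f (n + k) + 0) ≡⟨ cong₂ (λ a b → a + (b + 0)) (sum-upTo-extend f n k f0) (f0 (n + k) (m≤m+n n k)) ⟩
    sum (map f (upTo n)) + 0                   ≡⟨ +-identityʳ _ ⟩
    sum (map f (upTo n))                       ∎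
    where open ≡-Reasoning

  -- Passing from `L` to `L + c` renumbers the layers and adds a new first one. Its terms
  -- `L + c - t x` are not truncated because `t x ≤ c`, so the increment is exactly linear in `L`.
  ramps-step : ∀ {A : Set} (xs : List A) c .{{_ : NonZero c}} t → (∀ x → x ∈ xs → t x ≤ c) → ∀ L →
    ramps xs c t (L + c) + sum (map t xs) ≡ ramps xs c t L + length xs * (L + c)
  ramps-step xs c@(suc c′) t t≤ L = begin
    ramps xs c t (L + c) + S                                               ≡⟨ cong (_+ S) (sum-upTo-suc (ramp xs c t (L + c)) (L + c)) ⟩
    ramp xs c t (L + c) 0 + sum (map (ramp xs c t (L + c) ∘ suc) (upTo (L + c))) + S ≡⟨ cong (λ r → ramp xs c t (L + c) 0 + r + S) (cong sum (map-cong shift (upTo (L + c)))) ⟩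
    ramp xs c t (L + c) 0 + sum (map (ramp xs c t L) (upTo (L + c))) + S   ≡⟨ cong (λ r → ramp xs c t (L + c) 0 + r + S) tail ⟩
    ramp xs c t (L + c) 0 + ramps xs c t L + S                             ≡⟨ solve 3 (λ a b c → a :+ b :+ c := b :+ (a :+ c)) refl (ramp xs c t (L + c) 0) (ramps xs c t L) S ⟩
    ramps xs c t L + (ramp xs c t (L + c) 0 + S)                           ≡⟨ cong (_+_ (ramps xs c t L)) first ⟩
    ramps xs c t L + length xs * (L + c)                                   ∎
    where
    open ≡-Reasoning
    S = sum (map t xs)
    shift : ∀ q → ramp xs c t (L + c) (suc q) ≡ ramp xs c t L q
    shift q = cong sum (map-cong (λ x → trans
      (cong₂ _∸_ (+-comm L c) (trans (cong (_+ t x) (*-suc c q)) (+-assoc c (c * q) (t x))))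
      ([m+n]∸[m+o]≡n∸o c L (c * q + t x))) xs)
    tail : sum (map (ramp xs c t L) (upTo (L + c))) ≡ ramps xs c t L
    tail = trans (cong (λ i → sum (map (ramp xs c t L) (upTo i))) (+-suc L c′))
      (sum-upTo-extend (ramp xs c t L) (suc L) c′ λ q L<q →
        sum-zero (λ x → L ∸ (c * q + t x)) xs λ x _ →
          m≤n⇒m∸n≡0 (≤-trans (<⇒≤ L<q) (≤-trans (m≤n*m q c) (m≤m+n _ (t x)))))
    first : ramp xs c t (L + c) 0 + S ≡ length xs * (L + c)
    first = begin
      ramp xs c t (L + c) 0 + S                              ≡⟨ sum-map-+ (λ x → L + c ∸ (c * 0 + t x)) t xs ⟨
      sum (map (λ x → L + c ∸ (c * 0 + t x) + t x) xs)       ≡⟨ cong sum (map-cong-∈ xs λ x x∈ →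
                                                                  trans (cong (λ z → L + c ∸ (z + t x) + t x) (*-zeroʳ c)) (m∸n+n≡m (≤-trans (t≤ x x∈) (m≤n+m c L)))) ⟩
      sum (map (λ _ → L + c) xs)                             ≡⟨ sum-const (L + c) xs ⟩
      (L + c) * length xs                                    ≡⟨ *-comm (L + c) (length xs) ⟩
      length xs * (L + c)                                    ∎

  tˡ tʳ tˡʳ : Word → ℕ
  tˡ u = height u + δˡ u
  tʳ u = height u + δʳ u
  tˡʳ u = height u + δˡ u + δʳ u

  module _ (m′ : ℕ) where

    private
      m = suc m′
      xs = nonFull m

    -- This is `#admissible≡` with `A = q + δˡ u` and `B = q + δʳ u`, summed over all cells. Each
    -- `q` taken off the slack joins `m * q`, which turns the period `h - 1` into `h` and `h + 1`.
    s-ramps : ∀ L → s (ℤ.+ L) (ℤ.+ suc m) + (ramps xs (suc m) tˡ L + ramps xs (suc m) tʳ L)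
                  ≡ ramps xs m height L + ramps xs (2 + m) tˡʳ L
    s-ramps L = begin
      s (ℤ.+ L) (ℤ.+ suc m) + (ramps xs (suc m) tˡ L + ramps xs (suc m) tʳ L)
        ≡⟨ cong (_+ (ramps xs (suc m) tˡ L + ramps xs (suc m) tʳ L)) (s≡ m′ L) ⟩
      sum (map N qs) + (sum (map (ramp xs (suc m) tˡ L) qs) + sum (map (ramp xs (suc m) tʳ L) qs))
        ≡⟨ cong (sum (map N qs) +_) (sum-map-+ (ramp xs (suc m) tˡ L) (ramp xs (suc m) tʳ L) qs) ⟨
      sum (map N qs) + sum (map (λ q → ramp xs (suc m) tˡ L q + ramp xs (suc m) tʳ L q) qs)
        ≡⟨ sum-map-+ N _ qs ⟨
      sum (map (λ q → N q + (ramp xs (suc m) tˡ L q + ramp xs (suc m) tʳ L q)) qs)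
        ≡⟨ cong sum (map-cong layer qs) ⟩
      sum (map (λ q → ramp xs m height L q + ramp xs (2 + m) tˡʳ L q) qs)
        ≡⟨ sum-map-+ (ramp xs m height L) (ramp xs (2 + m) tˡʳ L) qs ⟩
      ramps xs m height L + ramps xs (2 + m) tˡʳ L ∎
      where
      open ≡-Reasoning
      qs = upTo (suc L)
      N : ℕ → ℕ
      N q = sum (map (length ∘ ends m L q) xs)
      cell : ∀ q u → length (ends m L q u) + (L ∸ (suc m * q + tˡ u) + (L ∸ (suc m * q + tʳ u)))
                   ≡ L ∸ (m * q + height u) + (L ∸ ((2 + m) * q + tˡʳ u))
      cell q u = begin
        n + (L ∸ (suc m * q + tˡ u) + (L ∸ (suc m * q + tʳ u)))
          ≡⟨ cong (n +_) (cong₂ _+_ (cong (L ∸_) (regroup (δˡ u))) (cong (L ∸_) (regroup (δʳ u)))) ⟩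
        n + (L ∸ (k + (q + δˡ u)) + (L ∸ (k + (q + δʳ u))))
          ≡⟨ cong (n +_) (cong₂ _+_ (∸-+-assoc L k (q + δˡ u)) (∸-+-assoc L k (q + δʳ u))) ⟨
        n + ((L ∸ k ∸ (q + δˡ u)) + (L ∸ k ∸ (q + δʳ u)))
          ≡⟨ +-assoc n _ _ ⟨
        n + (L ∸ k ∸ (q + δˡ u)) + (L ∸ k ∸ (q + δʳ u))
          ≡⟨ #admissible≡ (q + δˡ u) (q + δʳ u) (L ∸ k) ⟩
        (L ∸ k) + (L ∸ k ∸ (q + δˡ u + (q + δʳ u)))
          ≡⟨ cong (_+_ (L ∸ k)) (∸-+-assoc L k (q + δˡ u + (q + δʳ u))) ⟩
        (L ∸ k) + (L ∸ (k + (q + δˡ u + (q + δʳ u))))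
          ≡⟨ cong (λ t → (L ∸ k) + (L ∸ t)) (solve 5 (λ m q h x y → m :* q :+ h :+ (q :+ x :+ (q :+ y)) := (con 2 :+ m) :* q :+ (h :+ x :+ y)) refl m q (height u) (δˡ u) (δʳ u)) ⟩
        (L ∸ k) + (L ∸ ((2 + m) * q + tˡʳ u)) ∎
        where
        k = m * q + height u
        n = length (ends m L q u)
        regroup : ∀ d → suc m * q + (height u + d) ≡ k + (q + d)
        regroup d = solve 4 (λ m q h d → (con 1 :+ m) :* q :+ (h :+ d) := m :* q :+ h :+ (q :+ d)) refl m q (height u) d
      layer : ∀ q → N q + (ramp xs (suc m) tˡ L q + ramp xs (suc m) tʳ L q) ≡ ramp xs m height L q + ramp xs (2 + m) tˡʳ L q
      layer q = begin
        N q + (ramp xs (suc m) tˡ L q + ramp xs (suc m) tʳ L q) ≡⟨ cong (N q +_) (sum-map-+ (λ u → L ∸ (suc m * q + tˡ u)) (λ u → L ∸ (suc m * q + tʳ u)) xs) ⟨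
        N q + sum (map (λ u → L ∸ (suc m * q + tˡ u) + (L ∸ (suc m * q + tʳ u))) xs) ≡⟨ sum-map-+ (length ∘ ends m L q) _ xs ⟨
        sum (map (λ u → length (ends m L q u) + (L ∸ (suc m * q + tˡ u) + (L ∸ (suc m * q + tʳ u)))) xs) ≡⟨ cong sum (map-cong (cell q) xs) ⟩
        sum (map (λ u → L ∸ (m * q + height u) + (L ∸ ((2 + m) * q + tˡʳ u))) xs) ≡⟨ sum-map-+ (λ u → L ∸ (m * q + height u)) (λ u → L ∸ ((2 + m) * q + tˡʳ u)) xs ⟩
        ramp xs m height L q + ramp xs (2 + m) tˡʳ L q ∎

    private
      T = length xs
      S = sum (map height xs)
      Dˡ = sum (map δˡ xs)
      Dʳ = sum (map δʳ xs)
      -- Each indicator adds at most 1 to the offset while the period grows by 1, so the hypothesis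
      -- `t ≤ c` of `ramps-step` passes from the period `m` to `m + 1` and `m + 2`.
      height≤ : ∀ u → u ∈ xs → height u ≤ m
      height≤ u u∈ = <⇒≤ (proj₂ (proj₂ (∈-nonFull⁻ m u∈)))

    ramps₁-step : ∀ L → ramps xs m height (L + m) + S ≡ ramps xs m height L + T * (L + m)
    ramps₁-step = ramps-step xs m height height≤

    ramps₂-step : ∀ L → let f = λ L → ramps xs (suc m) tˡ L + ramps xs (suc m) tʳ L in
                  f (L + suc m) + (2 * S + (Dˡ + Dʳ)) ≡ f L + 2 * T * (L + suc m)
    ramps₂-step L = begin
      a′ + b′ + (2 * S + (Dˡ + Dʳ))       ≡⟨ solve 5 (λ a b s x y → a :+ b :+ (con 2 :* s :+ (x :+ y)) := a :+ (s :+ x) :+ (b :+ (s :+ y))) refl a′ b′ S Dˡ Dʳ ⟩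
      a′ + (S + Dˡ) + (b′ + (S + Dʳ))     ≡⟨ cong₂ (λ x y → a′ + x + (b′ + y)) (sum-map-+ height δˡ xs) (sum-map-+ height δʳ xs) ⟨
      a′ + sum (map tˡ xs) + (b′ + sum (map tʳ xs)) ≡⟨ cong₂ _+_ (ramps-step xs (suc m) tˡ (bound δˡ (λ u → indicator≤1 (balanced? (1F ∷ u)))) L)
                                                           (ramps-step xs (suc m) tʳ (bound δʳ (λ u → indicator≤1 (balanced? (u ∷ʳ 1F)))) L) ⟩
      a + T * (L + suc m) + (b + T * (L + suc m)) ≡⟨ solve 4 (λ a b t l → a :+ t :* l :+ (b :+ t :* l) := a :+ b :+ con 2 :* t :* l) refl a b T (L + suc m) ⟩
      a + b + 2 * T * (L + suc m) ∎
      where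
      open ≡-Reasoning
      a = ramps xs (suc m) tˡ L
      b = ramps xs (suc m) tʳ L
      a′ = ramps xs (suc m) tˡ (L + suc m)
      b′ = ramps xs (suc m) tʳ (L + suc m)
      bound : (d : Word → ℕ) → (∀ u → d u ≤ 1) → ∀ u → u ∈ xs → height u + d u ≤ suc m
      bound d d≤1 u u∈ = ≤-trans (+-mono-≤ (height≤ u u∈) (d≤1 u)) (≤-reflexive (+-comm m 1))

    ramps₃-step : ∀ L → ramps xs (2 + m) tˡʳ (L + (2 + m)) + (S + (Dˡ + Dʳ)) ≡ ramps xs (2 + m) tˡʳ L + T * (L + (2 + m))
    ramps₃-step L = trans (cong (_+_ (ramps xs (2 + m) tˡʳ (L + (2 + m)))) (sym sum-tˡʳ)) (ramps-step xs (2 + m) tˡʳ bound L)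
      where
      sum-tˡʳ : sum (map tˡʳ xs) ≡ S + (Dˡ + Dʳ)
      sum-tˡʳ = trans (sum-map-+ tˡ δʳ xs) (trans (cong (_+ Dʳ) (sum-map-+ height δˡ xs)) (+-assoc S Dˡ Dʳ))
      bound : ∀ u → u ∈ xs → tˡʳ u ≤ 2 + m
      bound u u∈ = ≤-trans (+-mono-≤ (+-mono-≤ (height≤ u u∈) (indicator≤1 (balanced? (1F ∷ u)))) (indicator≤1 (balanced? (u ∷ʳ 1F))))
        (≤-reflexive (solve 1 (λ m → m :+ con 1 :+ con 1 := con 2 :+ m) refl m))

open import Data.Fin using (Fin; toℕ)
open import Data.Fin.Properties using (toℕ-fromℕ<)
open import Data.Integer using (+_)
import Data.Integer as ℤ
import Data.Integer.Properties as ℤ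
open import Data.List using (map; length)
open import Data.Nat using (ℕ; zero; suc; 2+; _∸_; NonZero; NonTrivial; nonTrivial⇒nonZero)
import Data.Nat as ℕ
open import Data.Nat.DivMod using (_mod_; _%_; m%n<n; m≡m%n+[m/n]*n)
open import Data.Nat.ListAction using (sum)
import Data.Nat.Properties as ℕ
import Data.Nat.Solver as ℕSolver
open import Data.Product using (Σ-syntax; _,_)
open import Data.Rational using (ℚ; _+_; _*_; _-_; -_; _/_; ½; 1ℚ; toℚᵘ)
open import Data.Rational.Properties
open import Data.Rational.Solver
open +-*-Solver using (solve; _:+_; _:*_; _:-_; :-_; con; _:=_)
import Data.Rational.Unnormalised as ℚᵘ
import Data.Rational.Unnormalised.Properties as ℚᵘ
open import Relation.Binary.PropositionalEquality using (_≡_; refl; sym; trans; cong; cong₂; module ≡-Reasoning)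

open Counting
  using (nonFull; δˡ; δʳ; #nonFull≡; 2*sum-height-nonFull; 2*sum-δˡ; 2*sum-δʳ;
         ramps; tˡ; tʳ; tˡʳ; s-ramps; ramps₁-step; ramps₂-step; ramps₃-step)

-- Natural numbers inside the rationals

toℚᵘ-/ : ∀ n d .{{_ : NonZero d}} → toℚᵘ (+ n / d) ℚᵘ.≃ (+ n ℚᵘ./ d)
toℚᵘ-/ n (suc d) = toℚᵘ-fromℚᵘ (ℚᵘ.mkℚᵘ (+ n) d)

fromℕ-+ : ∀ m n → fromℕ (m ℕ.+ n) ≡ fromℕ m + fromℕ n
fromℕ-+ m n = toℚᵘ-injective (begin
  toℚᵘ (fromℕ (m ℕ.+ n))               ≈⟨ toℚᵘ-/ (m ℕ.+ n) 1 ⟩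
  + (m ℕ.+ n) ℚᵘ./ 1                   ≈⟨ ℚᵘ.*≡* (cong (ℤ._* ℤ.1ℤ) (sym (cong₂ ℤ._+_ (ℤ.*-identityʳ (+ m)) (ℤ.*-identityʳ (+ n))))) ⟩
  (+ m ℚᵘ./ 1) ℚᵘ.+ (+ n ℚᵘ./ 1)       ≈⟨ ℚᵘ.+-cong (toℚᵘ-/ m 1) (toℚᵘ-/ n 1) ⟨
  toℚᵘ (fromℕ m) ℚᵘ.+ toℚᵘ (fromℕ n)   ≈⟨ toℚᵘ-homo-+ (fromℕ m) (fromℕ n) ⟨
  toℚᵘ (fromℕ m + fromℕ n)             ∎)
  where open ℚᵘ.≃-Reasoning

fromℕ-* : ∀ m n → fromℕ (m ℕ.* n) ≡ fromℕ m * fromℕ n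
fromℕ-* m n = toℚᵘ-injective (begin
  toℚᵘ (fromℕ (m ℕ.* n))               ≈⟨ toℚᵘ-/ (m ℕ.* n) 1 ⟩
  + (m ℕ.* n) ℚᵘ./ 1                   ≈⟨ ℚᵘ.*≡* (cong (ℤ._* ℤ.1ℤ) (ℤ.pos-* m n)) ⟩
  (+ m ℚᵘ./ 1) ℚᵘ.* (+ n ℚᵘ./ 1)       ≈⟨ ℚᵘ.*-cong (toℚᵘ-/ m 1) (toℚᵘ-/ n 1) ⟨
  toℚᵘ (fromℕ m) ℚᵘ.* toℚᵘ (fromℕ n)   ≈⟨ toℚᵘ-homo-* (fromℕ m) (fromℕ n) ⟨
  toℚᵘ (fromℕ m * fromℕ n)             ∎)
  where open ℚᵘ.≃-Reasoning

/-*-cancel : ∀ n d .{{_ : NonZero d}} → (+ n / d) * fromℕ d ≡ fromℕ n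
/-*-cancel n d@(suc d′) = toℚᵘ-injective (begin
  toℚᵘ ((+ n / d) * fromℕ d)            ≈⟨ toℚᵘ-homo-* (+ n / d) (fromℕ d) ⟩
  toℚᵘ (+ n / d) ℚᵘ.* toℚᵘ (fromℕ d)    ≈⟨ ℚᵘ.*-cong (toℚᵘ-/ n d) (toℚᵘ-/ d 1) ⟩
  (+ n ℚᵘ./ d) ℚᵘ.* (+ d ℚᵘ./ 1)        ≈⟨ ℚᵘ.*≡* (trans (ℤ.*-identityʳ _) (cong (λ k → + n ℤ.* + k) (sym (ℕ.*-identityʳ d)))) ⟩
  + n ℚᵘ./ 1                            ≈⟨ toℚᵘ-/ n 1 ⟨
  toℚᵘ (fromℕ n)                        ∎)
  where open ℚᵘ.≃-Reasoning

fromℕ-% : ∀ L c .{{_ : NonZero c}} → toℕ (L mod c) ≡ L % c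
fromℕ-% L c = toℕ-fromℕ< (m%n<n L c)

-- The polynomial `a L² + b L` satisfies the recurrence when `2 a c = T` and `b c = T c / 2 - S`, so
-- its difference from `f` is `c`-periodic.
module Quadratic (c : ℕ) .{{_ : NonZero c}} (f : ℕ → ℕ) (T S : ℕ)
  (step : ∀ L → f (L ℕ.+ c) ℕ.+ S ≡ f L ℕ.+ T ℕ.* (L ℕ.+ c))
  (a b : ℚ) (a-eq : a * (fromℕ c + fromℕ c) ≡ fromℕ T)
  (b-eq : b * fromℕ c ≡ ½ * fromℕ T * fromℕ c - fromℕ S) where

  private
    poly : ℚ → ℚ
    poly x = a * (x * x) + b * x

  periodic : Fin c → ℚ
  periodic r = fromℕ (f (toℕ r)) - poly (fromℕ (toℕ r))

  private
    residual : ℕ → ℚ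
    residual L = fromℕ (f L) - poly (fromℕ L)

    residual-step : ∀ L → residual (L ℕ.+ c) ≡ residual L
    residual-step L = begin
      fromℕ (f (L ℕ.+ c)) - poly (fromℕ (L ℕ.+ c))
        ≡⟨ cong₂ (λ F x → F - poly x) f-step (fromℕ-+ L c) ⟩
      F + T′ * (l + C) - S′ - poly (l + C)
        -- The identity isolates two brackets, which vanish by `a-eq` and `b-eq`.
        ≡⟨ solve 7 (λ F T S l C a b → F :+ T :* (l :+ C) :- S :- (a :* ((l :+ C) :* (l :+ C)) :+ b :* (l :+ C))
             := F :- (a :* (l :* l) :+ b :* l) :+ (T :- a :* (C :+ C)) :* (l :+ con ½ :* C) :+ (con ½ :* T :* C :- S :- b :* C))
             refl F T′ S′ l C a b ⟩
      F - poly l + (T′ - a * (C + C)) * (l + ½ * C) + (½ * T′ * C - S′ - b * C)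
        ≡⟨ cong₂ (λ x y → F - poly l + (T′ - x) * (l + ½ * C) + (½ * T′ * C - S′ - y)) a-eq b-eq ⟩
      F - poly l + (T′ - T′) * (l + ½ * C) + (½ * T′ * C - S′ - (½ * T′ * C - S′))
        ≡⟨ solve 4 (λ G T X Y → G :+ (T :- T) :* X :+ (Y :- Y) := G) refl (F - poly l) T′ (l + ½ * C) (½ * T′ * C - S′) ⟩
      F - poly l ∎
      where
      open ≡-Reasoning
      F = fromℕ (f L)
      T′ = fromℕ T
      S′ = fromℕ S
      l = fromℕ L
      C = fromℕ c
      f-step : fromℕ (f (L ℕ.+ c)) ≡ F + T′ * (l + C) - S′
      f-step = begin
        fromℕ (f (L ℕ.+ c))                          ≡⟨ solve 2 (λ x y → x := x :+ y :- y) refl (fromℕ (f (L ℕ.+ c))) S′ ⟩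
        fromℕ (f (L ℕ.+ c)) + S′ - S′                ≡⟨ cong (_- S′) (fromℕ-+ (f (L ℕ.+ c)) S) ⟨
        fromℕ (f (L ℕ.+ c) ℕ.+ S) - S′               ≡⟨ cong (λ n → fromℕ n - S′) (step L) ⟩
        fromℕ (f L ℕ.+ T ℕ.* (L ℕ.+ c)) - S′         ≡⟨ cong (_- S′) (fromℕ-+ (f L) (T ℕ.* (L ℕ.+ c))) ⟩
        F + fromℕ (T ℕ.* (L ℕ.+ c)) - S′             ≡⟨ cong (λ x → F + x - S′) (trans (fromℕ-* T (L ℕ.+ c)) (cong (T′ *_) (fromℕ-+ L c))) ⟩
        F + T′ * (l + C) - S′                        ∎

    residual-% : ∀ r k → residual (r ℕ.+ k ℕ.* c) ≡ residual r
    residual-% r zero    = cong residual (ℕ.+-identityʳ r)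
    residual-% r (suc k) = trans (cong residual (trans (cong (r ℕ.+_) (ℕ.+-comm c (k ℕ.* c))) (sym (ℕ.+-assoc r (k ℕ.* c) c))))
                             (trans (residual-step (r ℕ.+ k ℕ.* c)) (residual-% r k))

  quadratic : ∀ L → fromℕ (f L) ≡ a * (fromℕ L * fromℕ L) + b * fromℕ L + periodic (L mod c)
  quadratic L = begin
    fromℕ (f L)                              ≡⟨ solve 2 (λ x y → x := y :+ (x :- y)) refl (fromℕ (f L)) (poly (fromℕ L)) ⟩
    poly (fromℕ L) + residual L              ≡⟨ cong (λ n → poly (fromℕ L) + residual n) (m≡m%n+[m/n]*n L c) ⟩
    poly (fromℕ L) + residual (L % c ℕ.+ (L ℕ./ c) ℕ.* c) ≡⟨ cong (_+_ (poly (fromℕ L))) (residual-% (L % c) (L ℕ./ c)) ⟩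
    poly (fromℕ L) + residual (L % c)        ≡⟨ cong (λ n → poly (fromℕ L) + residual n) (fromℕ-% L c) ⟨
    poly (fromℕ L) + periodic (L mod c)      ∎
    where open ≡-Reasoning

-- Coefficients of the quasi-polynomial

module _ (n : ℕ) where

  private
    m = suc n
    h = suc m
    xs = nonFull m
    T S Δ Φ : ℚ
    T = fromℕ (length xs)
    S = fromℕ (sum (map height xs))
    Δ = fromℕ (sum (map δˡ xs) ℕ.+ sum (map δʳ xs))
    Φ = fromℕ (sum (map φ (range h)))
    M = fromℕ m

    denominator = h ℕ.* (h ℕ.^ 2 ∸ 1)

    instance
      denominator≢0 : NonZero denominator
      denominator≢0 = α-denominator-nonZero h

    -- The inverse of each period `h - 1`, `h`, `h + 1` is `ω` times the product of the other two,
    -- so the identities between coefficients are polynomial up to `collapse`.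
    ω = + 1 / denominator

    h≡ : fromℕ h ≡ M + 1ℚ
    h≡ = trans (fromℕ-+ 1 m) (+-comm 1ℚ M)

    1+h≡ : fromℕ (suc h) ≡ M + 1ℚ + 1ℚ
    1+h≡ = trans (fromℕ-+ 1 h) (trans (+-comm 1ℚ (fromℕ h)) (cong (_+ 1ℚ) h≡))

    denominator≡ : fromℕ denominator ≡ (M + 1ℚ) * (M * (M + 1ℚ + 1ℚ))
    denominator≡ = begin
      fromℕ (h ℕ.* (h ℕ.^ 2 ∸ 1))        ≡⟨ cong (λ k → fromℕ (h ℕ.* k)) (cong (_∸ 1) square) ⟩
      fromℕ (h ℕ.* (m ℕ.* suc h))        ≡⟨ trans (fromℕ-* h (m ℕ.* suc h)) (cong (fromℕ h *_) (fromℕ-* m (suc h))) ⟩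
      fromℕ h * (M * fromℕ (suc h))      ≡⟨ cong₂ (λ x y → x * (M * y)) h≡ 1+h≡ ⟩
      (M + 1ℚ) * (M * (M + 1ℚ + 1ℚ))     ∎
      where
      open ≡-Reasoning
      square : h ℕ.^ 2 ≡ suc (m ℕ.* suc h)
      square = ℕ-solve 1 (λ m → (ℕ-con 1 ⊞ m) ⊠ ((ℕ-con 1 ⊞ m) ⊠ ℕ-con 1) ⊜ ℕ-con 1 ⊞ m ⊠ (ℕ-con 2 ⊞ m)) refl m
        where open ℕSolver.+-*-Solver using () renaming (solve to ℕ-solve; _:+_ to _⊞_; _:*_ to _⊠_; con to ℕ-con; _:=_ to _⊜_)

    unit : (M + 1ℚ) * (M * (M + 1ℚ + 1ℚ)) * ω ≡ 1ℚ
    unit = trans (*-comm _ ω) (trans (cong (ω *_) (sym denominator≡)) (/-*-cancel 1 denominator))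

    collapse : ∀ x → x * ((M + 1ℚ) * (M * (M + 1ℚ + 1ℚ)) * ω) ≡ x
    collapse x = trans (cong (x *_) unit) (*-identityʳ x)

    α≡ : α h ≡ T * ω
    α≡ = begin
      α h                                                   ≡⟨ collapse (α h) ⟨
      α h * ((M + 1ℚ) * (M * (M + 1ℚ + 1ℚ)) * ω)            ≡⟨ cong (λ d → α h * (d * ω)) denominator≡ ⟨
      α h * (fromℕ denominator * ω)                         ≡⟨ *-assoc (α h) (fromℕ denominator) ω ⟨
      α h * fromℕ denominator * ω                           ≡⟨ cong (_* ω) (/-*-cancel (sum (map (λ i → (h ∸ i) ℕ.* φ i) (range m))) denominator) ⟩
      fromℕ (sum (map (λ i → (h ∸ i) ℕ.* φ i) (range m))) * ω ≡⟨ cong (λ t → fromℕ t * ω) (#nonFull≡ m) ⟨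
      T * ω                                                 ∎
      where open ≡-Reasoning

    β≡ : β h ≡ Φ * M * ω
    β≡ = begin
      β h                                                   ≡⟨ collapse (β h) ⟨
      β h * ((M + 1ℚ) * (M * (M + 1ℚ + 1ℚ)) * ω)            ≡⟨ solve 5 (λ b x y M ω → b :* (x :* (M :* y) :* ω) := b :* (x :* y) :* M :* ω) refl (β h) (M + 1ℚ) (M + 1ℚ + 1ℚ) M ω ⟩
      β h * ((M + 1ℚ) * (M + 1ℚ + 1ℚ)) * M * ω              ≡⟨ cong (λ d → β h * d * M * ω) (trans (fromℕ-* h (suc h)) (cong₂ _*_ h≡ 1+h≡)) ⟨
      β h * fromℕ (h ℕ.* suc h) * M * ω                     ≡⟨ cong (λ d → d * M * ω) (/-*-cancel (sum (map φ (range h))) (h ℕ.* suc h)) ⟩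
      Φ * M * ω                                             ∎
      where open ≡-Reasoning

    -- For each period `c`, the leading coefficient is the number of summands over `2c`, and the
    -- linear one is half that number minus the total offset over `c`. The family of period `h` has
    -- two summands per word.
    a₁ a₂ a₃ b₁ b₂ b₃ : ℚ
    a₁ = ½ * T * ((M + 1ℚ) * (M + 1ℚ + 1ℚ)) * ω
    a₂ = T * (M * (M + 1ℚ + 1ℚ)) * ω
    a₃ = ½ * T * (M * (M + 1ℚ)) * ω
    b₁ = ½ * T - S * ((M + 1ℚ) * (M + 1ℚ + 1ℚ)) * ω
    b₂ = T - (S + S + Δ) * (M * (M + 1ℚ + 1ℚ)) * ω
    b₃ = ½ * T - (S + Δ) * (M * (M + 1ℚ)) * ω

    2T≡ : fromℕ (2 ℕ.* length xs) ≡ T + T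
    2T≡ = trans (cong (λ k → fromℕ (length xs ℕ.+ k)) (ℕ.+-identityʳ _)) (fromℕ-+ (length xs) (length xs))

    S₂ S₃ : ℕ
    S₂ = 2 ℕ.* sum (map height xs) ℕ.+ (sum (map δˡ xs) ℕ.+ sum (map δʳ xs))
    S₃ = sum (map height xs) ℕ.+ (sum (map δˡ xs) ℕ.+ sum (map δʳ xs))

    S₂≡ : fromℕ S₂ ≡ S + S + Δ
    S₂≡ = trans (fromℕ-+ (2 ℕ.* sum (map height xs)) _)
      (cong (_+ Δ) (trans (cong (λ k → fromℕ (sum (map height xs) ℕ.+ k)) (ℕ.+-identityʳ _)) (fromℕ-+ (sum (map height xs)) _)))

    a₁-eq : a₁ * (M + M) ≡ T
    a₁-eq = trans
      (solve 3 (λ c T M → let x = M :+ con 1ℚ; y = M :+ con 1ℚ :+ con 1ℚ in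
         con ½ :* T :* (x :* y) :* c :* (M :+ M) := T :* (x :* (M :* y) :* c)) refl ω T M)
      (collapse T)

    b₁-eq : b₁ * M ≡ ½ * T * M - S
    b₁-eq = trans
      (solve 4 (λ c T M S → let x = M :+ con 1ℚ; y = M :+ con 1ℚ :+ con 1ℚ in
         (con ½ :* T :- S :* (x :* y) :* c) :* M := con ½ :* T :* M :- S :* (x :* (M :* y) :* c)) refl ω T M S)
      (cong (λ t → ½ * T * M - t) (collapse S))

    a₂-eq : a₂ * (fromℕ h + fromℕ h) ≡ fromℕ (2 ℕ.* length xs)
    a₂-eq = begin
      a₂ * (fromℕ h + fromℕ h)         ≡⟨ cong (λ x → a₂ * (x + x)) h≡ ⟩
      a₂ * (M + 1ℚ + (M + 1ℚ))         ≡⟨ solve 3 (λ c T M → let x = M :+ con 1ℚ; y = M :+ con 1ℚ :+ con 1ℚ in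
                                            T :* (M :* y) :* c :* (x :+ x) := (T :+ T) :* (x :* (M :* y) :* c)) refl ω T M ⟩
      (T + T) * _                      ≡⟨ collapse (T + T) ⟩
      T + T                            ≡⟨ 2T≡ ⟨
      fromℕ (2 ℕ.* length xs)          ∎
      where open ≡-Reasoning

    b₂-eq : b₂ * fromℕ h ≡ ½ * fromℕ (2 ℕ.* length xs) * fromℕ h - fromℕ S₂
    b₂-eq = begin
      b₂ * fromℕ h                                      ≡⟨ cong (b₂ *_) h≡ ⟩
      b₂ * (M + 1ℚ)                                     ≡⟨ solve 4 (λ c T M S → let x = M :+ con 1ℚ; y = M :+ con 1ℚ :+ con 1ℚ in
                                                             (T :- S :* (M :* y) :* c) :* x := con ½ :* (T :+ T) :* x :- S :* (x :* (M :* y) :* c)) refl ω T M (S + S + Δ) ⟩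
      ½ * (T + T) * (M + 1ℚ) - (S + S + Δ) * _          ≡⟨ cong (λ t → ½ * (T + T) * (M + 1ℚ) - t) (collapse (S + S + Δ)) ⟩
      ½ * (T + T) * (M + 1ℚ) - (S + S + Δ)              ≡⟨ cong₂ (λ t s → ½ * t * (M + 1ℚ) - s) 2T≡ S₂≡ ⟨
      ½ * fromℕ (2 ℕ.* length xs) * (M + 1ℚ) - fromℕ S₂ ≡⟨ cong (λ x → ½ * fromℕ (2 ℕ.* length xs) * x - fromℕ S₂) h≡ ⟨
      ½ * fromℕ (2 ℕ.* length xs) * fromℕ h - fromℕ S₂  ∎
      where open ≡-Reasoning

    a₃-eq : a₃ * (fromℕ (suc h) + fromℕ (suc h)) ≡ T
    a₃-eq = begin
      a₃ * (fromℕ (suc h) + fromℕ (suc h))     ≡⟨ cong (λ x → a₃ * (x + x)) 1+h≡ ⟩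
      a₃ * (M + 1ℚ + 1ℚ + (M + 1ℚ + 1ℚ))       ≡⟨ solve 3 (λ c T M → let x = M :+ con 1ℚ; y = M :+ con 1ℚ :+ con 1ℚ in
                                                    con ½ :* T :* (M :* x) :* c :* (y :+ y) := T :* (x :* (M :* y) :* c)) refl ω T M ⟩
      T * _                                    ≡⟨ collapse T ⟩
      T                                        ∎
      where open ≡-Reasoning

    b₃-eq : b₃ * fromℕ (suc h) ≡ ½ * T * fromℕ (suc h) - fromℕ S₃
    b₃-eq = begin
      b₃ * fromℕ (suc h)                        ≡⟨ cong (b₃ *_) 1+h≡ ⟩
      b₃ * (M + 1ℚ + 1ℚ)                        ≡⟨ solve 4 (λ c T M S → let x = M :+ con 1ℚ; y = M :+ con 1ℚ :+ con 1ℚ in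
                                                     (con ½ :* T :- S :* (M :* x) :* c) :* y := con ½ :* T :* y :- S :* (x :* (M :* y) :* c)) refl ω T M (S + Δ) ⟩
      ½ * T * (M + 1ℚ + 1ℚ) - (S + Δ) * _       ≡⟨ cong (λ t → ½ * T * (M + 1ℚ + 1ℚ) - t) (collapse (S + Δ)) ⟩
      ½ * T * (M + 1ℚ + 1ℚ) - (S + Δ)           ≡⟨ cong₂ (λ x s → ½ * T * x - s) 1+h≡ (fromℕ-+ (sum (map height xs)) _) ⟨
      ½ * T * fromℕ (suc h) - fromℕ S₃          ∎
      where open ≡-Reasoning

    module Q₁ = Quadratic m (ramps xs m height) (length xs) (sum (map height xs)) (ramps₁-step n) a₁ b₁ a₁-eq b₁-eq

    ramps₂ : ℕ → ℕ
    ramps₂ L = ramps xs h tˡ L ℕ.+ ramps xs h tʳ L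

    module Q₂ = Quadratic h ramps₂ (2 ℕ.* length xs) S₂ (ramps₂-step n) a₂ b₂ a₂-eq b₂-eq

    module Q₃ = Quadratic (suc h) (ramps xs (suc h) tˡʳ) (length xs) S₃ (ramps₃-step n) a₃ b₃ a₃-eq b₃-eq

    -- The second difference `(M + 1)(M + 2) - 2 M (M + 2) + M (M + 1)` equals 2, which cancels `½`.
    a≡ : a₁ - a₂ + a₃ ≡ α h
    a≡ = trans (solve 3 (λ c T M → let x = M :+ con 1ℚ; y = M :+ con 1ℚ :+ con 1ℚ in
      con ½ :* T :* (x :* y) :* c :- T :* (M :* y) :* c :+ con ½ :* T :* (M :* x) :* c := T :* c) refl ω T M) (sym α≡)

    two-sum : ∀ k → fromℕ (2 ℕ.* k) ≡ fromℕ k + fromℕ k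
    two-sum k = trans (cong (λ t → fromℕ (k ℕ.+ t)) (ℕ.+-identityʳ k)) (fromℕ-+ k k)

    heights : (M + S) + (M + S) ≡ M * (1ℚ + T)
    heights = begin
      (M + S) + (M + S)                              ≡⟨ cong₂ _+_ (fromℕ-+ m _) (fromℕ-+ m _) ⟨
      fromℕ (m ℕ.+ sum (map height xs)) + fromℕ (m ℕ.+ sum (map height xs)) ≡⟨ two-sum (m ℕ.+ sum (map height xs)) ⟨
      fromℕ (2 ℕ.* (m ℕ.+ sum (map height xs)))      ≡⟨ cong fromℕ (2*sum-height-nonFull m) ⟩
      fromℕ (m ℕ.* suc (length xs))                  ≡⟨ trans (fromℕ-* m (suc (length xs))) (cong (M *_) (fromℕ-+ 1 (length xs))) ⟩
      M * (1ℚ + T)                                   ∎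
      where open ≡-Reasoning

    one-sided : ∀ {d} → 2 ℕ.* suc d ≡ suc (length xs) ℕ.+ sum (map φ (range h)) → (1ℚ + fromℕ d) + (1ℚ + fromℕ d) ≡ 1ℚ + T + Φ
    one-sided {d} eq = begin
      (1ℚ + fromℕ d) + (1ℚ + fromℕ d)   ≡⟨ cong₂ _+_ (fromℕ-+ 1 d) (fromℕ-+ 1 d) ⟨
      fromℕ (suc d) + fromℕ (suc d)     ≡⟨ two-sum (suc d) ⟨
      fromℕ (2 ℕ.* suc d)               ≡⟨ cong fromℕ eq ⟩
      fromℕ (suc (length xs) ℕ.+ sum (map φ (range h))) ≡⟨ trans (fromℕ-+ (suc (length xs)) _) (cong (_+ Φ) (fromℕ-+ 1 (length xs))) ⟩
      1ℚ + T + Φ                        ∎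
      where open ≡-Reasoning

    Δ≡ : Δ ≡ T + Φ - 1ℚ
    Δ≡ = begin
      Δ                                     ≡⟨ fromℕ-+ (sum (map δˡ xs)) _ ⟩
      -- Each one-sided total `d` is recovered from the doubled `1 + d`, the form that `one-sided`
      -- evaluates.
      dˡ + dʳ                               ≡⟨ solve 2 (λ x y → x :+ y := con ½ :* ((con 1ℚ :+ x :+ (con 1ℚ :+ x)) :+ (con 1ℚ :+ y :+ (con 1ℚ :+ y))) :- (con 1ℚ :+ con 1ℚ)) refl dˡ dʳ ⟩
      ½ * ((1ℚ + dˡ + (1ℚ + dˡ)) + (1ℚ + dʳ + (1ℚ + dʳ))) - (1ℚ + 1ℚ) ≡⟨ cong₂ (λ x y → ½ * (x + y) - (1ℚ + 1ℚ)) (one-sided (2*sum-δˡ m)) (one-sided (2*sum-δʳ m)) ⟩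
      ½ * ((1ℚ + T + Φ) + (1ℚ + T + Φ)) - (1ℚ + 1ℚ) ≡⟨ solve 2 (λ T P → con ½ :* ((con 1ℚ :+ T :+ P) :+ (con 1ℚ :+ T :+ P)) :- (con 1ℚ :+ con 1ℚ) := T :+ P :- con 1ℚ) refl T Φ ⟩
      T + Φ - 1ℚ                            ∎
      where
      open ≡-Reasoning
      dˡ = fromℕ (sum (map δˡ xs))
      dʳ = fromℕ (sum (map δʳ xs))

    b≡ : b₁ - b₂ + b₃ ≡ β h
    b≡ = begin
      b₁ - b₂ + b₃
        -- The halves of `T` cancel and `(M Δ - 2 S) ω` is left; `M + M` is added and subtracted so
        -- that `S` occurs as `M + S`, as in `heights`.
        ≡⟨ solve 5 (λ c T M S D → let x = M :+ con 1ℚ; y = M :+ con 1ℚ :+ con 1ℚ in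
             (con ½ :* T :- S :* (x :* y) :* c) :- (T :- (S :+ S :+ D) :* (M :* y) :* c) :+ (con ½ :* T :- (S :+ D) :* (M :* x) :* c)
             := (M :* D :+ (M :+ M) :- ((M :+ S) :+ (M :+ S))) :* c) refl ω T M S Δ ⟩
      (M * Δ + (M + M) - ((M + S) + (M + S))) * ω
        ≡⟨ cong₂ (λ d s → (M * d + (M + M) - s) * ω) Δ≡ heights ⟩
      (M * (T + Φ - 1ℚ) + (M + M) - M * (1ℚ + T)) * ω
        ≡⟨ solve 4 (λ c T M P → (M :* (T :+ P :- con 1ℚ) :+ (M :+ M) :- M :* (con 1ℚ :+ T)) :* c := P :* M :* c) refl ω T M Φ ⟩
      Φ * M * ω
        ≡⟨ β≡ ⟨
      β h ∎
      where open ≡-Reasoning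

  u : Fin m → ℚ
  u = Q₁.periodic

  -- The ramps of period `h` are the subtracted ones, hence the sign.
  v : Fin h → ℚ
  v r = - Q₂.periodic r

  w : Fin (suc h) → ℚ
  w = Q₃.periodic

  s-quasipolynomial : ∀ L → fromℕ (s (+ L) (+ h)) ≡
    α h * (fromℕ L * fromℕ L) + β h * fromℕ L + u (L mod m) + v (L mod h) + w (L mod suc h)
  s-quasipolynomial L = begin
    fromℕ (s (+ L) (+ h))
      ≡⟨ solve 2 (λ x y → x := x :+ y :- y) refl (fromℕ (s (+ L) (+ h))) (fromℕ F₂) ⟩
    fromℕ (s (+ L) (+ h)) + fromℕ F₂ - fromℕ F₂
      ≡⟨ cong (_- fromℕ F₂) (fromℕ-+ (s (+ L) (+ h)) F₂) ⟨
    fromℕ (s (+ L) (+ h) ℕ.+ F₂) - fromℕ F₂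
      ≡⟨ cong (λ k → fromℕ k - fromℕ F₂) (s-ramps n L) ⟩
    fromℕ (ramps xs m height L ℕ.+ ramps xs (suc h) tˡʳ L) - fromℕ F₂
      ≡⟨ cong (_- fromℕ F₂) (fromℕ-+ (ramps xs m height L) _) ⟩
    fromℕ (ramps xs m height L) + fromℕ (ramps xs (suc h) tˡʳ L) - fromℕ F₂
      ≡⟨ cong₂ _-_ (cong₂ _+_ (Q₁.quadratic L) (Q₃.quadratic L)) (Q₂.quadratic L) ⟩
    (a₁ * (l * l) + b₁ * l + p₁) + (a₃ * (l * l) + b₃ * l + p₃) - (a₂ * (l * l) + b₂ * l + p₂)
      ≡⟨ solve 10 (λ a b c d e f l p q r →
           (a :* (l :* l) :+ b :* l :+ p) :+ (e :* (l :* l) :+ f :* l :+ r) :- (c :* (l :* l) :+ d :* l :+ q)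
           := (a :- c :+ e) :* (l :* l) :+ (b :- d :+ f) :* l :+ p :+ (:- q) :+ r) refl a₁ b₁ a₂ b₂ a₃ b₃ l p₁ p₂ p₃ ⟩
    (a₁ - a₂ + a₃) * (l * l) + (b₁ - b₂ + b₃) * l + p₁ + - p₂ + p₃
      ≡⟨ cong₂ (λ a b → a * (l * l) + b * l + p₁ + - p₂ + p₃) a≡ b≡ ⟩
    α h * (l * l) + β h * l + p₁ + - p₂ + p₃ ∎
    where
    open ≡-Reasoning
    l = fromℕ L
    F₂ = ramps₂ L
    p₁ = u (L mod m)
    p₂ = Q₂.periodic (L mod h)
    p₃ = w (L mod suc h)

theorem11 : (h : ℕ) → .{{_ : NonTrivial h}} →
    let instance
          h∸1≢0 = pred-nonZero h
          h≢0   = nonTrivial⇒nonZero h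
    in
    Σ[ u ∈ (Fin (h ∸ 1) → ℚ) ] Σ[ v ∈ (Fin h → ℚ) ] Σ[ w ∈ (Fin (suc h) → ℚ) ]
      ((L : ℕ) →
        fromℕ (s (+ L) (+ h)) ≡
          α h * (fromℕ L * fromℕ L) + β h * fromℕ L
            + u (L mod (h ∸ 1)) + v (L mod h) + w (L mod suc h))
theorem11 (2+ n) = u n , v n , w n , s-quasipolynomial n
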